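{- For all positive integers $r,c$, as formal power series in $s$ with coefficients in $\mathbb{Z}[t]$, $$ \sum_{\pi \in \mathcal{P}(r,c)}A_\pi(t)\,s^{|\pi|}= \prod_{i=1}^{r}\prod_{j=1}^{c} \frac{1-ts^{i+j-1}}{1-s^{i+j-1}}. $$ In particular, $$ \sum_{\pi \in \mathcal{P}}A_\pi(t)\,s^{|\pi|}= \prod_{n=1}^{\infty} \left(\frac{1-ts^n}{1-s^{n}}\right)^n. $$
   Context: A plane partition is an array $\pi=(\pi(i,j))_{i,j\ge 1}$ of nonnegative integers, only finitely many nonzero, nonincreasing along each row and each column; its support is the set of boxes $(i,j)$ with $\pi(i,j)>0$, and $|\pi|=\sum_{i,j}\pi(i,j)$. $\mathcal{P}$ is the set of all plane partitions and $\mathcal{P}(r,c)$ the set of those with $\pi(i,j)=0$ whenever $i>r$ or $j>c$. A connected component of $\pi$ is a maximal set of boxes of the support, connected through boxes sharing an edge, all filled with the same number. If a box $(i,j)$ lies in a connected component $C$, its level is the smallest positive integer $h$ such that $(i+h,j+h)\notin C$. A border component is a maximal edge-connected subset of a connected component all of whose boxes have the same level; its level is that common level. For a connected component $C$ let $n_i$ be the number of border components of $C$ of level $i$, and $P_C(t)=\prod_{i\ge1}(1-t^i)^{n_i}$. Then $A_\pi(t)=\prod_C P_C(t)$, the product over all connected components $C$ of $\pi$. -}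

module Defs where

open import Data.Bool using (Bool; true; false; _∧_; _∨_; not; if_then_else_)
open import Data.Nat using (ℕ; zero; suc; _+_; _*_; _∸_; _≡ᵇ_; _<ᵇ_)
open import Data.Integer using (ℤ; 0ℤ; 1ℤ; -1ℤ) renaming (_+_ to _+ℤ_; _*_ to _*ℤ_)
open import Data.List using (List; []; _∷_; [_]; map; foldr; upTo; applyUpTo; concatMap; filterᵇ; length)
open import Data.Bool.ListAction using (any; all)
open import Data.Vec using (Vec; toList) renaming ([] to []ᵥ; _∷_ to _∷ᵥ_)
open import Data.Product using (_×_; _,_)
open import Relation.Binary.PropositionalEquality using (_≡_)

sumTo : ℕ → (ℕ → ℤ) → ℤ
sumTo zero    f = f 0
sumTo (suc n) f = sumTo n f +ℤ f (suc n)

-- ℤ[t] : a polynomial in t is given by its coefficient sequence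
-- (p k = coefficient of t^k).  All polynomials built below have
-- finite support.

Pol : Set
Pol = ℕ → ℤ

zeroPol : Pol
zeroPol _ = 0ℤ

onePol : Pol
onePol zero    = 1ℤ
onePol (suc _) = 0ℤ

_+P_ : Pol → Pol → Pol
(p +P q) k = p k +ℤ q k

_*P_ : Pol → Pol → Pol
(p *P q) k = sumTo k (λ a → p a *ℤ q (k ∸ a))

sumPol : List Pol → Pol
sumPol = foldr _+P_ zeroPol

prodPol : List Pol → Pol
prodPol = foldr _*P_ onePol

powPol : Pol → ℕ → Pol
powPol p zero    = onePol
powPol p (suc n) = p *P powPol p n

-- 1 - t^i  (used for i ≥ 1)
oneMinusTPow : ℕ → Pol
oneMinusTPow i k = if k ≡ᵇ 0 then 1ℤ else (if k ≡ᵇ i then -1ℤ else 0ℤ)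

-- ℤ[t][[s]] : a formal power series in s with coefficients in ℤ[t],
-- given by its coefficient sequence (f n = coefficient of s^n).

PS : Set
PS = ℕ → Pol

_≋_ : PS → PS → Set
f ≋ g = ∀ n k → f n k ≡ g n k

onePS : PS
onePS zero    = onePol
onePS (suc _) = zeroPol

_*S_ : PS → PS → PS
(f *S g) n k = sumTo n (λ a → (f a *P g (n ∸ a)) k)

prodPS : List PS → PS
prodPS = foldr _*S_ onePS

powPS : PS → ℕ → PS
powPS f zero    = onePS
powPS f (suc n) = f *S powPS f n

-- 1 - t s^m  (used for m ≥ 1)
oneMinusTSPow : ℕ → PS
oneMinusTSPow m n k =
  if n ≡ᵇ 0 then onePol k
  else (if (n ≡ᵇ m) ∧ (k ≡ᵇ 1) then -1ℤ else 0ℤ)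

-- 1 / (1 - s^m) = Σ_{j ≥ 0} s^{jm}   (the inverse of 1 - s^m, m ≥ 1)
invOneMinusSPow : ℕ → PS
invOneMinusSPow m n =
  if any (λ j → (j * m) ≡ᵇ n) (upTo (suc n)) then onePol else zeroPol

-- infinite product Π_{m ≥ 1} F m, for factors with F m ≡ 1 mod s^m:
-- the coefficient of s^n is that of the finite product Π_{m=1}^{n} F m
infProdPS : (ℕ → PS) → PS
infProdPS F n = prodPS (applyUpTo (λ i → F (suc i)) n) n

-- Boxes, arrays and A_π.
-- Boxes are 0-indexed pairs (i , j); box (i , j) here is the box
-- (i+1 , j+1) of the paper.  An array is a function ℕ → ℕ → ℕ; we only
-- look at it inside the r × c rectangle [0,r) × [0,c).

Box : Set
Box = ℕ × ℕ

boxes : ℕ → ℕ → List Box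
boxes r c = concatMap (λ i → map (λ j → (i , j)) (upTo c)) (upTo r)

eqBox : Box → Box → Bool
eqBox (i , j) (i' , j') = (i ≡ᵇ i') ∧ (j ≡ᵇ j')

lexLt : Box → Box → Bool
lexLt (i , j) (i' , j') = (i <ᵇ i') ∨ ((i ≡ᵇ i') ∧ (j <ᵇ j'))

edgeAdj : Box → Box → Bool
edgeAdj (i , j) (i' , j') =
  ((i ≡ᵇ i') ∧ ((suc j ≡ᵇ j') ∨ (suc j' ≡ᵇ j))) ∨
  ((j ≡ᵇ j') ∧ ((suc i ≡ᵇ i') ∨ (suc i' ≡ᵇ i)))

reachWith : ℕ → ℕ → (Box → Box → Bool) → ℕ → Box → Box → Bool
reachWith r c E zero    b b' = eqBox b b'
reachWith r c E (suc k) b b' =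
  reachWith r c E k b b' ∨ any (λ x → reachWith r c E k b x ∧ E x b') (boxes r c)

module AOf (r c : ℕ) (p : ℕ → ℕ → ℕ) where

  val : Box → ℕ
  val (i , j) = p i j

  inSupp : Box → Bool
  inSupp (i , j) = (i <ᵇ r) ∧ (j <ᵇ c) ∧ (0 <ᵇ p i j)

  -- edge of the graph whose connected pieces are the connected components
  cEdge : Box → Box → Bool
  cEdge b b' = inSupp b ∧ inSupp b' ∧ edgeAdj b b' ∧ (val b ≡ᵇ val b')

  sameC : Box → Box → Bool
  sameC b b' = inSupp b ∧ inSupp b' ∧ reachWith r c cEdge (r * c) b b'

  -- level of box b in its connected component C: the least h ≥ 1 with
  -- (i+h , j+h) ∉ C (such an h is ≤ r since the support is inside the box)
  level : Box → ℕ
  level (i , j) = go 1 r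
    where
    go : ℕ → ℕ → ℕ
    go h zero    = h
    go h (suc f) = if sameC (i , j) (i + h , j + h) then go (suc h) f else h

  -- edge of the graph whose connected pieces are the border components
  bEdge : Box → Box → Bool
  bEdge b b' = cEdge b b' ∧ (level b ≡ᵇ level b')

  sameB : Box → Box → Bool
  sameB b b' = inSupp b ∧ inSupp b' ∧ reachWith r c bEdge (r * c) b b'

  isRep : (Box → Box → Bool) → Box → Bool
  isRep R b = inSupp b ∧ not (any (λ x → lexLt x b ∧ R x b) (boxes r c))

  components : List Box
  components = filterᵇ (isRep sameC) (boxes r c)

  nLev : Box → ℕ → ℕ
  nLev b i = length (filterᵇ (λ x → isRep sameB x ∧ sameC b x ∧ (level x ≡ᵇ i)) (boxes r c))

  -- P_C(t) = Π_{i ≥ 1} (1 - t^i)^{n_i}; n_i = 0 for i > r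
  P : Box → Pol
  P b = prodPol (applyUpTo (λ i → powPol (oneMinusTPow (suc i)) (nLev b (suc i))) r)

  A : Pol
  A = prodPol (map P components)

allVecs : {A : Set} → (m : ℕ) → List A → List (Vec A m)
allVecs zero    xs = [ []ᵥ ]
allVecs (suc m) xs = concatMap (λ x → map (x ∷ᵥ_) (allVecs m xs)) xs

nthOr0 : List ℕ → ℕ → ℕ
nthOr0 []       _       = 0
nthOr0 (x ∷ xs) zero    = x
nthOr0 (x ∷ xs) (suc n) = nthOr0 xs n

nthRow : {c : ℕ} → List (Vec ℕ c) → ℕ → List ℕ
nthRow []       _       = []
nthRow (x ∷ xs) zero    = toList x
nthRow (x ∷ xs) (suc n) = nthRow xs n

-- an r × c array, viewed as π(i,j) (0-indexed), with π = 0 outside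
entry : {r c : ℕ} → Vec (Vec ℕ c) r → ℕ → ℕ → ℕ
entry M i j = nthOr0 (nthRow (toList M) i) j

isPlanePartition : {r c : ℕ} → Vec (Vec ℕ c) r → Bool
isPlanePartition {r} {c} M =
  all (λ { (i , j) → (entry M (suc i) j <ᵇ suc (entry M i j)) ∧
                     (entry M i (suc j) <ᵇ suc (entry M i j)) })
      (boxes r c)

size : {r c : ℕ} → Vec (Vec ℕ c) r → ℕ
size {r} {c} M = foldr (λ { (i , j) s → entry M i j + s }) 0 (boxes r c)

Aπ : {r c : ℕ} → Vec (Vec ℕ c) r → Pol
Aπ {r} {c} M = AOf.A r c (entry M)

-- Σ_{π ∈ P(r,c)} A_π(t) s^{|π|}: the coefficient of s^n is the sum of
-- A_π over π ∈ P(r,c) with |π| = n (whose entries are all ≤ n).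
genBox : ℕ → ℕ → PS
genBox r c n =
  sumPol (map (λ M → if isPlanePartition M ∧ (size M ≡ᵇ n) then Aπ M else zeroPol)
              (allVecs r (allVecs c (upTo (suc n)))))

-- Σ_{π ∈ P} A_π(t) s^{|π|}: a plane partition with |π| = n has its
-- support inside the n × n square, so the coefficient of s^n is that of
-- the box generating function with r = c = n.
genAll : PS
genAll n = genBox n n n

rhsBox : ℕ → ℕ → PS
rhsBox r c =
  prodPS (concatMap (λ i → map (λ j → oneMinusTSPow (suc (i + j)) *S invOneMinusSPow (suc (i + j)))
                               (upTo c))
                    (upTo r))

rhsAll : PS
rhsAll = infProdPS (λ m → powPS (oneMinusTSPow m *S invOneMinusSPow m) m)

{-# OPTIONS --safe #-}
-- Read along its diagonals, a plane partition is a chain of interlacing partitions.  A border component is a path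
-- crossing consecutive diagonals, counted where it starts: A_π is the product of 1 - t^m over the diagonals and the
-- part sizes whose multiplicity rises to m there.  These are Hall–Littlewood branching coefficients, so the sum over
-- all chains is a product of operators Up, Dn adding and removing horizontal strips.  With each part size as a site of
-- a lattice, they satisfy a local (Yang–Baxter) relation, which globally becomes (1 - zy) Up Dn = (1 - tzy) Dn Up.
-- Moving every Up to the right yields (1 - t s^h)/(1 - s^h) for every box of hook length h.  All sums are finite:
-- parts are at most n, and the resulting boundary term vanishes modulo s^(n+1).
module Submission where

open import Defs
open import Algebra.Bundles using (CommutativeMonoid; CommutativeRing)
open import Algebra.Bundles.Raw using (RawRing)
open import Data.Bool using (Bool; true; false; _∧_; _∨_; not; if_then_else_; T; T?)
open import Data.Bool.ListAction using (any; all)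
open import Data.Empty using (⊥; ⊥-elim)
open import Data.Integer using (ℤ; 0ℤ; 1ℤ; -1ℤ)
open import Data.List using (List; []; _∷_; _++_; map; concatMap; filterᵇ; length; foldr; upTo; applyUpTo)
open import Data.List.Membership.Propositional using (_∈_; find)
open import Data.List.Relation.Binary.Disjoint.Propositional using (Disjoint)
open import Data.List.Relation.Unary.All using (All; []; _∷_)
open import Data.List.Relation.Unary.AllPairs using ([]; _∷_)
open import Data.List.Relation.Unary.Any as Any using (here; there)
open import Data.List.Relation.Unary.Unique.Propositional using (Unique)
open import Data.Maybe using (Maybe; just; nothing)
open import Data.Nat using (ℕ; zero; suc; _+_; _*_; _∸_; _≤_; _<_; z≤n; s≤s; z<s; _≡ᵇ_; _<ᵇ_; _≤ᵇ_; _⊓_)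
open import Data.Product using (∃; _×_; _,_; proj₁; proj₂)
open import Data.Product.Properties using () renaming (≡-dec to ×-≡-dec)
open import Data.Sum using (_⊎_; inj₁; inj₂; swap)
open import Data.Unit using (⊤; tt)
open import Data.Vec using (Vec; []; _∷_; toList)
open import Function using (_∘_; id)
open import Level using (0ℓ)
open import Relation.Binary.Construct.Closure.ReflexiveTransitive using (Star; ε; _◅_; _◅◅_)
open import Relation.Binary.Definitions using (DecidableEquality; tri<; tri≈; tri>)
open import Relation.Binary.PropositionalEquality using (_≡_; _≢_; refl; sym; trans; cong; cong₂; subst; subst₂; module ≡-Reasoning)
open import Relation.Nullary using (yes; no; does; contradiction)
import Algebra.Properties.AbelianGroup
import Algebra.Properties.CommutativeSemigroup
import Algebra.Properties.CommutativeSemiring.Exp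
import Algebra.Properties.Group
import Algebra.Properties.Ring
import Algebra.Properties.Semiring.Mult
import Algebra.Solver.Ring
import Algebra.Solver.Ring.AlmostCommutativeRing as ACR
import Data.Integer as ℤ
import Data.Integer.Properties as ℤ
import Data.List.Membership.Propositional.Properties as ∈
import Data.List.Properties as List
import Data.List.Relation.Unary.All as All
import Data.List.Relation.Unary.Unique.Propositional.Properties as Unique
import Data.Nat.Properties as ℕ
import Data.Vec.Properties as Vec
import Relation.Binary.Construct.Closure.ReflexiveTransitive as Star
import Relation.Binary.Reasoning.Setoid

-- Equal values on one diagonal always lie in one connected component, so the level of a box is its
-- distance to the end of the run of equal values on its diagonal. A border component passes to the
-- next diagonal by keeping this distance. Hence a new one begins exactly when a run gets longer by
-- one; it begins at the first box of that run, and its level is the new run length. One rule,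
-- charging every rise of a multiplicity, gives the coefficient φ of the functions Q when a strip is
-- added and the coefficient ψ of the functions P when it is removed, so the commutation relation is
-- the skew Cauchy identity. With only n part sizes this relation keeps a term in which both
-- operators arrive with a part above n. Such a part fills all n columns and so brings s^n, and the
-- parameters bring one further s. This is why every coefficient is compared in a ring of its own,
-- in which s^(n+1) = 0.

private module ℕ+ = Algebra.Properties.CommutativeSemigroup ℕ.+-commutativeSemigroup

-- Finite products in a commutative monoid

module BigOp {c ℓ} (M : CommutativeMonoid c ℓ) where
  open CommutativeMonoid M renaming (refl to ≈-refl; sym to ≈-sym; trans to ≈-trans; ε to unit)
  open Algebra.Properties.CommutativeSemigroup commutativeSemigroup using (interchange)
  open Relation.Binary.Reasoning.Setoid setoid

  ⨀ : {A : Set} → List A → (A → Carrier) → Carrier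
  ⨀ xs f = foldr (λ x a → f x ∙ a) unit xs

  when : Bool → Carrier → Carrier
  when b x = if b then x else unit

  module _ {A : Set} where
    ⨀-cong : ∀ (xs : List A) {f g : A → Carrier} → (∀ x → x ∈ xs → f x ≈ g x) → ⨀ xs f ≈ ⨀ xs g
    ⨀-cong [] e = ≈-refl
    ⨀-cong (x ∷ xs) e = ∙-cong (e x (here refl)) (⨀-cong xs (λ y y∈ → e y (there y∈)))

    ⨀-unit : ∀ (xs : List A) {f : A → Carrier} → (∀ x → x ∈ xs → f x ≈ unit) → ⨀ xs f ≈ unit
    ⨀-unit [] e = ≈-refl
    ⨀-unit (x ∷ xs) e =
      ≈-trans (∙-cong (e x (here refl)) (⨀-unit xs (λ y y∈ → e y (there y∈)))) (identityˡ unit)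

    ⨀-∙ : ∀ (xs : List A) (f g : A → Carrier) → ⨀ xs (λ x → f x ∙ g x) ≈ ⨀ xs f ∙ ⨀ xs g
    ⨀-∙ [] f g = ≈-sym (identityˡ unit)
    ⨀-∙ (x ∷ xs) f g = ≈-trans (∙-congˡ (⨀-∙ xs f g)) (interchange _ _ _ _)

    ⨀-++ : ∀ (xs ys : List A) (f : A → Carrier) → ⨀ (xs ++ ys) f ≈ ⨀ xs f ∙ ⨀ ys f
    ⨀-++ [] ys f = ≈-sym (identityˡ _)
    ⨀-++ (x ∷ xs) ys f = ≈-trans (∙-congˡ (⨀-++ xs ys f)) (≈-sym (assoc _ _ _))

    ⨀-filterᵇ : ∀ (p : A → Bool) xs (f : A → Carrier) → ⨀ (filterᵇ p xs) f ≈ ⨀ xs (λ x → when (p x) (f x))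
    ⨀-filterᵇ p [] f = ≈-refl
    ⨀-filterᵇ p (x ∷ xs) f with p x
    ... | true  = ∙-congˡ (⨀-filterᵇ p xs f)
    ... | false = ≈-trans (⨀-filterᵇ p xs f) (≈-sym (identityˡ _))

    ⨀-when : ∀ b (xs : List A) (f : A → Carrier) → when b (⨀ xs f) ≈ ⨀ xs (λ x → when b (f x))
    ⨀-when true  xs f = ≈-refl
    ⨀-when false xs f = ≈-sym (⨀-unit xs (λ _ _ → ≈-refl))

    ⨀-one : ∀ {xs : List A} {x} {f : A → Carrier} → Unique xs → x ∈ xs →
            (∀ y → y ∈ xs → y ≢ x → f y ≈ unit) → ⨀ xs f ≈ f x
    ⨀-one {y ∷ xs} (y∉ ∷ u) (here refl) e =
      ≈-trans (∙-congˡ (⨀-unit xs (λ z z∈ → e z (there z∈) (λ z≡y → All.lookup y∉ z∈ (sym z≡y))))) (identityʳ _)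
    ⨀-one {y ∷ xs} (y∉ ∷ u) (there x∈) e =
      ≈-trans (∙-cong (e y (here refl) (All.lookup y∉ x∈)) (⨀-one u x∈ (λ z z∈ → e z (there z∈)))) (identityˡ _)

  ⨀-applyUpTo : ∀ (f : ℕ → Carrier) (h : ℕ → ℕ) n → ⨀ (applyUpTo h n) f ≈ ⨀ (upTo n) (f ∘ h)
  ⨀-applyUpTo f h n = go f h id n
    where
    go : ∀ (f : ℕ → Carrier) (h k : ℕ → ℕ) n → ⨀ (applyUpTo (h ∘ k) n) f ≈ ⨀ (applyUpTo k n) (f ∘ h)
    go f h k zero = ≈-refl
    go f h k (suc n) = ∙-congˡ (go f h (k ∘ suc) n)

  ⨀-upTo-last : ∀ (f : ℕ → Carrier) n → ⨀ (upTo (suc n)) f ≈ ⨀ (upTo n) f ∙ f n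
  ⨀-upTo-last f zero = comm _ _
  ⨀-upTo-last f (suc n) = ≈-trans (∙-congˡ (≈-trans (⨀-applyUpTo f suc (suc n)) (⨀-upTo-last (f ∘ suc) n)))
    (≈-trans (≈-sym (assoc _ _ _)) (∙-congʳ (∙-congˡ (≈-sym (⨀-applyUpTo f suc n)))))

  ⨀-split : ∀ (f : ℕ → Carrier) a b → ⨀ (upTo (a + b)) f ≈ ⨀ (upTo a) f ∙ ⨀ (upTo b) (λ i → f (a + i))
  ⨀-split f zero b = ≈-sym (identityˡ _)
  ⨀-split f (suc a) b = ≈-trans
    (∙-congˡ (≈-trans (⨀-applyUpTo f suc (a + b)) (≈-trans (⨀-split (f ∘ suc) a b) (∙-congʳ (≈-sym (⨀-applyUpTo f suc a))))))
    (≈-sym (assoc _ _ _))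

  module _ {A B : Set} where
    ⨀-map : ∀ (h : A → B) xs (f : B → Carrier) → ⨀ (map h xs) f ≈ ⨀ xs (f ∘ h)
    ⨀-map h [] f = ≈-refl
    ⨀-map h (x ∷ xs) f = ∙-congˡ (⨀-map h xs f)

    ⨀-concatMap : ∀ (h : A → List B) xs (f : B → Carrier) → ⨀ (concatMap h xs) f ≈ ⨀ xs (λ x → ⨀ (h x) f)
    ⨀-concatMap h [] f = ≈-refl
    ⨀-concatMap h (x ∷ xs) f = ≈-trans (⨀-++ (h x) (concatMap h xs) f) (∙-congˡ (⨀-concatMap h xs f))

    ⨀-swap : ∀ (xs : List A) (ys : List B) (f : A → B → Carrier) →
             ⨀ xs (λ x → ⨀ ys (f x)) ≈ ⨀ ys (λ y → ⨀ xs (λ x → f x y))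
    ⨀-swap [] ys f = ≈-sym (⨀-unit ys (λ _ _ → ≈-refl))
    ⨀-swap (x ∷ xs) ys f = ≈-trans (∙-congˡ (⨀-swap xs ys f)) (≈-sym (⨀-∙ ys _ _))

    -- Insert the graph of φ: each term with `P x` is the only nontrivial entry of a row indexed by
    -- ys, and after exchanging the two products, `onto` and `inj` leave one entry in each column
    -- with `Q y`. Only the restriction of φ to P has to be bijective onto Q.
    ⨀-bij : DecidableEquality B → ∀ {xs : List A} {ys : List B} (P : A → Bool) (Q : B → Bool)
            {f : A → Carrier} {g : B → Carrier} (φ : A → B) → Unique xs → Unique ys →
            (∀ x → x ∈ xs → P x ≡ true → φ x ∈ ys × Q (φ x) ≡ true × f x ≈ g (φ x)) →
            (∀ y → y ∈ ys → Q y ≡ true → ∃ λ x → x ∈ xs × P x ≡ true × φ x ≡ y) →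
            (∀ x x′ → x ∈ xs → x′ ∈ xs → P x ≡ true → P x′ ≡ true → φ x ≡ φ x′ → x ≡ x′) →
            ⨀ xs (λ x → when (P x) (f x)) ≈ ⨀ ys (λ y → when (Q y) (g y))
    ⨀-bij _≟_ {xs} {ys} P Q {f} {g} φ uxs uys into onto inj = begin
      ⨀ xs (λ x → when (P x) (f x)) ≈⟨ ⨀-cong xs spread ⟩
      ⨀ xs (λ x → ⨀ ys (λ y → when (P x ∧ does (φ x ≟ y)) (g y))) ≈⟨ ⨀-swap xs ys _ ⟩
      ⨀ ys (λ y → ⨀ xs (λ x → when (P x ∧ does (φ x ≟ y)) (g y))) ≈⟨ ⨀-cong ys collect ⟩
      ⨀ ys (λ y → when (Q y) (g y)) ∎
      where
      spread : ∀ x → x ∈ xs → when (P x) (f x) ≈ ⨀ ys (λ y → when (P x ∧ does (φ x ≟ y)) (g y))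
      spread x x∈ with P x in eq
      ... | false = ≈-sym (⨀-unit ys (λ _ _ → ≈-refl))
      ... | true with into x x∈ eq
      ... | φx∈ , _ , fx≈ = ≈-sym (≈-trans (⨀-one uys φx∈ other) (≈-trans here-value (≈-sym fx≈)))
        where
        other : ∀ y → y ∈ ys → y ≢ φ x → when (does (φ x ≟ y)) (g y) ≈ unit
        other y _ y≢ with φ x ≟ y
        ... | yes e = contradiction (sym e) y≢
        ... | no _  = ≈-refl
        here-value : when (does (φ x ≟ φ x)) (g (φ x)) ≈ g (φ x)
        here-value with φ x ≟ φ x
        ... | yes _ = ≈-refl
        ... | no ne = contradiction refl ne
      collect : ∀ y → y ∈ ys → ⨀ xs (λ x → when (P x ∧ does (φ x ≟ y)) (g y)) ≈ when (Q y) (g y)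
      collect y y∈ with Q y in eq
      ... | false = ⨀-unit xs vanish
        where
        vanish : ∀ x → x ∈ xs → when (P x ∧ does (φ x ≟ y)) (g y) ≈ unit
        vanish x x∈ with P x in px | φ x ≟ y
        ... | false | _ = ≈-refl
        ... | true  | no _ = ≈-refl
        ... | true  | yes refl with trans (sym eq) (proj₁ (proj₂ (into x x∈ px)))
        ... | ()
      ... | true with onto y y∈ eq
      ... | x , x∈ , px , refl = ≈-trans (⨀-one uxs x∈ other) here-value
        where
        other : ∀ x′ → x′ ∈ xs → x′ ≢ x → when (P x′ ∧ does (φ x′ ≟ φ x)) (g (φ x)) ≈ unit
        other x′ x′∈ ne with P x′ in px′ | φ x′ ≟ φ x
        ... | false | _ = ≈-refl
        ... | true  | no _ = ≈-refl
        ... | true  | yes e = contradiction (inj x′ x x′∈ x∈ px′ px e) ne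
        here-value : when (P x ∧ does (φ x ≟ φ x)) (g (φ x)) ≈ g (φ x)
        here-value rewrite px with φ x ≟ φ x
        ... | yes _ = ≈-refl
        ... | no ne = contradiction refl ne

  -- The antidiagonals of a square, when f is trivial below the main one.
  ⨀-antidiagonals : ∀ n (f : ℕ → Carrier) → (∀ m → n ≤ m → f m ≈ unit) →
                    ⨀ (upTo n) (λ i → ⨀ (upTo n) (λ j → f (i + j))) ≈ ⨀ (upTo n) (λ m → ⨀ (upTo (suc m)) (λ _ → f m))
  ⨀-antidiagonals n f trivial = begin
    ⨀ (upTo n) (λ i → ⨀ (upTo n) (λ j → f (i + j))) ≈⟨ ⨀-cong (upTo n) (λ i _ → row i) ⟩
    ⨀ (upTo n) (λ i → ⨀ (upTo n) (λ m → when (i ≤ᵇ m) (f m))) ≈⟨ ⨀-swap (upTo n) (upTo n) _ ⟩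
    ⨀ (upTo n) (λ m → ⨀ (upTo n) (λ i → when (i ≤ᵇ m) (f m))) ≈⟨ ⨀-cong (upTo n) column ⟩
    ⨀ (upTo n) (λ m → ⨀ (upTo (suc m)) (λ _ → f m)) ∎
    where
    when-≤ : ∀ {i m x} → i ≤ m → when (i ≤ᵇ m) x ≈ x
    when-≤ {i} {m} i≤ with i ≤ᵇ m | ℕ.≤⇒≤ᵇ i≤
    ... | true | _ = ≈-refl
    when-≰ : ∀ {i m x} → m < i → when (i ≤ᵇ m) x ≈ unit
    when-≰ {i} {m} m< with i ≤ᵇ m in e
    ... | false = ≈-refl
    ... | true  = contradiction m< (ℕ.≤⇒≯ (ℕ.≤ᵇ⇒≤ i m (subst T (sym e) _)))
    when-unit : ∀ b {x} → x ≈ unit → when b x ≈ unit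
    when-unit true  e = e
    when-unit false e = ≈-refl
    -- Both sides are compared with the product over all m below i + n: splitting it at i discards
    -- the m below i, splitting it at n discards the trivial tail.
    row : ∀ i → ⨀ (upTo n) (λ j → f (i + j)) ≈ ⨀ (upTo n) (λ m → when (i ≤ᵇ m) (f m))
    row i = begin
      ⨀ (upTo n) (λ j → f (i + j))
        ≈⟨ ⨀-cong (upTo n) (λ j _ → when-≤ (ℕ.m≤m+n i j)) ⟨
      ⨀ (upTo n) (λ j → when (i ≤ᵇ i + j) (f (i + j)))
        ≈⟨ identityˡ _ ⟨
      unit ∙ ⨀ (upTo n) (λ j → when (i ≤ᵇ i + j) (f (i + j)))
        ≈⟨ ∙-congʳ (⨀-unit (upTo i) (λ m m∈ → when-≰ (∈.∈-upTo⁻ m∈))) ⟨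
      ⨀ (upTo i) (λ m → when (i ≤ᵇ m) (f m)) ∙ ⨀ (upTo n) (λ j → when (i ≤ᵇ i + j) (f (i + j)))
        ≈⟨ ⨀-split (λ m → when (i ≤ᵇ m) (f m)) i n ⟨
      ⨀ (upTo (i + n)) (λ m → when (i ≤ᵇ m) (f m))
        ≡⟨ cong (λ k → ⨀ (upTo k) (λ m → when (i ≤ᵇ m) (f m))) (ℕ.+-comm i n) ⟩
      ⨀ (upTo (n + i)) (λ m → when (i ≤ᵇ m) (f m))
        ≈⟨ ⨀-split (λ m → when (i ≤ᵇ m) (f m)) n i ⟩
      ⨀ (upTo n) (λ m → when (i ≤ᵇ m) (f m)) ∙ ⨀ (upTo i) (λ j → when (i ≤ᵇ n + j) (f (n + j)))
        ≈⟨ ∙-congˡ (⨀-unit (upTo i) (λ j _ → when-unit (i ≤ᵇ n + j) (trivial _ (ℕ.m≤m+n n j)))) ⟩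
      ⨀ (upTo n) (λ m → when (i ≤ᵇ m) (f m)) ∙ unit
        ≈⟨ identityʳ _ ⟩
      ⨀ (upTo n) (λ m → when (i ≤ᵇ m) (f m)) ∎
    column : ∀ m → m ∈ upTo n → ⨀ (upTo n) (λ i → when (i ≤ᵇ m) (f m)) ≈ ⨀ (upTo (suc m)) (λ _ → f m)
    column m m∈ = begin
      ⨀ (upTo n) g
        ≡⟨ cong (λ k → ⨀ (upTo k) g) (ℕ.m+[n∸m]≡n (∈.∈-upTo⁻ m∈)) ⟨
      ⨀ (upTo (suc m + (n ∸ suc m))) g
        ≈⟨ ⨀-split g (suc m) (n ∸ suc m) ⟩
      ⨀ (upTo (suc m)) g ∙ ⨀ (upTo (n ∸ suc m)) (λ i → g (suc m + i))
        ≈⟨ ∙-cong (⨀-cong (upTo (suc m)) (λ i i∈ → when-≤ (ℕ.≤-pred (∈.∈-upTo⁻ i∈))))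
                  (⨀-unit (upTo (n ∸ suc m)) (λ i _ → when-≰ (s≤s (ℕ.m≤m+n m i)))) ⟩
      ⨀ (upTo (suc m)) (λ _ → f m) ∙ unit
        ≈⟨ identityʳ _ ⟩
      ⨀ (upTo (suc m)) (λ _ → f m) ∎
      where
      g : ℕ → Carrier
      g i = when (i ≤ᵇ m) (f m)

-- Commutative rings and a solver for polynomial identities

module RingNotation (K : CommutativeRing 0ℓ 0ℓ) where
  open CommutativeRing K public hiding (zero)
    renaming (_+_ to _⊕_; _*_ to _⊛_; _-_ to _⊖_; -_ to ⊖_; refl to ≈-refl; sym to ≈-sym; trans to ≈-trans; reflexive to ≈-reflexive)
  open Algebra.Properties.CommutativeSemiring.Exp commutativeSemiring public using (_^_; ^-homo-*; ^-congˡ; ^-distrib-*)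
  open Algebra.Properties.CommutativeSemigroup +-commutativeSemigroup public using (interchange)
  open Algebra.Properties.CommutativeSemigroup *-commutativeSemigroup public using (x∙yz≈y∙xz)
  open Relation.Binary.Reasoning.Setoid setoid public

-- Formal differences of natural numbers are the coefficients: they map to every ring and have decidable equality.
module DifferenceSolver (K : CommutativeRing 0ℓ 0ℓ) where
  open RingNotation K
  open Algebra.Properties.Semiring.Mult semiring renaming (_×_ to _·_)
  open Algebra.Properties.Ring ring using (-‿distribˡ-*; -‿distribʳ-*; -‿involutive; -0#≈0#)
  open Algebra.Properties.AbelianGroup +-abelianGroup using (⁻¹-∙-comm; ⁻¹-anti-homo‿-)

  differences : RawRing 0ℓ 0ℓ
  differences = record
    { Carrier = ℕ × ℕ
    ; _≈_ = _≡_
    ; _+_ = λ { (a , b) (c , d) → a + c , b + d }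
    ; _*_ = λ { (a , b) (c , d) → a * c + b * d , a * d + b * c }
    ; -_  = λ { (a , b) → b , a }
    ; 0#  = 0 , 0
    ; 1#  = 1 , 0
    }

  value₀ : ℕ × ℕ → CommutativeRing.Carrier K
  value₀ (a , b) = a · 1# ⊕ ⊖ (b · 1#)

  -- Agrees with value₀, but sends the coefficients 0 and 1 to 0# and 1# definitionally.
  value : ℕ × ℕ → CommutativeRing.Carrier K
  value (zero , zero) = 0#
  value (suc zero , zero) = 1#
  value x = value₀ x

  private
    ×-minus : ∀ x y u v → (x ⊕ ⊖ y) ⊛ (u ⊕ ⊖ v) ≈ (x ⊛ u ⊕ y ⊛ v) ⊕ ⊖ (x ⊛ v ⊕ y ⊛ u)
    ×-minus x y u v = begin
      (x ⊕ ⊖ y) ⊛ (u ⊕ ⊖ v) ≈⟨ distribʳ _ _ _ ⟩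
      x ⊛ (u ⊕ ⊖ v) ⊕ ⊖ y ⊛ (u ⊕ ⊖ v) ≈⟨ +-cong (distribˡ _ _ _) (distribˡ _ _ _) ⟩
      (x ⊛ u ⊕ x ⊛ ⊖ v) ⊕ (⊖ y ⊛ u ⊕ ⊖ y ⊛ ⊖ v) ≈⟨ +-congˡ (+-comm _ _) ⟩
      (x ⊛ u ⊕ x ⊛ ⊖ v) ⊕ (⊖ y ⊛ ⊖ v ⊕ ⊖ y ⊛ u) ≈⟨ interchange _ _ _ _ ⟩
      (x ⊛ u ⊕ ⊖ y ⊛ ⊖ v) ⊕ (x ⊛ ⊖ v ⊕ ⊖ y ⊛ u)
        ≈⟨ +-cong (+-congˡ (≈-trans (≈-sym (-‿distribʳ-* _ _)) (≈-trans (-‿cong (≈-sym (-‿distribˡ-* _ _))) (-‿involutive _))))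
                  (+-cong (≈-sym (-‿distribʳ-* _ _)) (≈-sym (-‿distribˡ-* _ _))) ⟩
      (x ⊛ u ⊕ y ⊛ v) ⊕ (⊖ (x ⊛ v) ⊕ ⊖ (y ⊛ u)) ≈⟨ +-congˡ (⁻¹-∙-comm _ _) ⟩
      (x ⊛ u ⊕ y ⊛ v) ⊕ ⊖ (x ⊛ v ⊕ y ⊛ u) ∎

    value≈value₀ : ∀ x → value x ≈ value₀ x
    value≈value₀ (zero , zero) = ≈-sym (-‿inverseʳ 0#)
    value≈value₀ (zero , suc _) = ≈-refl
    value≈value₀ (suc zero , zero) = ≈-sym (≈-trans (+-congˡ -0#≈0#) (≈-trans (+-identityʳ _) (+-identityʳ 1#)))
    value≈value₀ (suc zero , suc _) = ≈-refl
    value≈value₀ (suc (suc _) , zero) = ≈-refl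
    value≈value₀ (suc (suc _) , suc _) = ≈-refl

    value₀-cong : ∀ a b c d → a + d ≡ c + b → value₀ (a , b) ≈ value₀ (c , d)
    value₀-cong a b c d e = begin
      a · 1# ⊕ ⊖ (b · 1#) ≈⟨ +-congʳ (cancel (a · 1#) (d · 1#)) ⟩
      (a · 1# ⊕ d · 1#) ⊕ ⊖ (d · 1#) ⊕ ⊖ (b · 1#) ≈⟨ +-congʳ (+-congʳ sums) ⟩
      (c · 1# ⊕ b · 1#) ⊕ ⊖ (d · 1#) ⊕ ⊖ (b · 1#) ≈⟨ +-assoc _ _ _ ⟩
      (c · 1# ⊕ b · 1#) ⊕ (⊖ (d · 1#) ⊕ ⊖ (b · 1#)) ≈⟨ interchange _ _ _ _ ⟩
      (c · 1# ⊕ ⊖ (d · 1#)) ⊕ (b · 1# ⊕ ⊖ (b · 1#)) ≈⟨ +-congˡ (-‿inverseʳ _) ⟩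
      (c · 1# ⊕ ⊖ (d · 1#)) ⊕ 0# ≈⟨ +-identityʳ _ ⟩
      c · 1# ⊕ ⊖ (d · 1#) ∎
      where
      cancel : ∀ x y → x ≈ (x ⊕ y) ⊕ ⊖ y
      cancel x y = ≈-sym (≈-trans (+-assoc _ _ _) (≈-trans (+-congˡ (-‿inverseʳ y)) (+-identityʳ x)))
      sums : a · 1# ⊕ d · 1# ≈ c · 1# ⊕ b · 1#
      sums = ≈-trans (≈-sym (×-homo-+ 1# a d))
        (≈-trans (subst (λ k → (a + d) · 1# ≈ k · 1#) e ≈-refl) (×-homo-+ 1# c b))

    value₀-+ : ∀ a b c d → value₀ (a + c , b + d) ≈ value₀ (a , b) ⊕ value₀ (c , d)
    value₀-+ a b c d = ≈-trans
      (+-cong (×-homo-+ 1# a c) (≈-trans (-‿cong (×-homo-+ 1# b d)) (≈-sym (⁻¹-∙-comm _ _)))) (interchange _ _ _ _)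

    value₀-* : ∀ a b c d → value₀ (a * c + b * d , a * d + b * c) ≈ value₀ (a , b) ⊛ value₀ (c , d)
    value₀-* a b c d = ≈-trans
      (+-cong (≈-trans (×-homo-+ 1# (a * c) (b * d)) (+-cong (×1-homo-* a c) (×1-homo-* b d)))
        (-‿cong (≈-trans (×-homo-+ 1# (a * d) (b * c)) (+-cong (×1-homo-* a d) (×1-homo-* b c)))))
      (≈-sym (×-minus _ _ _ _))

  morphism : differences ACR.-Raw-AlmostCommutative⟶ ACR.fromCommutativeRing K
  morphism = record
    { ⟦_⟧ = value
    ; +-homo = λ { x@(a , b) y@(c , d) → ≈-trans (value≈value₀ (a + c , b + d))
        (≈-trans (value₀-+ a b c d) (+-cong (≈-sym (value≈value₀ x)) (≈-sym (value≈value₀ y)))) }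
    ; *-homo = λ { x@(a , b) y@(c , d) → ≈-trans (value≈value₀ (a * c + b * d , a * d + b * c))
        (≈-trans (value₀-* a b c d) (*-cong (≈-sym (value≈value₀ x)) (≈-sym (value≈value₀ y)))) }
    ; -‿homo = λ { x@(a , b) → ≈-trans (value≈value₀ (b , a))
        (≈-trans (≈-sym (⁻¹-anti-homo‿- _ _)) (-‿cong (≈-sym (value≈value₀ x)))) }
    ; 0-homo = ≈-refl
    ; 1-homo = ≈-refl
    }

  -- Pairs are never normalised (1 - 1 is computed as (1 , 1)), so equal coefficients have to be
  -- recognised by cross addition before the solver can cancel them.
  value-≟ : (x y : ℕ × ℕ) → Maybe (value x ≈ value y)
  value-≟ (a , b) (c , d) with (a + d) ℕ.≟ (c + b)
  ... | yes e = just (≈-trans (value≈value₀ (a , b)) (≈-trans (value₀-cong a b c d e) (≈-sym (value≈value₀ (c , d)))))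
  ... | no _  = nothing

  open Algebra.Solver.Ring differences (ACR.fromCommutativeRing K) morphism value-≟ public
    using (solve; _:=_; _:+_; _:*_; _:-_; :-_; con; Polynomial)

  nil one : ∀ {n} → Polynomial n
  nil = con (0 , 0)
  one = con (1 , 0)

-- Transfer operators and the local Yang-Baxter relation

data Dir : Set where
  up dn : Dir

-- The multiplicities of the parts n, n - 1, …, 1 of a partition.
State : ℕ → Set
State = Vec ℕ

-- Op up z false F μ is the sum, over the λ such that λ/μ is a horizontal strip, of F λ weighted by
-- z^(|λ| - |μ|) and by 1 - t^m for each part size whose multiplicity increases, to m; dn swaps the roles of
-- λ and μ.  The Boolean is the difference of the numbers of parts larger than those still listed.
module Transfer (K : CommutativeRing 0ℓ 0ℓ) (t : CommutativeRing.Carrier K) where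
  open RingNotation K
  open DifferenceSolver K using (solve; _:=_; _:+_; _:*_; _:-_; nil; one; Polynomial)

  w : ℕ → Carrier
  w p = 1# ⊖ t ^ p

  -- θ′ and θ are the differences of the two column lengths at this part size and at the next larger
  -- one, so the multiplicity p becomes p + θ′ - θ for `up` and p + θ - θ′ for `dn`. A rise costs a
  -- factor `w`; lowering the multiplicity 0 is impossible and contributes `0#`.
  move : Dir → Bool → Bool → (ℕ → Carrier) → ℕ → Carrier
  move _  false false f p = f p
  move _  true  true  f p = f p
  move up true  false f p = w (suc p) ⊛ f (suc p)
  move dn false true  f p = w (suc p) ⊛ f (suc p)
  move up false true  f zero = 0#
  move up false true  f (suc p) = f p
  move dn true  false f zero = 0#
  move dn true  false f (suc p) = f p

  Op : Dir → Carrier → Bool → ∀ {n} → (State n → Carrier) → State n → Carrier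
  Op d z θ F [] = F []
  Op d z θ F (p ∷ ps) = move d false θ (λ q → Op d z false (λ qs → F (q ∷ qs)) ps) p ⊕
                        z ⊛ move d true θ (λ q → Op d z true (λ qs → F (q ∷ qs)) ps) p

  move-cong : ∀ d θ′ θ {f g} p → (∀ q → f q ≈ g q) → move d θ′ θ f p ≈ move d θ′ θ g p
  move-cong _  false false p e = e p
  move-cong _  true  true  p e = e p
  move-cong up true  false p e = *-congˡ (e (suc p))
  move-cong dn false true  p e = *-congˡ (e (suc p))
  move-cong up false true  zero e = ≈-refl
  move-cong up false true  (suc p) e = e p
  move-cong dn true  false zero e = ≈-refl
  move-cong dn true  false (suc p) e = e p

  move-+ : ∀ d θ′ θ f g p → move d θ′ θ (λ q → f q ⊕ g q) p ≈ move d θ′ θ f p ⊕ move d θ′ θ g p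
  move-+ _  false false f g p = ≈-refl
  move-+ _  true  true  f g p = ≈-refl
  move-+ up true  false f g p = distribˡ _ _ _
  move-+ dn false true  f g p = distribˡ _ _ _
  move-+ up false true  f g zero = ≈-sym (+-identityˡ 0#)
  move-+ up false true  f g (suc p) = ≈-refl
  move-+ dn true  false f g zero = ≈-sym (+-identityˡ 0#)
  move-+ dn true  false f g (suc p) = ≈-refl

  move-* : ∀ d θ′ θ a f p → move d θ′ θ (λ q → a ⊛ f q) p ≈ a ⊛ move d θ′ θ f p
  move-* _  false false a f p = ≈-refl
  move-* _  true  true  a f p = ≈-refl
  move-* up true  false a f p = x∙yz≈y∙xz _ _ _
  move-* dn false true  a f p = x∙yz≈y∙xz _ _ _
  move-* up false true  a f zero = ≈-sym (zeroʳ a)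
  move-* up false true  a f (suc p) = ≈-refl
  move-* dn true  false a f zero = ≈-sym (zeroʳ a)
  move-* dn true  false a f (suc p) = ≈-refl

  Op-cong : ∀ d z θ {n} {F G : State n → Carrier} μ → (∀ ν → F ν ≈ G ν) → Op d z θ F μ ≈ Op d z θ G μ
  Op-cong d z θ [] e = e []
  Op-cong d z θ (p ∷ ps) e =
    +-cong (move-cong d false θ p (λ q → Op-cong d z false ps (λ qs → e (q ∷ qs))))
           (*-congˡ (move-cong d true θ p (λ q → Op-cong d z true ps (λ qs → e (q ∷ qs)))))

  Op-+ : ∀ d z θ {n} (F G : State n → Carrier) μ → Op d z θ (λ ν → F ν ⊕ G ν) μ ≈ Op d z θ F μ ⊕ Op d z θ G μ
  Op-+ d z θ F G [] = ≈-refl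
  Op-+ d z θ F G (p ∷ ps) = ≈-trans
    (+-cong (part false) (≈-trans (*-congˡ (part true)) (distribˡ _ _ _)))
    (interchange _ _ _ _)
    where
    part : ∀ θ′ → move d θ′ θ (λ q → Op d z θ′ (λ qs → F (q ∷ qs) ⊕ G (q ∷ qs)) ps) p ≈
                  move d θ′ θ (λ q → Op d z θ′ (λ qs → F (q ∷ qs)) ps) p ⊕ move d θ′ θ (λ q → Op d z θ′ (λ qs → G (q ∷ qs)) ps) p
    part θ′ = ≈-trans (move-cong d θ′ θ p (λ q → Op-+ d z θ′ _ _ ps)) (move-+ d θ′ θ _ _ p)

  Op-* : ∀ d z θ {n} a (F : State n → Carrier) μ → Op d z θ (λ ν → a ⊛ F ν) μ ≈ a ⊛ Op d z θ F μ
  Op-* d z θ a F [] = ≈-refl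
  Op-* d z θ a F (p ∷ ps) = ≈-trans
    (+-cong (part false) (≈-trans (*-congˡ (part true)) (x∙yz≈y∙xz _ _ _)))
    (≈-sym (distribˡ _ _ _))
    where
    part : ∀ θ′ → move d θ′ θ (λ q → Op d z θ′ (λ qs → a ⊛ F (q ∷ qs)) ps) p ≈ a ⊛ move d θ′ θ (λ q → Op d z θ′ (λ qs → F (q ∷ qs)) ps) p
    part θ′ = ≈-trans (move-cong d θ′ θ p (λ q → Op-* d z θ′ a _ ps)) (move-* d θ′ θ a _ p)

  Op-0 : ∀ d z θ {n} μ → Op d z θ {n} (λ _ → 0#) μ ≈ 0#
  Op-0 d z θ μ = ≈-trans (Op-cong d z θ μ (λ _ → ≈-sym (zeroˡ 0#))) (≈-trans (Op-* d z θ 0# (λ _ → 0#) μ) (zeroˡ _))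

  -- `Op` acts on the smaller part sizes and `move` on the current one; they commute because `Op` is
  -- linear.
  Op-move : ∀ d z θ d′ a b {n} (G : ℕ → State n → Carrier) p μ →
            Op d z θ (λ ν → move d′ a b (λ q → G q ν) p) μ ≈ move d′ a b (λ q → Op d z θ (G q) μ) p
  Op-move d z θ _  false false G p μ = ≈-refl
  Op-move d z θ _  true  true  G p μ = ≈-refl
  Op-move d z θ up true  false G p μ = Op-* d z θ _ _ μ
  Op-move d z θ dn false true  G p μ = Op-* d z θ _ _ μ
  Op-move d z θ up false true  G zero μ = Op-0 d z θ μ
  Op-move d z θ up false true  G (suc p) μ = ≈-refl
  Op-move d z θ dn true  false G zero μ = Op-0 d z θ μ
  Op-move d z θ dn true  false G (suc p) μ = ≈-refl

  -- Both operators branch at the largest part size. Pulling the inner branching out leaves a factor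
  -- local to this site and products of the two operators on `ps`, to which induction applies.
  Op-Op : ∀ d z a d′ y b {n} (F : State (suc n) → Carrier) p ps →
          let inner = λ a′ q → move d′ false b (λ r → Op d z a′ (Op d′ y false (λ rs → F (r ∷ rs))) ps) q ⊕
                               y ⊛ move d′ true b (λ r → Op d z a′ (Op d′ y true (λ rs → F (r ∷ rs))) ps) q
          in Op d z a (Op d′ y b F) (p ∷ ps) ≈ move d false a (inner false) p ⊕ z ⊛ move d true a (inner true) p
  Op-Op d z a d′ y b F p ps = +-cong (move-cong d false a p (part false)) (*-congˡ (move-cong d true a p (part true)))
    where
    part : ∀ a′ q → Op d z a′ (λ qs → Op d′ y b F (q ∷ qs)) ps ≈
                    move d′ false b (λ r → Op d z a′ (Op d′ y false (λ rs → F (r ∷ rs))) ps) q ⊕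
                    y ⊛ move d′ true b (λ r → Op d z a′ (Op d′ y true (λ rs → F (r ∷ rs))) ps) q
    part a′ q = ≈-trans (Op-+ d z a′ _ _ ps)
      (+-cong (Op-move d z a′ d′ false b _ q ps)
              (≈-trans (Op-* d z a′ y _ ps) (*-congˡ (Op-move d z a′ d′ true b _ q ps))))

  module _ (z y : Carrier) where
    X : Carrier
    X = z ⊛ y

    up-dn dn-up : Bool → Bool → ∀ {n} → (State n → Carrier) → State n → Carrier
    up-dn a b F = Op up z a (Op dn y b F)
    dn-up a b F = Op dn y b (Op up z a F)

    -- The Yang–Baxter relation between the two products, written as the vanishing of ℓ - k on the charged
    -- components and of two independent combinations on the neutral ones.
    record Intertwined (ℓ k : Bool → Bool → Carrier) : Set where
      field
        r₀₁ : ℓ false true ⊖ k false true ≈ 0#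
        r₁₀ : ℓ true false ⊖ k true false ≈ 0#
        r₄ : (ℓ false false ⊕ X ⊛ ℓ true true) ⊖ (k false false ⊕ X ⊛ k true true) ≈ 0#
        r₂ : (1# ⊖ t ⊛ X) ⊛ (ℓ true true ⊖ k true true) ⊖ (1# ⊖ t) ⊛ (ℓ true true ⊖ ℓ false false) ≈ 0#
    open Intertwined

    private
      0*_ : ∀ {e} a → e ≈ 0# → a ⊛ e ≈ 0#
      (0* a) e0 = ≈-trans (*-congˡ e0) (zeroʳ a)

      _0+_ : ∀ {x y} → x ≈ 0# → y ≈ 0# → x ⊕ y ≈ 0#
      x0 0+ y0 = ≈-trans (+-cong x0 y0) (+-identityˡ 0#)

    -- One site of the lattice: the argument of ℓ or k in ℕ is the multiplicity left at the site,
    -- and the Booleans are the charges of the two operators handed on to the smaller part sizes.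
    step-ud step-du : (ℕ → Bool → Bool → Carrier) → ℕ → Bool → Bool → Carrier
    step-ud ℓ p a b =
      move up false a (λ q → move dn false b (λ r → ℓ r false false) q ⊕ y ⊛ move dn true b (λ r → ℓ r false true) q) p ⊕
      z ⊛ move up true a (λ q → move dn false b (λ r → ℓ r true false) q ⊕ y ⊛ move dn true b (λ r → ℓ r true true) q) p
    step-du k p a b =
      move dn false b (λ q → move up false a (λ r → k r false false) q ⊕ z ⊛ move up true a (λ r → k r true false) q) p ⊕
      y ⊛ move dn true b (λ q → move up false a (λ r → k r false true) q ⊕ z ⊛ move up true a (λ r → k r true true) q) p

    -- The multiplicity minus the charge difference a - b is conserved at a site. So each relation
    -- after the step involves neutral components at a single multiplicity and charged ones at its
    -- two neighbours, and it is a linear combination of the relations there; the coefficients below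
    -- are those of this combination.
    intertwined-step : ∀ {ℓ k} → (∀ q → Intertwined (ℓ q) (k q)) → ∀ p → Intertwined (step-ud ℓ p) (step-du k p)
    intertwined-step {ℓ} {k} I p = record { r₀₁ = s₀₁ ; r₁₀ = s₁₀ p ; r₄ = s₄ p ; r₂ = s₂ p }
      where
      module _ {m : ℕ} where
        pol₄ : (x l0 l1 k0 k1 : Polynomial m) → Polynomial m
        pol₄ x l0 l1 k0 k1 = (l0 :+ x :* l1) :- (k0 :+ x :* k1)

        pol₂ : (t x l0 l1 k1 : Polynomial m) → Polynomial m
        pol₂ t x l0 l1 k1 = (one :- t :* x) :* (l1 :- k1) :- (one :- t) :* (l1 :- l0)

        -- The neutral components after a step: wp and wp′ stand for w p and w (suc p), and the charged components
        -- a and b before the step enter at p - 1 and p + 1.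
        ud₀₀ ud₁₁ du₀₀ du₁₁ : (z y wp wp′ l0 l1 a b : Polynomial m) → Polynomial m
        ud₀₀ z y wp wp′ l0 l1 a b = (l0 :+ y :* a) :+ z :* (wp′ :* (b :+ y :* l1))
        ud₁₁ z y wp wp′ l0 l1 a b = (wp :* l0 :+ y :* a) :+ z :* (wp′ :* b :+ y :* l1)
        du₀₀ z y wp wp′ k0 k1 a b = (k0 :+ z :* (wp′ :* b)) :+ y :* (a :+ z :* (wp :* k1))
        du₁₁ z y wp wp′ k0 k1 a b = wp′ :* (k0 :+ z :* b) :+ y :* (a :+ z :* k1)

      s₀₁ : step-ud ℓ p false true ⊖ step-du k p false true ≈ 0#
      s₀₁ = ≈-trans
        (solve 12 (λ z y w′ w″ l0 l1 k0 k1 a a′ b b′ →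
          ((w′ :* l0 :+ y :* a) :+ z :* (w′ :* (w″ :* b :+ y :* l1))) :- (w′ :* (k0 :+ z :* (w″ :* b′)) :+ y :* (a′ :+ z :* (w′ :* k1)))
            := w′ :* pol₄ (z :* y) l0 l1 k0 k1 :+ (y :* (a :- a′) :+ (z :* (w′ :* w″)) :* (b :- b′)))
          ≈-refl z y (w (suc p)) (w (suc (suc p))) (ℓ (suc p) false false) (ℓ (suc p) true true) (k (suc p) false false) (k (suc p) true true)
          (ℓ p false true) (k p false true) (ℓ (suc (suc p)) true false) (k (suc (suc p)) true false))
        ((0* _) (r₄ (I (suc p))) 0+ ((0* _) (r₀₁ (I p)) 0+ (0* _) (r₁₀ (I (suc (suc p))))))

      -- The multiplicity drops twice here, from q + 1 to q - 1; for q = 0 both orders give zero.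
      destroyed : ∀ q → move dn true false (λ r → ℓ r false true) q ⊖ move up false true (λ r → k r false true) q ≈ 0#
      destroyed zero = -‿inverseʳ 0#
      destroyed (suc q) = r₀₁ (I q)

      s₁₀ : ∀ p → step-ud ℓ p true false ⊖ step-du k p true false ≈ 0#
      -- At multiplicity 0 every branch that lowers it is absent, so this case, like the other zero
      -- cases below, is an identity with fewer terms.
      s₁₀ zero = ≈-trans
        (solve 4 (λ z y b b′ → (nil :+ z :* (b :+ y :* nil)) :- ((nil :+ z :* b′) :+ y :* nil) := z :* (b :- b′)) ≈-refl
          z y (ℓ zero true false) (k zero true false))
        ((0* _) (r₁₀ (I zero)))
      s₁₀ (suc q) = ≈-trans
        (solve 10 (λ z y l0 l1 k0 k1 a a′ b b′ →
          ((l0 :+ y :* a) :+ z :* (b :+ y :* l1)) :- ((k0 :+ z :* b′) :+ y :* (a′ :+ z :* k1))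
            := pol₄ (z :* y) l0 l1 k0 k1 :+ (y :* (a :- a′) :+ z :* (b :- b′)))
          ≈-refl z y (ℓ q false false) (ℓ q true true) (k q false false) (k q true true)
          (move dn true false (λ r → ℓ r false true) q) (move up false true (λ r → k r false true) q) (ℓ (suc q) true false) (k (suc q) true false))
        (r₄ (I q) 0+ ((0* _) (destroyed q) 0+ (0* _) (r₁₀ (I (suc q)))))

      s₄ : ∀ p → (step-ud ℓ p false false ⊕ X ⊛ step-ud ℓ p true true) ⊖ (step-du k p false false ⊕ X ⊛ step-du k p true true) ≈ 0#
      s₄ zero = ≈-trans
        (solve 9 (λ t z y l0 l1 k0 k1 b b′ → let w′ = one :- t :* one ; x = z :* y in
          (((l0 :+ y :* nil) :+ z :* (w′ :* (b :+ y :* l1))) :+ x :* (nil :+ z :* (w′ :* b :+ y :* l1)))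
          :- (((k0 :+ z :* (w′ :* b′)) :+ y :* nil) :+ x :* du₁₁ z y nil w′ k0 k1 nil b′)
            := (one :+ x :* (one :- t)) :* pol₄ x l0 l1 k0 k1
               :+ ((nil :- x) :* pol₂ t x l0 l1 k1 :+ (z :* ((one :- t) :+ x :* (one :- t))) :* (b :- b′)))
          ≈-refl t z y (ℓ zero false false) (ℓ zero true true) (k zero false false) (k zero true true) (ℓ 1 true false) (k 1 true false))
        ((0* _) (r₄ (I zero)) 0+ ((0* _) (r₂ (I zero)) 0+ (0* _) (r₁₀ (I 1))))
      s₄ (suc q) = ≈-trans
        (solve 12 (λ t τ z y l0 l1 k0 k1 a a′ b b′ → let wp = one :- t :* τ ; w′ = one :- t :* (t :* τ) ; x = z :* y in
          (ud₀₀ z y wp w′ l0 l1 a b :+ x :* ud₁₁ z y wp w′ l0 l1 a b) :- (du₀₀ z y wp w′ k0 k1 a′ b′ :+ x :* du₁₁ z y wp w′ k0 k1 a′ b′)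
            := (one :+ x :* w′) :* pol₄ x l0 l1 k0 k1
               :+ ((nil :- x :* (t :* τ)) :* pol₂ t x l0 l1 k1
               :+ ((y :+ x :* y) :* (a :- a′) :+ (z :* (w′ :+ x :* w′)) :* (b :- b′))))
          ≈-refl t (t ^ q) z y (ℓ (suc q) false false) (ℓ (suc q) true true) (k (suc q) false false) (k (suc q) true true)
          (ℓ q false true) (k q false true) (ℓ (suc (suc q)) true false) (k (suc (suc q)) true false))
        ((0* _) (r₄ (I (suc q))) 0+ ((0* _) (r₂ (I (suc q))) 0+ ((0* _) (r₀₁ (I q)) 0+ (0* _) (r₁₀ (I (suc (suc q)))))))

      s₂ : ∀ p → (1# ⊖ t ⊛ X) ⊛ (step-ud ℓ p true true ⊖ step-du k p true true) ⊖ (1# ⊖ t) ⊛ (step-ud ℓ p true true ⊖ step-ud ℓ p false false) ≈ 0#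
      s₂ zero = ≈-trans
        (solve 9 (λ t z y l0 l1 k0 k1 b b′ → let w′ = one :- t :* one ; x = z :* y in
          pol₂ t x ((l0 :+ y :* nil) :+ z :* (w′ :* (b :+ y :* l1))) (nil :+ z :* (w′ :* b :+ y :* l1)) (du₁₁ z y nil w′ k0 k1 nil b′)
            := ((one :- t :* x) :* (one :- t)) :* pol₄ x l0 l1 k0 k1
               :+ ((t :* x) :* pol₂ t x l0 l1 k1 :+ ((one :- t :* x) :* (z :* (one :- t))) :* (b :- b′)))
          ≈-refl t z y (ℓ zero false false) (ℓ zero true true) (k zero false false) (k zero true true) (ℓ 1 true false) (k 1 true false))
        ((0* _) (r₄ (I zero)) 0+ ((0* _) (r₂ (I zero)) 0+ (0* _) (r₁₀ (I 1))))
      s₂ (suc q) = ≈-trans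
        (solve 12 (λ t τ z y l0 l1 k0 k1 a a′ b b′ → let wp = one :- t :* τ ; w′ = one :- t :* (t :* τ) ; x = z :* y in
          pol₂ t x (ud₀₀ z y wp w′ l0 l1 a b) (ud₁₁ z y wp w′ l0 l1 a b) (du₁₁ z y wp w′ k0 k1 a′ b′)
            := ((one :- t :* x) :* w′) :* pol₄ x l0 l1 k0 k1
               :+ (((t :* τ) :* (t :* x)) :* pol₂ t x l0 l1 k1
               :+ (((one :- t :* x) :* y) :* (a :- a′) :+ ((one :- t :* x) :* (z :* w′)) :* (b :- b′))))
          ≈-refl t (t ^ q) z y (ℓ (suc q) false false) (ℓ (suc q) true true) (k (suc q) false false) (k (suc q) true true)
          (ℓ q false true) (k q false true) (ℓ (suc (suc q)) true false) (k (suc (suc q)) true false))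
        ((0* _) (r₄ (I (suc q))) 0+ ((0* _) (r₂ (I (suc q))) 0+ ((0* _) (r₀₁ (I q)) 0+ (0* _) (r₁₀ (I (suc (suc q)))))))

-- Global commutation and evaluation of the operator product

weight : ∀ {n} → State n → ℕ
weight [] = 0
weight {suc n} (p ∷ ps) = suc n * p + weight ps

∅ : ∀ {n} → State n
∅ {zero}  = []
∅ {suc n} = 0 ∷ ∅

weight-∅ : ∀ n → weight (∅ {n}) ≡ 0
weight-∅ zero = refl
weight-∅ (suc n) = cong₂ _+_ (ℕ.*-zeroʳ n) (weight-∅ n)

carry : Bool → ℕ → ℕ
carry θ n = if θ then n else 0

module TransferProduct (K : CommutativeRing 0ℓ 0ℓ) (t s : CommutativeRing.Carrier K) where
  open RingNotation K
  open Algebra.Properties.Group +-group using (x∙y⁻¹≈ε⇒x≈y)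
  open DifferenceSolver K using (solve; _:=_; _:+_; _:*_; _:-_; nil; one)
  open Transfer K t

  module _ (z y : Carrier) where
    open Intertwined

    private
      resp : ∀ {ℓ ℓ′ k k′} → (∀ a b → ℓ′ a b ≈ ℓ a b) → (∀ a b → k′ a b ≈ k a b) → Intertwined z y ℓ k → Intertwined z y ℓ′ k′
      resp eℓ ek I = record
        { r₀₁ = ≈-trans (minus (eℓ _ _) (ek _ _)) (r₀₁ I)
        ; r₁₀ = ≈-trans (minus (eℓ _ _) (ek _ _)) (r₁₀ I)
        ; r₄  = ≈-trans (minus (+-cong (eℓ _ _) (*-congˡ (eℓ _ _))) (+-cong (ek _ _) (*-congˡ (ek _ _)))) (r₄ I)
        ; r₂  = ≈-trans (minus (*-congˡ (minus (eℓ _ _) (ek _ _))) (*-congˡ (minus (eℓ _ _) (eℓ _ _)))) (r₂ I)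
        }
        where
        minus : ∀ {a a′ b b′} → a ≈ a′ → b ≈ b′ → a ⊖ b ≈ a′ ⊖ b′
        minus e f = +-cong e (-‿cong f)

    intertwined : ∀ {n} (F : State n → Carrier) μ → Intertwined z y (λ a b → up-dn z y a b F μ) (λ a b → dn-up z y a b F μ)
    intertwined F [] = record
      { r₀₁ = -‿inverseʳ _
      ; r₁₀ = -‿inverseʳ _
      ; r₄  = -‿inverseʳ _
      ; r₂  = solve 3 (λ f a b → a :* (f :- f) :- b :* (f :- f) := nil) ≈-refl (F []) (1# ⊖ t ⊛ X z y) (1# ⊖ t)
      }
    intertwined F (p ∷ ps) = resp
      (λ a b → Op-Op up z a dn y b F p ps)
      (λ a b → Op-Op dn y b up z a F p ps)
      (intertwined-step z y (λ q → intertwined (λ qs → F (q ∷ qs)) ps) p)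

    -- Eliminating k₁₁ between `r₄` and `r₂` leaves ℓ₁₁ with coefficient (t - 1) X. In that
    -- component both operators arrive already charged by a part above n; the hypothesis removes
    -- exactly this term.
    commutation : ∀ {n} (F : State n → Carrier) μ → X z y ⊛ up-dn z y true true F μ ≈ 0# →
                  (1# ⊖ X z y) ⊛ up-dn z y false false F μ ≈ (1# ⊖ t ⊛ X z y) ⊛ dn-up z y false false F μ
    commutation F μ e = x∙y⁻¹≈ε⇒x≈y _ _ (≈-trans
      (solve 6 (λ t x l0 l1 k0 k1 → (one :- x) :* l0 :- (one :- t :* x) :* k0
        := (one :- t :* x) :* ((l0 :+ x :* l1) :- (k0 :+ x :* k1))
           :+ ((nil :- x) :* ((one :- t :* x) :* (l1 :- k1) :- (one :- t) :* (l1 :- l0)) :+ (t :- one) :* (x :* l1)))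
        ≈-refl t (X z y) (up-dn z y false false F μ) (up-dn z y true true F μ) (dn-up z y false false F μ) (dn-up z y true true F μ))
      (null (r₄ I) (null (r₂ I) (≈-trans (*-congˡ e) (zeroʳ _)))))
      where
      I = intertwined F μ
      null : ∀ {a e f} → e ≈ 0# → f ≈ 0# → a ⊛ e ⊕ f ≈ 0#
      null e0 f0 = ≈-trans (+-cong (≈-trans (*-congˡ e0) (zeroʳ _)) f0) (+-identityˡ 0#)

  weigh : Carrier → ∀ {n} → (State n → Carrier) → State n → Carrier
  weigh σ F μ = σ ^ weight μ ⊛ F μ

  private
    ^-+ : ∀ σ {k} a b → k ≡ a + b → σ ^ k ≈ σ ^ a ⊛ σ ^ b
    ^-+ σ a b refl = ^-homo-* σ a b

  module _ (σ : Carrier) where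
    private
      Op-weigh : ∀ d z θ {n} (F : State (suc n) → Carrier) q ps →
                 Op d z θ (λ qs → weigh σ F (q ∷ qs)) ps ≈ σ ^ (suc n * q) ⊛ Op d z θ (weigh σ (λ qs → F (q ∷ qs))) ps
      Op-weigh d z θ {n} F q ps = ≈-trans
        (Op-cong d z θ ps (λ qs → ≈-trans (*-congʳ (^-homo-* σ (suc n * q) (weight qs))) (*-assoc _ _ _)))
        (Op-* d z θ _ _ ps)

    -- The power of y in a term is the change of size within the first n columns. A charge stands
    -- for one part above n, which fills all n of them: this is `carry θ n`. So multiplying by σ to
    -- the size rescales the parameter, here as in `weigh-up`.
    weigh-dn : ∀ y θ {n} (F : State n → Carrier) μ →
               σ ^ (carry θ n + weight μ) ⊛ Op dn y θ F μ ≈ Op dn (σ ⊛ y) θ (weigh σ F) μ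
    weigh-dn y false F [] = ≈-refl
    weigh-dn y true  F [] = ≈-refl
    weigh-dn y θ {suc m} F (p ∷ ps) = go θ p
      where
      D V : Bool → ℕ → Carrier
      D θ′ q = Op dn y θ′ (λ qs → F (q ∷ qs)) ps
      V θ′ q = Op dn (σ ⊛ y) θ′ (λ qs → weigh σ F (q ∷ qs)) ps
      part : ∀ θ′ q e → e ≡ suc m * q + (carry θ′ m + weight ps) → σ ^ e ⊛ D θ′ q ≈ V θ′ q
      part θ′ q e refl = ≈-trans
        (≈-trans (*-congʳ (^-homo-* σ (suc m * q) _)) (≈-trans (*-assoc _ _ _) (*-congˡ (weigh-dn y θ′ (λ qs → F (q ∷ qs)) ps))))
        (≈-sym (Op-weigh dn (σ ⊛ y) θ′ F q ps))
      part₁ : ∀ θ′ q e → e ≡ suc (suc m * q + (carry θ′ m + weight ps)) → σ ^ e ⊛ D θ′ q ≈ σ ⊛ V θ′ q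
      part₁ θ′ q (suc e) eq = ≈-trans (*-assoc _ _ _) (*-congˡ (part θ′ q e (ℕ.suc-injective eq)))
      combine : ∀ {E a b a′ b′} → E ⊛ a ≈ a′ → E ⊛ b ≈ σ ⊛ b′ → E ⊛ (a ⊕ y ⊛ b) ≈ a′ ⊕ (σ ⊛ y) ⊛ b′
      combine ea eb = ≈-trans (distribˡ _ _ _)
        (+-cong ea (≈-trans (x∙yz≈y∙xz _ _ _) (≈-trans (*-congˡ eb) (≈-trans (≈-sym (*-assoc _ _ _)) (*-congʳ (*-comm _ _))))))
      go : ∀ θ p → σ ^ (carry θ (suc m) + weight (p ∷ ps)) ⊛ Op dn y θ F (p ∷ ps) ≈ Op dn (σ ⊛ y) θ (weigh σ F) (p ∷ ps)
      go false zero = combine (part false zero _ refl) (≈-trans (zeroʳ _) (≈-sym (zeroʳ _)))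
      go false (suc q) = combine (part false (suc q) _ refl)
        (part₁ true q _ (trans (cong (_+ weight ps) (ℕ.*-suc (suc m) q)) (cong suc (trans (ℕ.+-assoc m _ _) (ℕ+.x∙yz≈y∙xz m (suc m * q) _)))))
      go true  p = combine
        (≈-trans (x∙yz≈y∙xz _ _ _) (*-congˡ (part false (suc p) _
          (trans (sym (ℕ.+-assoc (suc m) _ _)) (cong (_+ weight ps) (sym (ℕ.*-suc (suc m) p)))))))
        (part₁ true p _ (cong suc (ℕ+.x∙yz≈y∙xz m (suc m * p) _)))

    weigh-up : ∀ z θ {n} (F : State n → Carrier) μ →
               σ ^ weight μ ⊛ Op up (σ ⊛ z) θ F μ ≈ σ ^ carry θ n ⊛ Op up z θ (weigh σ F) μ
    weigh-up z false F [] = *-congˡ (≈-sym (*-identityˡ _))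
    weigh-up z true  F [] = *-congˡ (≈-sym (*-identityˡ _))
    weigh-up z θ {suc m} F (p ∷ ps) = go θ p
      where
      U V : Bool → ℕ → Carrier
      U θ′ q = Op up (σ ⊛ z) θ′ (λ qs → F (q ∷ qs)) ps
      V θ′ q = Op up z θ′ (λ qs → weigh σ F (q ∷ qs)) ps
      part : ∀ θ′ q f g → f + suc m * q ≡ g + carry θ′ m → σ ^ (g + weight ps) ⊛ U θ′ q ≈ σ ^ f ⊛ V θ′ q
      part θ′ q f g e = begin
        σ ^ (g + weight ps) ⊛ U θ′ q ≈⟨ ≈-trans (*-congʳ (^-homo-* σ g _)) (*-assoc _ _ _) ⟩
        σ ^ g ⊛ (σ ^ weight ps ⊛ U θ′ q) ≈⟨ *-congˡ (weigh-up z θ′ (λ qs → F (q ∷ qs)) ps) ⟩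
        σ ^ g ⊛ (σ ^ carry θ′ m ⊛ V′) ≈⟨ ≈-trans (≈-sym (*-assoc _ _ _)) (*-congʳ (≈-sym (^-+ σ g _ e))) ⟩
        σ ^ (f + suc m * q) ⊛ V′ ≈⟨ ≈-trans (*-congʳ (^-homo-* σ f _)) (*-assoc _ _ _) ⟩
        σ ^ f ⊛ (σ ^ (suc m * q) ⊛ V′) ≈⟨ *-congˡ (≈-sym (Op-weigh up z θ′ F q ps)) ⟩
        σ ^ f ⊛ V θ′ q ∎
        where V′ = Op up z θ′ (weigh σ (λ qs → F (q ∷ qs))) ps
      combine : ∀ {E S a b a′ b′} → E ⊛ a ≈ S ⊛ a′ → (σ ⊛ E) ⊛ b ≈ S ⊛ b′ → E ⊛ (a ⊕ (σ ⊛ z) ⊛ b) ≈ S ⊛ (a′ ⊕ z ⊛ b′)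
      combine {E} {S} {a} {b} {a′} {b′} ea eb = ≈-trans
        (solve 5 (λ E a σ z b → E :* (a :+ (σ :* z) :* b) := E :* a :+ z :* ((σ :* E) :* b)) ≈-refl E a σ z b)
        (≈-trans (+-cong ea (*-congˡ eb))
          (solve 4 (λ S a z b → S :* a :+ z :* (S :* b) := S :* (a :+ z :* b)) ≈-refl S a′ z b′))
      go : ∀ θ p → σ ^ weight (p ∷ ps) ⊛ Op up (σ ⊛ z) θ F (p ∷ ps) ≈ σ ^ carry θ (suc m) ⊛ Op up z θ (weigh σ F) (p ∷ ps)
      go false p = combine
        (part false p 0 (suc m * p) (sym (ℕ.+-identityʳ _)))
        (≈-trans (x∙yz≈y∙xz _ _ _) (≈-trans (*-congˡ (part true (suc p) 0 (suc (suc m * p))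
          (trans (ℕ.*-suc (suc m) p) (cong suc (ℕ.+-comm m _))))) (x∙yz≈y∙xz _ _ _)))
      go true zero = combine
        (≈-trans (zeroʳ _) (≈-sym (zeroʳ _)))
        (part true 0 (suc m) (suc (suc m * 0)) (cong suc (ℕ.+-comm m _)))
      go true (suc q) = combine
        (part false q (suc m) (suc m * suc q) (trans (sym (ℕ.*-suc (suc m) q)) (sym (ℕ.+-identityʳ _))))
        (part true (suc q) (suc m) (suc (suc m * suc q)) (cong suc (ℕ.+-comm m _)))

  Op-congᶻ : ∀ d θ {n} {F : State n → Carrier} {z z′} μ → z ≈ z′ → Op d z θ F μ ≈ Op d z′ θ F μ
  Op-congᶻ d θ [] e = ≈-refl
  Op-congᶻ d θ (p ∷ ps) e = +-cong (move-cong d false θ p (λ q → Op-congᶻ d false ps e))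
                                   (*-cong e (move-cong d true θ p (λ q → Op-congᶻ d true ps e)))

  vacuum : ∀ {n} → State n → Carrier
  vacuum [] = 1#
  vacuum (zero ∷ ps)  = vacuum ps
  vacuum (suc _ ∷ ps) = 0#

  -- Adding a strip leads to the empty partition only from the empty partition, with an empty strip.
  Op-vacuum : ∀ z {n} (μ : State n) → Op up z false vacuum μ ≈ vacuum μ
  Op-vacuum z [] = ≈-refl
  Op-vacuum z (p ∷ ps) = ≈-trans
    (+-cong (first p) (≈-trans (*-congˡ (≈-trans (*-congˡ (Op-0 up z true ps)) (zeroʳ _))) (zeroʳ z)))
    (+-identityʳ _)
    where
    first : ∀ p → Op up z false (λ qs → vacuum (p ∷ qs)) ps ≈ vacuum (p ∷ ps)
    first zero = Op-vacuum z ps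
    first (suc p) = Op-0 up z false ps

  weigh-vacuum : ∀ σ {n} (μ : State n) → weigh σ vacuum μ ≈ vacuum μ
  weigh-vacuum σ [] = *-identityˡ _
  weigh-vacuum σ {suc n} (zero ∷ ps)  rewrite ℕ.*-zeroʳ n = weigh-vacuum σ ps
  weigh-vacuum σ (suc _ ∷ ps) = zeroʳ _

  Op-dn-∅ : ∀ y n (F : State n → Carrier) → Op dn y false F ∅ ≈ F ∅
  Op-dn-∅ y zero F = ≈-refl
  Op-dn-∅ y (suc n) F = ≈-trans (+-cong (Op-dn-∅ y n (λ qs → F (0 ∷ qs))) (zeroʳ y)) (+-identityʳ _)

  weigh-∅ : ∀ σ n (F : State n → Carrier) → weigh σ F ∅ ≈ F ∅
  weigh-∅ σ n F rewrite weight-∅ n = *-identityˡ _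

  weigh-cong : ∀ σ {n} {F G : State n → Carrier} → (∀ μ → F μ ≈ G μ) → ∀ μ → weigh σ F μ ≈ weigh σ G μ
  weigh-cong σ e μ = *-congˡ (e μ)

  weigh-weigh : ∀ i {n} (F : State n → Carrier) μ → weigh (s ^ i) (weigh s F) μ ≈ weigh (s ^ suc i) F μ
  weigh-weigh i F μ = ≈-trans (≈-sym (*-assoc _ _ _)) (*-congʳ (≈-trans (*-comm _ _) (≈-sym (^-distrib-* s (s ^ i) (weight μ)))))

  descend : ∀ {n} → ℕ → State n → Carrier
  descend zero = vacuum
  descend (suc c) = Op dn 1# false (weigh s (descend c))

  ascend : ∀ {n} → ℕ → (State n → Carrier) → State n → Carrier
  ascend zero F = F
  ascend (suc r) F = Op up 1# false (weigh s (ascend r F))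

  module _ (N : ℕ) (nilpotent : s ^ suc N ≈ 0#)
           (ι : ℕ → Carrier) (ι-inverse : ∀ m → ι (suc m) ⊛ (1# ⊖ s ^ suc m) ≈ 1#) where
    open BigOp (CommutativeRing.*-commutativeMonoid K) using (⨀; ⨀-cong; ⨀-applyUpTo; ⨀-upTo-last)

    ratio : ℕ → Carrier
    ratio m = (1# ⊖ t ⊛ s ^ m) ⊛ ι m

    private
      -- The c removing operators with all weights pushed onto the vacuum, where they disappear: by
      -- `D-suc` this is Dn(s^(j+1)) Dn(s^(j+2)) ... Dn(s^(j+c)) applied to `vacuum`.
      D : ℕ → ℕ → State N → Carrier
      D j c = weigh (s ^ suc j) (descend c)

      D-suc : ∀ j c μ → D j (suc c) μ ≈ Op dn (s ^ suc j) false (D (suc j) c) μ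
      D-suc j c μ = begin
        weigh (s ^ suc j) (Op dn 1# false (weigh s (descend c))) μ ≈⟨ weigh-dn (s ^ suc j) 1# false _ μ ⟩
        Op dn (s ^ suc j ⊛ 1#) false (weigh (s ^ suc j) (weigh s (descend c))) μ
          ≈⟨ Op-congᶻ dn false μ (*-identityʳ _) ⟩
        Op dn (s ^ suc j) false (weigh (s ^ suc j) (weigh s (descend c))) μ
          ≈⟨ Op-cong dn _ false μ (weigh-weigh (suc j) (descend c)) ⟩
        Op dn (s ^ suc j) false (D (suc j) c) μ ∎

      -- Only here does the truncation at parts of size N matter: the boundary term has order above N in s.
      boundary : ∀ i j c μ → X (s ^ i) (s ^ suc j) ⊛ up-dn (s ^ i) (s ^ suc j) true true (D (suc j) c) μ ≈ 0#
      boundary i j c μ = begin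
        X (s ^ i) (s ^ suc j) ⊛ Op up (s ^ i) true (Op dn (s ^ suc j) true (D (suc j) c)) μ
          ≈⟨ Op-* up (s ^ i) true _ _ μ ⟨
        Op up (s ^ i) true (λ ν → X (s ^ i) (s ^ suc j) ⊛ Op dn (s ^ suc j) true (D (suc j) c) ν) μ
          ≈⟨ Op-cong up (s ^ i) true μ small ⟩
        Op up (s ^ i) true (λ _ → 0#) μ
          ≈⟨ Op-0 up (s ^ i) true μ ⟩
        0# ∎
        where
        G : State N → Carrier
        G = weigh (s ^ suc j) (descend c)
        -- Splitting one s off the parameter s^(j+1) lets `weigh-dn` act with charge `true`, whose
        -- exponent contains N; the one power of s still missing comes from X.
        expand : ∀ ν → Op dn (s ^ suc j) true (D (suc j) c) ν ≈ s ^ (N + weight ν) ⊛ Op dn (s ^ j) true G ν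
        expand ν = ≈-trans
          (Op-cong dn _ true ν (λ ν → ≈-trans (≈-sym (weigh-weigh (suc j) (descend c) ν)) (x∙yz≈y∙xz _ _ _)))
          (≈-sym (weigh-dn s (s ^ j) true G ν))
        small : ∀ ν → X (s ^ i) (s ^ suc j) ⊛ Op dn (s ^ suc j) true (D (suc j) c) ν ≈ 0#
        small ν = begin
          (s ^ i ⊛ (s ⊛ s ^ j)) ⊛ Op dn (s ^ suc j) true (D (suc j) c) ν
            ≈⟨ *-congˡ (≈-trans (expand ν) (*-congʳ (^-homo-* s N (weight ν)))) ⟩
          (s ^ i ⊛ (s ⊛ s ^ j)) ⊛ ((s ^ N ⊛ s ^ weight ν) ⊛ Op dn (s ^ j) true G ν)
            ≈⟨ solve 6 (λ a s b c d e → (a :* (s :* b)) :* ((c :* d) :* e) := (s :* c) :* ((a :* b) :* (d :* e))) ≈-refl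
                 (s ^ i) s (s ^ j) (s ^ N) (s ^ weight ν) (Op dn (s ^ j) true G ν) ⟩
          s ^ suc N ⊛ ((s ^ i ⊛ s ^ j) ⊛ (s ^ weight ν ⊛ Op dn (s ^ j) true G ν))
            ≈⟨ *-congʳ nilpotent ⟩
          0# ⊛ ((s ^ i ⊛ s ^ j) ⊛ (s ^ weight ν ⊛ Op dn (s ^ j) true G ν))
            ≈⟨ zeroˡ _ ⟩
          0# ∎

      columns : ℕ → ℕ → ℕ → Carrier
      columns i j c = ⨀ (upTo c) (λ k → ratio (i + suc (j + k)))

      columns-suc : ∀ i j c → columns i j (suc c) ≈ ratio (i + suc j) ⊛ columns i (suc j) c
      columns-suc i j c = *-cong (≈-reflexive (cong (λ k → ratio (i + suc k)) (ℕ.+-identityʳ j)))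
        (≈-trans (⨀-applyUpTo _ suc c) (⨀-cong (upTo c) (λ k _ → ≈-reflexive (cong (λ m → ratio (i + suc m)) (ℕ.+-suc j k)))))

      -- Passing Dn(s^(j+1)) costs `ratio (i + suc j)`, with ι dividing by 1 - s^(i+j+1), and the
      -- operator fixes the vacuum at the end. So `D j c` is an eigenvector of every Up(s^i).
      eigen : ∀ i j c μ → Op up (s ^ i) false (D j c) μ ≈ columns i j c ⊛ D j c μ
      eigen i j zero μ = begin
        Op up (s ^ i) false (D j zero) μ ≈⟨ Op-cong up (s ^ i) false μ (weigh-vacuum (s ^ suc j)) ⟩
        Op up (s ^ i) false vacuum μ ≈⟨ Op-vacuum (s ^ i) μ ⟩
        vacuum μ ≈⟨ weigh-vacuum (s ^ suc j) μ ⟨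
        D j zero μ ≈⟨ *-identityˡ _ ⟨
        1# ⊛ D j zero μ ∎
      eigen i j (suc c) μ = begin
        Op up z false (D j (suc c)) μ ≈⟨ Op-cong up z false μ (D-suc j c) ⟩
        ud ≈⟨ *-identityˡ _ ⟨
        1# ⊛ ud ≈⟨ *-congʳ ι-x ⟨
        (ι (i + suc j) ⊛ (1# ⊖ x)) ⊛ ud ≈⟨ *-assoc _ _ _ ⟩
        ι (i + suc j) ⊛ ((1# ⊖ x) ⊛ ud) ≈⟨ *-congˡ (commutation z y (D (suc j) c) μ (boundary i j c μ)) ⟩
        ι (i + suc j) ⊛ ((1# ⊖ t ⊛ x) ⊛ Op dn y false (Op up z false (D (suc j) c)) μ)
          ≈⟨ *-congˡ (*-cong (+-congˡ (-‿cong (*-congˡ x≈))) (≈-trans (Op-cong dn y false μ (eigen i (suc j) c)) (Op-* dn y false _ _ μ))) ⟩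
        ι (i + suc j) ⊛ ((1# ⊖ t ⊛ s ^ (i + suc j)) ⊛ (columns i (suc j) c ⊛ Op dn y false (D (suc j) c) μ))
          ≈⟨ solve 4 (λ a b c d → a :* (b :* (c :* d)) := ((b :* a) :* c) :* d) ≈-refl
               (ι (i + suc j)) (1# ⊖ t ⊛ s ^ (i + suc j)) (columns i (suc j) c) (Op dn y false (D (suc j) c) μ) ⟩
        (ratio (i + suc j) ⊛ columns i (suc j) c) ⊛ Op dn y false (D (suc j) c) μ
          ≈⟨ *-cong (columns-suc i j c) (D-suc j c μ) ⟨
        columns i j (suc c) ⊛ D j (suc c) μ ∎
        where
        z y x ud : Carrier
        z = s ^ i
        y = s ^ suc j
        x = X z y
        ud = up-dn z y false false (D (suc j) c) μ
        x≈ : x ≈ s ^ (i + suc j)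
        x≈ = ≈-sym (^-homo-* s i (suc j))
        ι-x : ι (i + suc j) ⊛ (1# ⊖ x) ≈ 1#
        ι-x = ≈-trans (*-congˡ (+-congˡ (-‿cong x≈)))
          (subst (λ m → ι m ⊛ (1# ⊖ s ^ m) ≈ 1#) (sym (ℕ.+-suc i j)) (ι-inverse (i + j)))

      -- The weights collected from r raising operators turn the parameter 1 of the next one into
      -- s^r; this is how the row index enters the exponents.
      ascend-eigen : ∀ r c μ → weigh s (ascend r (descend c)) μ ≈ ⨀ (upTo r) (λ i → columns i 0 c) ⊛ weigh (s ^ r) (D 0 c) μ
      ascend-eigen zero c μ = ≈-sym (≈-trans (*-identityˡ _) (≈-trans (weigh-one (D 0 c) μ) (*-congʳ (^-congˡ (weight μ) (*-identityʳ s)))))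
        where
        weigh-one : ∀ (F : State N → Carrier) μ → weigh 1# F μ ≈ F μ
        weigh-one F μ = ≈-trans (*-congʳ (1^ (weight μ))) (*-identityˡ _)
          where
          1^ : ∀ k → 1# ^ k ≈ 1#
          1^ zero = ≈-refl
          1^ (suc k) = ≈-trans (*-identityˡ _) (1^ k)
      ascend-eigen (suc r) c μ = begin
        σ ⊛ Op up 1# false (weigh s (ascend r (descend c))) μ
          ≈⟨ *-congˡ (≈-trans (Op-cong up 1# false μ (ascend-eigen r c)) (Op-* up 1# false a _ μ)) ⟩
        σ ⊛ (a ⊛ Op up 1# false (weigh (s ^ r) (D 0 c)) μ)
          ≈⟨ *-congˡ (*-congˡ (≈-trans (≈-sym (*-identityˡ _)) (≈-sym (weigh-up (s ^ r) 1# false (D 0 c) μ)))) ⟩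
        σ ⊛ (a ⊛ (τ ⊛ Op up (s ^ r ⊛ 1#) false (D 0 c) μ))
          ≈⟨ *-congˡ (*-congˡ (*-congˡ (≈-trans (Op-congᶻ up false μ (*-identityʳ _)) (eigen r 0 c μ)))) ⟩
        σ ⊛ (a ⊛ (τ ⊛ (columns r 0 c ⊛ D 0 c μ)))
          ≈⟨ solve 5 (λ σ a τ b d → σ :* (a :* (τ :* (b :* d))) := (a :* b) :* ((σ :* τ) :* d)) ≈-refl σ a τ (columns r 0 c) (D 0 c μ) ⟩
        (a ⊛ columns r 0 c) ⊛ ((σ ⊛ τ) ⊛ D 0 c μ)
          ≈⟨ *-cong (⨀-upTo-last (λ i → columns i 0 c) r) (*-congʳ (^-distrib-* s (s ^ r) (weight μ))) ⟨
        ⨀ (upTo (suc r)) (λ i → columns i 0 c) ⊛ weigh (s ^ suc r) (D 0 c) μ ∎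
        where
        σ τ a : Carrier
        σ = s ^ weight μ
        τ = (s ^ r) ^ weight μ
        a = ⨀ (upTo r) (λ i → columns i 0 c)

      descend-∅ : ∀ c → descend c (∅ {N}) ≈ 1#
      descend-∅ zero = vacuum-∅ N
        where
        vacuum-∅ : ∀ n → vacuum (∅ {n}) ≈ 1#
        vacuum-∅ zero = ≈-refl
        vacuum-∅ (suc n) = vacuum-∅ n
      descend-∅ (suc c) = ≈-trans (Op-dn-∅ 1# N _) (≈-trans (weigh-∅ s N (descend c)) (descend-∅ c))

    partition-function : ∀ r c → ascend r (descend c) (∅ {N}) ≈ ⨀ (upTo r) (λ i → ⨀ (upTo c) (λ j → ratio (i + suc j)))
    partition-function r c = ≈-trans (≈-sym (weigh-∅ s N (ascend r (descend c)))) (≈-trans (ascend-eigen r c ∅)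
      (≈-trans (*-congˡ (≈-trans (weigh-∅ (s ^ r) N (D 0 c)) (≈-trans (weigh-∅ (s ^ 1) N (descend c)) (descend-∅ c)))) (*-identityʳ _)))

-- Chains of states and the expansion of the operator product

module _ {A B C D : Set} (_▹_ : A → C → D) (▹-injective : ∀ {a a′ c c′} → a ▹ c ≡ a′ ▹ c′ → a ≡ a′ × c ≡ c′) where

  -- The common shape of `next`, `chains`, `boxes` and `allVecs`, so that membership and uniqueness
  -- are settled once for all of them.
  extend : (B → A) → (B → List C) → List B → List D
  extend key tails = concatMap (λ b → map (key b ▹_) (tails b))

  ∈-extend⁺ : ∀ {key tails bs b c} → b ∈ bs → c ∈ tails b → (key b ▹ c) ∈ extend key tails bs
  ∈-extend⁺ {key} {tails} b∈ c∈ = ∈.∈-concatMap⁺ (λ b → map (key b ▹_) (tails b)) (Any.map (λ { refl → ∈.∈-map⁺ _ c∈ }) b∈)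

  ∈-extend⁻ : ∀ {key tails} bs {d} → d ∈ extend key tails bs → ∃ λ b → ∃ λ c → b ∈ bs × c ∈ tails b × d ≡ key b ▹ c
  ∈-extend⁻ {key} {tails} bs d∈ with find (∈.∈-concatMap⁻ (λ b → map (key b ▹_) (tails b)) {xs = bs} d∈)
  ... | b , b∈ , d∈′ with ∈.∈-map⁻ _ d∈′
  ... | c , c∈ , e = b , c , b∈ , c∈ , e

  extend-unique : ∀ {key tails} bs → Unique (map key bs) → (∀ b → Unique (tails b)) → Unique (extend key tails bs)
  extend-unique [] _ _  = []
  extend-unique {key} {tails} (b ∷ bs) (b∉ ∷ ubs) ut =
    Unique.++⁺ (Unique.map⁺ (proj₂ ∘ ▹-injective) (ut b)) (extend-unique bs ubs ut) disjoint
    where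
    disjoint : Disjoint (map (key b ▹_) (tails b)) (extend key tails bs)
    disjoint (d∈ , d∈′) with ∈.∈-map⁻ _ d∈ | ∈-extend⁻ bs d∈′
    ... | c , _ , refl | b′ , _ , b′∈ , _ , e = All.lookup b∉ (∈.∈-map⁺ key b′∈) (proj₁ (▹-injective e))

-- The possible cases of `move` at multiplicity p with incoming charge θ, as pairs of the outgoing
-- charge and the new multiplicity.
branches : Dir → Bool → ℕ → List (Bool × ℕ)
branches up false p = (false , p) ∷ (true , suc p) ∷ []
branches up true  zero = (true , zero) ∷ []
branches up true  (suc p) = (false , p) ∷ (true , suc p) ∷ []
branches dn false zero = (false , zero) ∷ []
branches dn false (suc p) = (false , suc p) ∷ (true , p) ∷ []
branches dn true  p = (false , suc p) ∷ (true , p) ∷ []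

branches-unique : ∀ d θ p → Unique (map proj₂ (branches d θ p))
branches-unique up false p = ((λ ()) ∷ []) ∷ [] ∷ []
branches-unique up true  zero = [] ∷ []
branches-unique up true  (suc p) = ((λ ()) ∷ []) ∷ [] ∷ []
branches-unique dn false zero = [] ∷ []
branches-unique dn false (suc p) = ((λ ()) ∷ []) ∷ [] ∷ []
branches-unique dn true  p = ((λ ()) ∷ []) ∷ [] ∷ []

next : Dir → Bool → ∀ {n} → State n → List (State n)
next d θ [] = [] ∷ []
next d θ (p ∷ ps) = extend _∷_ Vec.∷-injective proj₂ (λ b → next d (proj₁ b) ps) (branches d θ p)

next-unique : ∀ d θ {n} (μ : State n) → Unique (next d θ μ)
next-unique d θ [] = [] ∷ []
next-unique d θ (p ∷ ps) = extend-unique _∷_ Vec.∷-injective (branches d θ p) (branches-unique d θ p) (λ b → next-unique d (proj₁ b) ps)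

chains : (ℕ → Dir) → ℕ → ∀ {n} → State n → List (List (State n))
chains δ zero μ = [] ∷ []
chains δ (suc k) μ = extend _∷_ List.∷-injective id (chains (δ ∘ suc) k) (next (δ 0) false μ)

chains-unique : ∀ δ k {n} (μ : State n) → Unique (chains δ k μ)
chains-unique δ zero μ = [] ∷ []
chains-unique δ (suc k) μ = extend-unique _∷_ List.∷-injective (next (δ 0) false μ)
  (subst Unique (sym (List.map-id _)) (next-unique (δ 0) false μ)) (chains-unique (δ ∘ suc) k)

chain : ℕ → ∀ {n} → (ℕ → State n) → List (State n)
chain zero st = []
chain (suc k) st = st 1 ∷ chain k (st ∘ suc)

chain-cong : ∀ k {n} {st st′ : ℕ → State n} → (∀ i → i < k → st (suc i) ≡ st′ (suc i)) → chain k st ≡ chain k st′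
chain-cong zero e = refl
chain-cong (suc k) e = cong₂ _∷_ (e 0 z<s) (chain-cong k (λ i i< → e (suc i) (s≤s i<)))

chain-injective : ∀ k {n} {st st′ : ℕ → State n} → chain k st ≡ chain k st′ → ∀ i → i < k → st (suc i) ≡ st′ (suc i)
chain-injective (suc k) e zero _ = proj₁ (List.∷-injective e)
chain-injective (suc k) e (suc i) (s≤s i<) = chain-injective k (proj₂ (List.∷-injective e)) i i<

∈-chains⁺ : ∀ δ k {n} (st : ℕ → State n) → (∀ i → i < k → st (suc i) ∈ next (δ i) false (st i)) → chain k st ∈ chains δ k (st 0)
∈-chains⁺ δ zero st e = here refl
∈-chains⁺ δ (suc k) st e = ∈-extend⁺ _∷_ List.∷-injective (e 0 z<s) (∈-chains⁺ (δ ∘ suc) k (st ∘ suc) (λ i i< → e (suc i) (s≤s i<)))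

∈-chains⁻ : ∀ δ k {n} (μ : State n) {ch} → ch ∈ chains δ k μ →
            ∃ λ st → st 0 ≡ μ × ch ≡ chain k st × (∀ i → i < k → st (suc i) ∈ next (δ i) false (st i))
∈-chains⁻ δ zero μ (here refl) = (λ _ → μ) , refl , refl , λ _ ()
∈-chains⁻ δ (suc k) μ ch∈ with ∈-extend⁻ _∷_ List.∷-injective (next (δ 0) false μ) ch∈
... | ν , ch′ , ν∈ , ch′∈ , refl with ∈-chains⁻ (δ ∘ suc) k ν ch′∈
... | st , refl , refl , e = (λ { zero → μ ; (suc i) → st i }) , refl , refl , λ { zero _ → ν∈ ; (suc i) (s≤s i<) → e i i< }

empty? : ∀ {n} → State n → Bool
empty? [] = true
empty? (zero ∷ ps)  = empty? ps
empty? (suc _ ∷ ps) = false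

returns : ∀ {n} → State n → List (State n) → Bool
returns μ [] = empty? μ
returns μ (ν ∷ ch) = returns ν ch

returns-chain : ∀ k {n} (st : ℕ → State n) → returns (st 0) (chain k st) ≡ empty? (st k)
returns-chain zero st = refl
returns-chain (suc k) st = returns-chain k (st ∘ suc)

direction : ℕ → ℕ → Dir
direction r k = if k <ᵇ r then up else dn

module ChainSum (K : CommutativeRing 0ℓ 0ℓ) (t s : CommutativeRing.Carrier K) where
  open RingNotation K
  open Transfer K t
  open TransferProduct K t s
  private
    module Sum = BigOp (CommutativeRing.+-commutativeMonoid K)
    module Prod = BigOp (CommutativeRing.*-commutativeMonoid K)

  ⨁-*ˡ : ∀ {A : Set} a (xs : List A) (f : A → Carrier) → Sum.⨀ xs (λ x → a ⊛ f x) ≈ a ⊛ Sum.⨀ xs f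
  ⨁-*ˡ a [] f = ≈-sym (zeroʳ a)
  ⨁-*ˡ a (x ∷ xs) f = ≈-trans (+-congˡ (⨁-*ˡ a xs f)) (≈-sym (distribˡ _ _ _))

  gain : ℕ → ℕ → Carrier
  gain p q = Prod.when (q ≡ᵇ suc p) (w q)

  gains : ∀ {n} → State n → State n → Carrier
  gains [] [] = 1#
  gains (p ∷ ps) (q ∷ qs) = gain p q ⊛ gains ps qs

  private
    gain-same : ∀ p → gain p p ≈ 1#
    gain-same zero = ≈-refl
    gain-same (suc p) with p ≡ᵇ suc p in e
    ... | false = ≈-refl
    ... | true  = contradiction (ℕ.≡ᵇ⇒≡ p (suc p) (subst T (sym e) tt)) (λ ())
    gain-less : ∀ p → gain (suc p) p ≈ 1#
    gain-less p with p ≡ᵇ suc (suc p) in e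
    ... | false = ≈-refl
    ... | true  = contradiction (ℕ.≡ᵇ⇒≡ p (suc (suc p)) (subst T (sym e) tt)) (λ ())
    gain-more : ∀ p → gain p (suc p) ≈ w (suc p)
    gain-more p with p ≡ᵇ p | ℕ.≡⇒≡ᵇ p p refl
    ... | true | _ = ≈-refl

    unit : ∀ {g x} → g ≈ 1# → x ≈ g ⊛ x
    unit e = ≈-sym (≈-trans (*-congʳ e) (*-identityˡ _))

  branch-sum : ∀ d θ p (f : Bool → ℕ → Carrier) →
               move d false θ (f false) p ⊕ 1# ⊛ move d true θ (f true) p ≈
               Sum.⨀ (branches d θ p) (λ b → gain p (proj₂ b) ⊛ f (proj₁ b) (proj₂ b))
  branch-sum up false p f = +-cong (unit (gain-same p))
    (≈-trans (*-identityˡ _) (≈-trans (*-congʳ (≈-sym (gain-more p))) (≈-sym (+-identityʳ _))))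
  branch-sum up true  zero f = ≈-trans (+-identityˡ _)
    (≈-trans (*-identityˡ _) (≈-trans (unit (gain-same zero)) (≈-sym (+-identityʳ _))))
  branch-sum up true  (suc p) f = +-cong (unit (gain-less p))
    (≈-trans (*-identityˡ _) (≈-trans (unit (gain-same (suc p))) (≈-sym (+-identityʳ _))))
  branch-sum dn false zero f = +-cong (unit (gain-same zero)) (zeroʳ _)
  branch-sum dn false (suc p) f = +-cong (unit (gain-same (suc p)))
    (≈-trans (*-identityˡ _) (≈-trans (unit (gain-less p)) (≈-sym (+-identityʳ _))))
  branch-sum dn true  p f = +-cong (*-congʳ (≈-sym (gain-more p)))
    (≈-trans (*-identityˡ _) (≈-trans (unit (gain-same p)) (≈-sym (+-identityʳ _))))

  extend-sum : ∀ {A B C D : Set} (_▹_ : A → C → D) (inj : ∀ {a a′ c c′} → a ▹ c ≡ a′ ▹ c′ → a ≡ a′ × c ≡ c′)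
               {key : B → A} {tails} bs (f : D → Carrier) →
               Sum.⨀ (extend _▹_ inj key tails bs) f ≈ Sum.⨀ bs (λ b → Sum.⨀ (tails b) (λ c → f (key b ▹ c)))
  extend-sum _▹_ inj {key} {tails} bs f = ≈-trans (Sum.⨀-concatMap (λ b → map (key b ▹_) (tails b)) bs f)
    (Sum.⨀-cong bs (λ b _ → Sum.⨀-map (key b ▹_) (tails b) f))

  Op-sum : ∀ d θ {n} (F : State n → Carrier) μ → Op d 1# θ F μ ≈ Sum.⨀ (next d θ μ) (λ ν → gains μ ν ⊛ F ν)
  Op-sum d θ F [] = ≈-sym (≈-trans (+-identityʳ _) (*-identityˡ _))
  Op-sum d θ F (p ∷ ps) = begin
    Op d 1# θ F (p ∷ ps)
      ≈⟨ branch-sum d θ p (λ θ′ q → Op d 1# θ′ (λ qs → F (q ∷ qs)) ps) ⟩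
    Sum.⨀ (branches d θ p) (λ b → gain p (proj₂ b) ⊛ Op d 1# (proj₁ b) (λ qs → F (proj₂ b ∷ qs)) ps)
      ≈⟨ Sum.⨀-cong (branches d θ p) (λ b _ → ≈-trans (*-congˡ (Op-sum d (proj₁ b) (λ qs → F (proj₂ b ∷ qs)) ps))
           (≈-trans (≈-sym (⨁-*ˡ _ (next d (proj₁ b) ps) _)) (Sum.⨀-cong (next d (proj₁ b) ps) (λ _ _ → ≈-sym (*-assoc _ _ _))))) ⟩
    Sum.⨀ (branches d θ p) (λ b → Sum.⨀ (next d (proj₁ b) ps) (λ qs → gains (p ∷ ps) (proj₂ b ∷ qs) ⊛ F (proj₂ b ∷ qs)))
      ≈⟨ extend-sum _∷_ Vec.∷-injective (branches d θ p) _ ⟨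
    Sum.⨀ (next d θ (p ∷ ps)) (λ ν → gains (p ∷ ps) ν ⊛ F ν) ∎

  chain-weight : ∀ {n} → State n → List (State n) → Carrier
  chain-weight μ [] = 1#
  chain-weight μ (ν ∷ ch) = (gains μ ν ⊛ s ^ weight ν) ⊛ chain-weight ν ch

  total : (ℕ → Dir) → ℕ → ∀ {n} → State n → Carrier
  total δ zero = vacuum
  total δ (suc k) = Op (δ 0) 1# false (weigh s (total (δ ∘ suc) k))

  total-direction : ∀ r c {n} (μ : State n) → total (direction r) (r + c) μ ≈ ascend r (descend c) μ
  total-direction zero zero μ = ≈-refl
  total-direction zero (suc c) μ = Op-cong dn 1# false μ (weigh-cong s (total-direction zero c))
  total-direction (suc r) c μ = Op-cong up 1# false μ (weigh-cong s (total-direction r c))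

  chain-sum : ∀ δ k {n} (μ : State n) → total δ k μ ≈ Sum.⨀ (chains δ k μ) (λ ch → Sum.when (returns μ ch) (chain-weight μ ch))
  chain-sum δ zero μ = ≈-trans (vacuum-empty? μ) (≈-sym (+-identityʳ _))
    where
    vacuum-empty? : ∀ {n} (μ : State n) → vacuum μ ≈ Sum.when (empty? μ) 1#
    vacuum-empty? [] = ≈-refl
    vacuum-empty? (zero ∷ ps)  = vacuum-empty? ps
    vacuum-empty? (suc _ ∷ ps) = ≈-refl
  chain-sum δ (suc k) μ = begin
    Op (δ 0) 1# false (weigh s (total (δ ∘ suc) k)) μ
      ≈⟨ Op-sum (δ 0) false _ μ ⟩
    Sum.⨀ (next (δ 0) false μ) (λ ν → gains μ ν ⊛ (s ^ weight ν ⊛ total (δ ∘ suc) k ν))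
      ≈⟨ Sum.⨀-cong (next (δ 0) false μ) (λ ν _ → ≈-trans (≈-sym (*-assoc _ _ _)) (≈-trans (*-congˡ (chain-sum (δ ∘ suc) k ν))
           (≈-trans (≈-sym (⨁-*ˡ _ (chains (δ ∘ suc) k ν) _)) (Sum.⨀-cong (chains (δ ∘ suc) k ν) (λ ch _ → when-* (returns ν ch)))))) ⟩
    Sum.⨀ (next (δ 0) false μ) (λ ν → Sum.⨀ (chains (δ ∘ suc) k ν) (λ ch → Sum.when (returns ν ch) (chain-weight μ (ν ∷ ch))))
      ≈⟨ extend-sum _∷_ List.∷-injective (next (δ 0) false μ) _ ⟨
    Sum.⨀ (chains δ (suc k) μ) (λ ch → Sum.when (returns μ ch) (chain-weight μ ch)) ∎
    where
    when-* : ∀ b {a x} → a ⊛ Sum.when b x ≈ Sum.when b (a ⊛ x)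
    when-* true  = ≈-refl
    when-* false = zeroʳ _

  chain-weight-product : ∀ k {n} (st : ℕ → State n) →
    chain-weight (st 0) (chain k st) ≈ Prod.⨀ (upTo k) (λ i → gains (st i) (st (suc i)) ⊛ s ^ weight (st (suc i)))
  chain-weight-product zero st = ≈-refl
  chain-weight-product (suc k) st = *-congˡ (≈-trans (chain-weight-product k (st ∘ suc)) (≈-sym (Prod.⨀-applyUpTo _ suc k)))

-- Boolean tests, boxes and reachability in finite graphs

∧-true : ∀ {a b} → a ∧ b ≡ true → a ≡ true × b ≡ true
∧-true {true} e = refl , e

∧-intro : ∀ {a b} → a ≡ true → b ≡ true → a ∧ b ≡ true
∧-intro refl e = e

∨-true : ∀ {a b} → a ∨ b ≡ true → a ≡ true ⊎ b ≡ true
∨-true {true}  e = inj₁ refl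
∨-true {false} e = inj₂ e

∨-introˡ : ∀ {a b} → a ≡ true → a ∨ b ≡ true
∨-introˡ refl = refl

∨-introʳ : ∀ {a b} → b ≡ true → a ∨ b ≡ true
∨-introʳ {true}  _ = refl
∨-introʳ {false} e = e

not-true : ∀ {a} → not a ≡ true → a ≡ false
not-true {false} _ = refl

true≢false : true ≢ false
true≢false ()

≡ᵇ-sound : ∀ {m n} → (m ≡ᵇ n) ≡ true → m ≡ n
≡ᵇ-sound {m} {n} e = ℕ.≡ᵇ⇒≡ m n (subst T (sym e) tt)

T-true : ∀ {b} → T b → b ≡ true
T-true {true} _ = refl

≡ᵇ-complete : ∀ {m n} → m ≡ n → (m ≡ᵇ n) ≡ true
≡ᵇ-complete {m} {n} e = T-true (ℕ.≡⇒≡ᵇ m n e)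

<ᵇ-sound : ∀ {m n} → (m <ᵇ n) ≡ true → m < n
<ᵇ-sound {m} {n} e = ℕ.<ᵇ⇒< m n (subst T (sym e) tt)

<ᵇ-complete : ∀ {m n} → m < n → (m <ᵇ n) ≡ true
<ᵇ-complete l = T-true (ℕ.<⇒<ᵇ l)

module _ {A : Set} where
  any⁺ : ∀ (p : A → Bool) {xs x} → x ∈ xs → p x ≡ true → any p xs ≡ true
  any⁺ p (here refl) e = ∨-introˡ e
  any⁺ p (there x∈)  e = ∨-introʳ {p _} (any⁺ p x∈ e)

  any⁻ : ∀ (p : A → Bool) xs → any p xs ≡ true → ∃ λ x → x ∈ xs × p x ≡ true
  any⁻ p (x ∷ xs) e with ∨-true {p x} e
  ... | inj₁ px = x , here refl , px
  ... | inj₂ a with any⁻ p xs a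
  ... | y , y∈ , py = y , there y∈ , py

  count : (A → Bool) → List A → ℕ
  count p xs = length (filterᵇ p xs)

  count-mono : ∀ {p q : A → Bool} xs → (∀ x → p x ≡ true → q x ≡ true) → count p xs ≤ count q xs
  count-mono [] p⇒q = z≤n
  count-mono {p} {q} (x ∷ xs) p⇒q with p x in px | q x in qx
  ... | true  | true  = s≤s (count-mono xs p⇒q)
  ... | true  | false = contradiction (trans (sym (p⇒q x px)) qx) true≢false
  ... | false | true  = ℕ.m≤n⇒m≤1+n (count-mono xs p⇒q)
  ... | false | false = count-mono xs p⇒q

  count-mono-< : ∀ {p q : A → Bool} {xs y} → (∀ x → p x ≡ true → q x ≡ true) → y ∈ xs → p y ≡ false → q y ≡ true →
                 count p xs < count q xs
  count-mono-< {p} {q} {x ∷ xs} p⇒q (here refl) py qy rewrite py | qy = s≤s (count-mono xs p⇒q)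
  count-mono-< {p} {q} {x ∷ xs} p⇒q (there y∈) py qy with p x in px | q x in qx
  ... | true  | true  = s≤s (count-mono-< p⇒q y∈ py qy)
  ... | true  | false = contradiction (trans (sym (p⇒q x px)) qx) true≢false
  ... | false | true  = ℕ.m≤n⇒m≤1+n (count-mono-< p⇒q y∈ py qy)
  ... | false | false = count-mono-< p⇒q y∈ py qy

∈-boxes⁺ : ∀ {r c i j} → i < r → j < c → (i , j) ∈ boxes r c
∈-boxes⁺ i< j< = ∈-extend⁺ _,_ (λ { refl → refl , refl }) (∈.∈-upTo⁺ i<) (∈.∈-upTo⁺ j<)

∈-boxes⁻ : ∀ {r c i j} → (i , j) ∈ boxes r c → i < r × j < c
∈-boxes⁻ {r} b∈ with ∈-extend⁻ _,_ (λ { refl → refl , refl }) (upTo r) b∈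
... | _ , _ , i∈ , j∈ , refl = ∈.∈-upTo⁻ i∈ , ∈.∈-upTo⁻ j∈

boxes-unique : ∀ r c → Unique (boxes r c)
boxes-unique r c = extend-unique _,_ (λ { refl → refl , refl }) (upTo r)
  (subst Unique (sym (List.map-id _)) (Unique.upTo⁺ r)) (λ _ → Unique.upTo⁺ c)

length-boxes : ∀ r c → length (boxes r c) ≡ r * c
length-boxes r c = trans (go (upTo r)) (cong (_* c) (List.length-upTo r))
  where
  go : ∀ xs → length (concatMap (λ i → map (λ j → (i , j)) (upTo c)) xs) ≡ length xs * c
  go [] = refl
  go (x ∷ xs) = trans (List.length-++ (map (x ,_) (upTo c)))
    (cong₂ _+_ (trans (List.length-map (x ,_) (upTo c)) (List.length-upTo c)) (go xs))

eqBox-sound : ∀ {b b′} → eqBox b b′ ≡ true → b ≡ b′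
eqBox-sound e with ∧-true e
... | ei , ej = cong₂ _,_ (≡ᵇ-sound ei) (≡ᵇ-sound ej)

eqBox-refl : ∀ b → eqBox b b ≡ true
eqBox-refl (i , j) = ∧-intro (≡ᵇ-complete {i} refl) (≡ᵇ-complete {j} refl)

-- After r * c rounds the set of reached boxes is saturated, since it grows strictly until it is closed.
module Reachability (r c : ℕ) (E : Box → Box → Bool)
                    (E-∈ : ∀ {x y} → E x y ≡ true → x ∈ boxes r c × y ∈ boxes r c) where
  Edge : Box → Box → Set
  Edge x y = E x y ≡ true

  reach : ℕ → Box → Box → Bool
  reach = reachWith r c E

  reach-sound : ∀ k {b y} → reach k b y ≡ true → Star Edge b y
  reach-sound zero {b} {y} e with eqBox-sound {b} {y} e
  ... | refl = ε
  reach-sound (suc k) {b} {y} e with ∨-true {reach k b y} e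
  ... | inj₁ e′ = reach-sound k e′
  ... | inj₂ e′ with any⁻ (λ x → reach k b x ∧ E x y) (boxes r c) e′
  ... | x , _ , xe with ∧-true {reach k b x} xe
  ... | bx , xy = reach-sound k bx ◅◅ (xy ◅ ε)

  module _ {b : Box} (b∈ : b ∈ boxes r c) where
    private
      Closed : ℕ → Set
      Closed k = ∀ {x y} → reach k b x ≡ true → Edge x y → reach k b y ≡ true

      reached : ℕ → ℕ
      reached k = count (reach k b) (boxes r c)

      step : ∀ k {x y} → reach k b x ≡ true → Edge x y → reach (suc k) b y ≡ true
      step k {x} {y} bx xy = ∨-introʳ {reach k b y} (any⁺ (λ z → reach k b z ∧ E z y) (proj₁ (E-∈ xy)) (∧-intro bx xy))

      grow : ∀ k → Closed k ⊎ reached k < reached (suc k)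
      grow k with any (λ y → reach (suc k) b y ∧ not (reach k b y)) (boxes r c) in e
      ... | true with any⁻ _ (boxes r c) e
      ... | y , y∈ , py with ∧-true {reach (suc k) b y} py
      ... | new , old = inj₂ (count-mono-< (λ x → ∨-introˡ) y∈ (not-true old) new)
      grow k | false = inj₁ closed
        where
        closed : Closed k
        closed {x} {y} bx xy with reach k b y in by
        ... | true  = refl
        ... | false = contradiction
          (trans (sym (any⁺ (λ z → reach (suc k) b z ∧ not (reach k b z)) (proj₂ (E-∈ xy))
            (∧-intro (step k bx xy) (cong not by)))) e) true≢false

      saturate : ∀ k → (∃ λ k′ → k′ ≤ k × Closed k′) ⊎ k < reached k
      saturate zero = inj₂ (ℕ.≤-trans z<s (count-mono-< {p = λ _ → false} (λ _ ()) b∈ refl (eqBox-refl b)))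
      saturate (suc k) with saturate k
      ... | inj₁ (k′ , k′≤ , cl) = inj₁ (k′ , ℕ.m≤n⇒m≤1+n k′≤ , cl)
      ... | inj₂ k< with grow k
      ... | inj₁ cl = inj₁ (k , ℕ.n≤1+n k , cl)
      ... | inj₂ g  = inj₂ (ℕ.≤-trans (s≤s k<) g)

      closed-before : ∃ λ k′ → k′ ≤ r * c × Closed k′
      closed-before with saturate (r * c)
      ... | inj₁ x  = x
      ... | inj₂ k< = contradiction k<
        (ℕ.≤⇒≯ (subst (reached (r * c) ≤_) (length-boxes r c) (List.length-filter (T? ∘ reach (r * c) b) (boxes r c))))

      reach-mono : ∀ {k k′ y} → k ≤ k′ → reach k b y ≡ true → reach k′ b y ≡ true
      reach-mono {k} {zero} z≤n e = e
      reach-mono {k} {suc k′} k≤ e with ℕ.m≤n⇒m<n∨m≡n k≤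
      ... | inj₁ (s≤s k≤k′) = ∨-introˡ (reach-mono {k} k≤k′ e)
      ... | inj₂ refl = e

      star-closed : ∀ k {x y} → Closed k → reach k b x ≡ true → Star Edge x y → reach k b y ≡ true
      star-closed k cl bx ε = bx
      star-closed k cl bx (e ◅ es) = star-closed k cl (cl bx e) es

    reach-complete : ∀ {y} → Star Edge b y → reach (r * c) b y ≡ true
    reach-complete path with closed-before
    ... | k , k≤ , cl = reach-mono {k} k≤ (star-closed k cl (reach-mono {zero} {k} z≤n (eqBox-refl b)) path)

-- The where-bound loop of AOf.level has no name of its own; here unification supplies it.
mutual
  levelLoop : ℕ → ℕ → (ℕ → ℕ → ℕ) → ℕ → ℕ → ℕ → ℕ → ℕ
  levelLoop = _

  level-unfold : ∀ r c p i j → AOf.level (suc r) c p (i , j) ≡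
                 (if AOf.sameC (suc r) c p (i , j) (i + 1 , j + 1) then levelLoop (suc r) c p i j 2 r else 1)
  -- Replacing `suc r` and 2 by variables makes the arguments of `levelLoop` distinct variables,
  -- which determines it uniquely.
  level-unfold r c p i j with suc r | 2
  ... | R | h = refl

-- In Before x y, the box y lies on the next diagonal.
data Before : Box → Box → Set where
  below : ∀ {i j} → Before (suc i , j) (i , j)
  left : ∀ {i j} → Before (i , j) (i , suc j)

edgeAdj-sound : ∀ {x y} → edgeAdj x y ≡ true → Before x y ⊎ Before y x
edgeAdj-sound {i , j} {i′ , j′} e with ∨-true {(i ≡ᵇ i′) ∧ ((suc j ≡ᵇ j′) ∨ (suc j′ ≡ᵇ j))} e
... | inj₁ e₁ with ∧-true {i ≡ᵇ i′} e₁
... | ei , ej with ≡ᵇ-sound {i} ei | ∨-true {suc j ≡ᵇ j′} ej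
... | refl | inj₁ a with ≡ᵇ-sound {suc j} {j′} a
... | refl = inj₁ left
edgeAdj-sound {i , j} {i′ , j′} e | inj₁ e₁ | ei , ej | refl | inj₂ a with ≡ᵇ-sound {suc j′} {j} a
... | refl = inj₂ left
edgeAdj-sound {i , j} {i′ , j′} e | inj₂ e₂ with ∧-true {j ≡ᵇ j′} e₂
... | ej , ei with ≡ᵇ-sound {j} ej | ∨-true {suc i ≡ᵇ i′} ei
... | refl | inj₁ a with ≡ᵇ-sound {suc i} {i′} a
... | refl = inj₂ below
edgeAdj-sound {i , j} {i′ , j′} e | inj₂ e₂ | ej , ei | refl | inj₂ a with ≡ᵇ-sound {suc i′} {i} a
... | refl = inj₁ below

edgeAdj-complete : ∀ {x y} → Before x y ⊎ Before y x → edgeAdj x y ≡ true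
edgeAdj-complete (inj₁ (below {i} {j})) = ∨-introʳ {(suc i ≡ᵇ i) ∧ _}
  (∧-intro (≡ᵇ-complete {j} refl) (∨-introʳ {suc (suc i) ≡ᵇ i} (≡ᵇ-complete {i} refl)))
edgeAdj-complete (inj₁ (left {i} {j})) = ∨-introˡ (∧-intro (≡ᵇ-complete {i} refl) (∨-introˡ (≡ᵇ-complete {j} refl)))
edgeAdj-complete (inj₂ (below {i} {j})) = ∨-introʳ {(i ≡ᵇ suc i) ∧ _}
  (∧-intro (≡ᵇ-complete {j} refl) (∨-introˡ (≡ᵇ-complete {i} refl)))
edgeAdj-complete (inj₂ (left {i} {j})) = ∨-introˡ (∧-intro (≡ᵇ-complete {i} refl) (∨-introʳ {suc (suc j) ≡ᵇ j} (≡ᵇ-complete {j} refl)))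

-- Levels, connected components and border components

module PlanePartition (r c : ℕ) (p : ℕ → ℕ → ℕ)
    (outside : ∀ i j → r ≤ i ⊎ c ≤ j → p i j ≡ 0)
    (column-≥ : ∀ i j → p (suc i) j ≤ p i j) (row-≥ : ∀ i j → p i (suc j) ≤ p i j) where
  open AOf r c p

  Positive : Box → Set
  Positive b = 0 < val b

  positive-inside : ∀ {i j} → 0 < p i j → i < r × j < c
  positive-inside {i} {j} pos = ℕ.≰⇒> (λ r≤ → ℕ.n≮0 (subst (0 <_) (outside i j (inj₁ r≤)) pos)) ,
                                ℕ.≰⇒> (λ c≤ → ℕ.n≮0 (subst (0 <_) (outside i j (inj₂ c≤)) pos))

  positive-∈ : ∀ {b} → Positive b → b ∈ boxes r c
  positive-∈ pos with positive-inside pos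
  ... | i< , j< = ∈-boxes⁺ i< j<

  inSupp⁺ : ∀ {b} → Positive b → inSupp b ≡ true
  inSupp⁺ {i , j} pos with positive-inside {i} {j} pos
  ... | i< , j< = ∧-intro (<ᵇ-complete i<) (∧-intro (<ᵇ-complete j<) (<ᵇ-complete pos))

  inSupp⁻ : ∀ {b} → inSupp b ≡ true → Positive b
  inSupp⁻ {i , j} e = <ᵇ-sound (proj₂ (∧-true {j <ᵇ c} (proj₂ (∧-true {i <ᵇ r} e))))

  cEdge⁻ : ∀ {x y} → cEdge x y ≡ true → (Positive x × Positive y) × (Before x y ⊎ Before y x) × val x ≡ val y
  cEdge⁻ {x} {y} e with ∧-true {inSupp x} e
  ... | sx , e₁ with ∧-true {inSupp y} e₁
  ... | sy , e₂ with ∧-true {edgeAdj x y} e₂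
  ... | a , v = (inSupp⁻ sx , inSupp⁻ sy) , edgeAdj-sound a , ≡ᵇ-sound v

  cEdge⁺ : ∀ {x y} → Positive x → val x ≡ val y → Before x y ⊎ Before y x → cEdge x y ≡ true
  cEdge⁺ pos v a = ∧-intro (inSupp⁺ pos) (∧-intro (inSupp⁺ (subst (0 <_) v pos)) (∧-intro (edgeAdj-complete a) (≡ᵇ-complete v)))

  cEdge-sym : ∀ {x y} → cEdge x y ≡ true → cEdge y x ≡ true
  cEdge-sym e with cEdge⁻ e
  ... | (_ , posy) , a , v = cEdge⁺ posy (sym v) (swap a)

  -- The row-major index. Inside the rectangle it increases along `lexLt`, and so it is the
  -- termination measure in the search for a representative.
  measure : Box → ℕ
  measure (i , j) = i * c + j

  lexLt-measure : ∀ {x y} → x ∈ boxes r c → lexLt x y ≡ true → measure x < measure y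
  lexLt-measure {i , j} {i′ , j′} x∈ e with ∨-true {i <ᵇ i′} e
  ... | inj₁ i< = ℕ.≤-trans (ℕ.+-monoʳ-< (i * c) (proj₂ (∈-boxes⁻ {r} {c} x∈)))
        (ℕ.≤-trans (ℕ.≤-reflexive (ℕ.+-comm (i * c) c)) (ℕ.≤-trans (ℕ.*-monoˡ-≤ c (<ᵇ-sound {i} {i′} i<)) (ℕ.m≤m+n _ j′)))
  ... | inj₂ e₂ with ∧-true {i ≡ᵇ i′} e₂
  ... | ei , j< with ≡ᵇ-sound {i} ei
  ... | refl = ℕ.+-monoʳ-< (i * c) (<ᵇ-sound j<)

  lexLt-trichotomy : ∀ x y → lexLt x y ≡ true ⊎ x ≡ y ⊎ lexLt y x ≡ true
  lexLt-trichotomy (i , j) (i′ , j′) with ℕ.<-cmp i i′ | ℕ.<-cmp j j′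
  ... | tri< i< _ _ | _ = inj₁ (∨-introˡ (<ᵇ-complete i<))
  ... | tri> _ _ i> | _ = inj₂ (inj₂ (∨-introˡ (<ᵇ-complete i>)))
  ... | tri≈ _ refl _ | tri< j< _ _ = inj₁ (∨-introʳ {i <ᵇ i} (∧-intro (≡ᵇ-complete {i} refl) (<ᵇ-complete j<)))
  ... | tri≈ _ refl _ | tri≈ _ refl _ = inj₂ (inj₁ refl)
  ... | tri≈ _ refl _ | tri> _ _ j> = inj₂ (inj₂ (∨-introʳ {i <ᵇ i} (∧-intro (≡ᵇ-complete {i} refl) (<ᵇ-complete j>))))

  -- Instantiated with `cEdge` and with `bEdge`, where `same` unfolds to `sameC` and `sameB`.
  module Classes (E : Box → Box → Bool)
                 (E-positive : ∀ {x y} → E x y ≡ true → Positive x × Positive y)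
                 (E-sym : ∀ {x y} → E x y ≡ true → E y x ≡ true) where
    open Reachability r c E (λ e → positive-∈ (proj₁ (E-positive e)) , positive-∈ (proj₂ (E-positive e))) public using (Edge)
    private module R = Reachability r c E (λ e → positive-∈ (proj₁ (E-positive e)) , positive-∈ (proj₂ (E-positive e)))

    same : Box → Box → Bool
    same b b′ = inSupp b ∧ inSupp b′ ∧ reachWith r c E (r * c) b b′

    same⁺ : ∀ {b b′} → Positive b → Positive b′ → Star Edge b b′ → same b b′ ≡ true
    same⁺ pos pos′ path = ∧-intro (inSupp⁺ pos) (∧-intro (inSupp⁺ pos′) (R.reach-complete (positive-∈ pos) path))

    same⁻ : ∀ {b b′} → same b b′ ≡ true → Positive b × Positive b′ × Star Edge b b′
    same⁻ {b} {b′} e with ∧-true {inSupp b} e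
    ... | s , e₁ with ∧-true {inSupp b′} e₁
    ... | s′ , e₂ = inSupp⁻ s , inSupp⁻ s′ , R.reach-sound (r * c) e₂

    reverse : ∀ {b b′} → Star Edge b b′ → Star Edge b′ b
    reverse = Star.reverse E-sym

    rep-positive : ∀ {b} → isRep same b ≡ true → Positive b
    rep-positive {b} e = inSupp⁻ (proj₁ (∧-true {inSupp b} e))

    rep-exists : ∀ {b} → Positive b → ∃ λ x → isRep same x ≡ true × Star Edge x b
    rep-exists {b} pos = go (suc (measure b)) pos ℕ.≤-refl
      where
      go : ∀ n {b} → Positive b → measure b < n → ∃ λ x → isRep same x ≡ true × Star Edge x b
      go (suc n) {b} pos (s≤s m≤) with any (λ x → lexLt x b ∧ same x b) (boxes r c) in e
      ... | false = b , ∧-intro (inSupp⁺ pos) (cong not e) , ε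
      ... | true with any⁻ _ (boxes r c) e
      ... | y , y∈ , ye with ∧-true {lexLt y b} ye
      ... | y< , yb with same⁻ yb
      ... | posy , _ , path with go n posy (ℕ.≤-trans (lexLt-measure y∈ y<) m≤)
      ... | x , rep , path′ = x , rep , path′ ◅◅ path

    private
      minimal : ∀ {x y} → isRep same y ≡ true → lexLt x y ≡ true → Positive x → Star Edge x y → ⊥
      minimal {x} {y} rep x<y posx path = true≢false (trans
        (sym (any⁺ (λ z → lexLt z y ∧ same z y) (positive-∈ posx) (∧-intro x<y (same⁺ posx (rep-positive rep) path))))
        (not-true (proj₂ (∧-true {inSupp y} rep))))

    rep-unique : ∀ {x y} → isRep same x ≡ true → isRep same y ≡ true → Star Edge x y → x ≡ y
    rep-unique {x} {y} repx repy path with lexLt-trichotomy x y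
    ... | inj₁ x<y = ⊥-elim (minimal repy x<y (rep-positive repx) path)
    ... | inj₂ (inj₁ x≡y) = x≡y
    ... | inj₂ (inj₂ y<x) = ⊥-elim (minimal repx y<x (rep-positive repy) (reverse path))

  cEdge-positive : ∀ {x y} → cEdge x y ≡ true → Positive x × Positive y
  cEdge-positive e = proj₁ (cEdge⁻ e)

  module C = Classes cEdge cEdge-positive cEdge-sym

  val-constant : ∀ {x y} → Star C.Edge x y → val x ≡ val y
  val-constant ε = refl
  val-constant (e ◅ es) = trans (proj₂ (proj₂ (cEdge⁻ e))) (val-constant es)

  diagonal-≥ : ∀ i j → p (suc i) (suc j) ≤ p i j
  diagonal-≥ i j = ℕ.≤-trans (row-≥ (suc i) j) (column-≥ i j)

  -- Monotonicity squeezes all boxes between the two corners to the same value, so the staircase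
  -- joining them stays in one component. Whether (i + h , j + h) belongs to the component of (i ,
  -- j) is thereby just an equation between values.
  diagonal-path : ∀ h i j → 0 < p i j → p (i + h) (j + h) ≡ p i j → Star C.Edge (i , j) (i + h , j + h)
  diagonal-path zero i j pos e rewrite ℕ.+-identityʳ i | ℕ.+-identityʳ j = ε
  diagonal-path (suc h) i j pos e rewrite ℕ.+-suc i h | ℕ.+-suc j h =
    diagonal-path h i j pos corner ◅◅
    (cEdge⁺ (subst (0 <_) (sym corner) pos) (trans corner (sym middle)) (inj₂ below) ◅
     cEdge⁺ (subst (0 <_) (sym middle) pos) (trans middle (sym e)) (inj₁ left) ◅ ε)
    where
    decreasing : ∀ h → p (i + h) (j + h) ≤ p i j
    decreasing zero rewrite ℕ.+-identityʳ i | ℕ.+-identityʳ j = ℕ.≤-refl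
    decreasing (suc h) rewrite ℕ.+-suc i h | ℕ.+-suc j h = ℕ.≤-trans (diagonal-≥ _ _) (decreasing h)
    corner : p (i + h) (j + h) ≡ p i j
    corner = ℕ.≤-antisym (decreasing h) (ℕ.≤-trans (ℕ.≤-reflexive (sym e)) (diagonal-≥ _ _))
    middle : p (suc (i + h)) (j + h) ≡ p i j
    middle = ℕ.≤-antisym (ℕ.≤-trans (column-≥ _ _) (decreasing h)) (ℕ.≤-trans (ℕ.≤-reflexive (sym e)) (row-≥ _ _))

  -- The level read off the diagonal alone, as the length of the run of equal values that starts at
  -- (i , j); connectivity no longer occurs.
  record IsLevel (i j h : ℕ) : Set where
    field
      positive : 0 < h
      constant : ∀ {k} → k < h → p (i + k) (j + k) ≡ p i j
      different : p (i + h) (j + h) ≢ p i j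

  IsLevel-unique : ∀ {i j h h′} → IsLevel i j h → IsLevel i j h′ → h ≡ h′
  IsLevel-unique {h = h} {h′} l l′ with ℕ.<-cmp h h′
  ... | tri< h< _ _ = contradiction (IsLevel.constant l′ h<) (IsLevel.different l)
  ... | tri≈ _ e _  = e
  ... | tri> _ _ h> = contradiction (IsLevel.constant l h>) (IsLevel.different l′)

  IsLevel-suc : ∀ {i j h} → p (suc i) (suc j) ≡ p i j → IsLevel (suc i) (suc j) h → IsLevel i j (suc h)
  IsLevel-suc {i} {j} {h} e l = record
    { positive  = z<s
    ; constant  = λ { {zero} _ → cong₂ p (ℕ.+-identityʳ i) (ℕ.+-identityʳ j)
                    ; {suc k} (s≤s k<) → trans (cong₂ p (ℕ.+-suc i k) (ℕ.+-suc j k)) (trans (IsLevel.constant l k<) e) }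
    ; different = λ e′ → IsLevel.different l (trans (sym (cong₂ p (ℕ.+-suc i h) (ℕ.+-suc j h))) (trans e′ (sym e)))
    }

  -- The invariant r < h + f ensures that when the fuel is used up, row i + h lies outside the
  -- rectangle, where p is 0 and so differs from the positive p i j.
  loop-isLevel : ∀ i j h f → 0 < p i j → 0 < h → r < h + f → (∀ {k} → k < h → p (i + k) (j + k) ≡ p i j) →
                 IsLevel i j (levelLoop r c p i j h f)
  loop-isLevel i j h zero pos h> r< const = record
    { positive = h> ; constant = const
    ; different = λ e → ℕ.<⇒≢ pos (trans (sym (outside _ _ (inj₁
        (ℕ.≤-trans (ℕ.<⇒≤ r<) (ℕ.≤-trans (ℕ.≤-reflexive (ℕ.+-identityʳ h)) (ℕ.m≤n+m h i)))))) e) }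
  loop-isLevel i j h (suc f) pos h> r< const with sameC (i , j) (i + h , j + h) in e
  ... | true  = loop-isLevel i j (suc h) f pos z<s (subst (r <_) (ℕ.+-suc h f) r<) const′
    where
    const′ : ∀ {k} → k < suc h → p (i + k) (j + k) ≡ p i j
    const′ {k} (s≤s k≤) with ℕ.m≤n⇒m<n∨m≡n k≤
    ... | inj₁ k< = const k<
    ... | inj₂ refl = sym (val-constant (proj₂ (proj₂ (C.same⁻ {i , j} e))))
  ... | false = record
    { positive = h> ; constant = const
    ; different = λ eq → true≢false (trans (sym (C.same⁺ {i , j} pos (subst (0 <_) (sym eq) pos) (diagonal-path h i j pos eq))) e) }

  level-isLevel : ∀ {i j} → 0 < p i j → IsLevel i j (level (i , j))
  level-isLevel {i} {j} pos = loop-isLevel i j 1 r pos z<s ℕ.≤-refl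
    λ { {zero} _ → cong₂ p (ℕ.+-identityʳ i) (ℕ.+-identityʳ j) ; {suc _} (s≤s ()) }

  level-≤ : ∀ {b} → Positive b → level b ≤ r
  level-≤ {i , j} pos = ℕ.≮⇒≥ λ r< → ℕ.<⇒≢ pos (trans (sym (outside (i + r) (j + r) (inj₁ (ℕ.m≤n+m r i))))
    (IsLevel.constant (level-isLevel pos) r<))

  bEdge⁻ : ∀ {x y} → bEdge x y ≡ true → cEdge x y ≡ true × level x ≡ level y
  bEdge⁻ {x} {y} e with ∧-true {cEdge x y} e
  ... | ce , le = ce , ≡ᵇ-sound le

  bEdge⁺ : ∀ {x y} → cEdge x y ≡ true → level x ≡ level y → bEdge x y ≡ true
  bEdge⁺ ce le = ∧-intro ce (≡ᵇ-complete le)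

  bEdge-sym : ∀ {x y} → bEdge x y ≡ true → bEdge y x ≡ true
  bEdge-sym {x} {y} e with bEdge⁻ {x} {y} e
  ... | ce , le = bEdge⁺ {y} {x} (cEdge-sym ce) (sym le)

  bEdge-positive : ∀ {x y} → bEdge x y ≡ true → Positive x × Positive y
  bEdge-positive {x} {y} e = cEdge-positive (proj₁ (bEdge⁻ {x} {y} e))

  module B = Classes bEdge (λ {x} {y} → bEdge-positive {x} {y}) (λ {x} {y} → bEdge-sym {x} {y})

  level-constant : ∀ {x y} → Star B.Edge x y → level x ≡ level y
  level-constant ε = refl
  level-constant (_◅_ {x} {y} e es) = trans (proj₂ (bEdge⁻ {x} {y} e)) (level-constant es)

  -- The two neighbours of a box on the previous diagonal are consecutive there, so they have different levels if
  -- they have the same value: a border component is a path that goes up and right.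
  one-predecessor : ∀ {i j} → bEdge (i , j) (i , suc j) ≡ true → bEdge (suc i , suc j) (i , suc j) ≡ true → ⊥
  one-predecessor {i} {j} e e′ with bEdge⁻ {i , j} e | bEdge⁻ {suc i , suc j} e′
  ... | ce , le | ce′ , le′ with cEdge⁻ {i , j} ce | cEdge⁻ {suc i , suc j} ce′
  ... | (pos , _) , _ , v | (pos′ , _) , _ , v′ = ℕ.1+n≢n (trans
    (IsLevel-unique (IsLevel-suc (trans v′ (sym v)) (level-isLevel pos′)) (level-isLevel pos)) (trans le (sym le′)))

  -- Counted from the lower left corner and shifted by r to stay in ℕ. A box of the support has i <
  -- r, so the diagonal with index 0 is empty.
  diagonal : Box → ℕ
  diagonal (i , j) = j + (r ∸ i)

  diagonal-before : ∀ {x y} → Before x y → Positive y → diagonal y ≡ suc (diagonal x)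
  diagonal-before {_} {i , j} below pos = trans (cong (j +_) (ℕ.+-∸-assoc 1 (proj₁ (positive-inside pos)))) (ℕ.+-suc j _)
  diagonal-before left pos = refl

  hasLeft : ℕ → ℕ → Bool
  hasLeft i zero = false
  hasLeft i (suc j) = bEdge (i , j) (i , suc j)

  -- The start of a border path: no `bEdge` joins the box to either of its two neighbours on the
  -- previous diagonal.
  isEnd : Box → Bool
  isEnd (i , j) = inSupp (i , j) ∧ not (bEdge (suc i , j) (i , j)) ∧ not (hasLeft i j)

  -- The walk back to the start of a border path. Each step lowers `diagonal` by one, so the
  -- diagonal index is enough fuel, and a walk from y through x has the same fuel left at x as a
  -- walk begun there.
  mutual
    descent : ℕ → Box → Box
    descent zero b = b
    descent (suc f) (i , j) = if bEdge (suc i , j) (i , j) then descent f (suc i , j) else descentLeft f i j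

    descentLeft : ℕ → ℕ → ℕ → Box
    descentLeft f i zero = i , zero
    descentLeft f i (suc j) = if bEdge (i , j) (i , suc j) then descent f (i , j) else (i , suc j)

  root : Box → Box
  root b = descent (diagonal b) b

  -- By `one-predecessor` the first step back from y can only lead to x.
  root-before : ∀ {x y} → Before x y → bEdge x y ≡ true → root y ≡ root x
  root-before {x} {y} bef e with bEdge-positive {x} {y} e
  ... | _ , posy rewrite diagonal-before bef posy = go bef e
    where
    go : ∀ {x y f} → Before x y → bEdge x y ≡ true → descent (suc f) y ≡ descent f x
    go below e rewrite e = refl
    go (left {i} {j}) e with bEdge (suc i , suc j) (i , suc j) in e′
    ... | true  = ⊥-elim (one-predecessor e e′)
    ... | false rewrite e = refl

  root-constant : ∀ {x y} → Star B.Edge x y → root x ≡ root y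
  root-constant ε = refl
  root-constant (_◅_ {x} {y} e es) with proj₁ (proj₂ (cEdge⁻ (proj₁ (bEdge⁻ {x} {y} e))))
  ... | inj₁ bef = trans (sym (root-before bef e)) (root-constant es)
  ... | inj₂ bef = trans (root-before bef (bEdge-sym {x} {y} e)) (root-constant es)

  root-end : ∀ {b} → isEnd b ≡ true → root b ≡ b
  root-end {i , j} e = go (diagonal (i , j)) j e
    where
    go : ∀ f j → isEnd (i , j) ≡ true → descent f (i , j) ≡ (i , j)
    go zero j e = refl
    go (suc f) j e with ∧-true {inSupp (i , j)} e
    ... | _ , e₁ with ∧-true {not (bEdge (suc i , j) (i , j))} e₁
    ... | nb , nl rewrite not-true {bEdge (suc i , j) (i , j)} nb = goLeft j nl
      where
      goLeft : ∀ j → not (hasLeft i j) ≡ true → descentLeft f i j ≡ (i , j)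
      goLeft zero nl = refl
      goLeft (suc j) nl rewrite not-true {bEdge (i , j) (i , suc j)} nl = refl

  root-spec : ∀ {b} → Positive b → isEnd (root b) ≡ true × Star B.Edge (root b) b
  root-spec {b} pos = go (diagonal b) b refl pos
    where
    go : ∀ f b → diagonal b ≡ f → Positive b → isEnd (descent f b) ≡ true × Star B.Edge (descent f b) b
    go zero (i , j) d pos = contradiction (ℕ.m+n≡0⇒n≡0 j d) (ℕ.m>n⇒m∸n≢0 (proj₁ (positive-inside pos)))
    go (suc f) (i , j) d pos with bEdge (suc i , j) (i , j) in eb
    ... | true with go f (suc i , j) (ℕ.suc-injective (trans (sym (diagonal-before (below {i} {j}) pos)) d)) (proj₁ (bEdge-positive {suc i , j} eb))
    ... | end , path = end , path ◅◅ (eb ◅ ε)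
    go (suc f) (i , j) d pos | false = goLeft j d pos eb
      where
      goLeft : ∀ j → diagonal (i , j) ≡ suc f → 0 < p i j → bEdge (suc i , j) (i , j) ≡ false →
               isEnd (descentLeft f i j) ≡ true × Star B.Edge (descentLeft f i j) (i , j)
      goLeft zero d pos eb = ∧-intro (inSupp⁺ pos) (∧-intro (cong not eb) refl) , ε
      goLeft (suc j) d pos eb with bEdge (i , j) (i , suc j) in el
      ... | true with go f (i , j) (ℕ.suc-injective d) (proj₁ (bEdge-positive {i , j} el))
      ... | end , path = end , path ◅◅ (el ◅ ε)
      goLeft (suc j) d pos eb | false = ∧-intro (inSupp⁺ pos) (∧-intro (cong not eb) (cong not el)) , ε

  module BorderProduct (M : CommutativeMonoid 0ℓ 0ℓ) (f : ℕ → CommutativeMonoid.Carrier M) where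
    open CommutativeMonoid M using (_≈_; setoid) renaming (refl to ≈-refl; trans to ≈-trans; reflexive to ≈-reflexive; ε to unit)
    open BigOp M
    open Relation.Binary.Reasoning.Setoid setoid

    private
      inC : Box → ℕ → Box → Bool
      inC b i x = isRep sameB x ∧ sameC b x ∧ (level x ≡ᵇ suc i)

      levels : ∀ {x} → Positive x → ⨀ (upTo r) (λ i → when (level x ≡ᵇ suc i) (f (suc i))) ≈ f (level x)
      levels {i , j} pos with level (i , j) | IsLevel.positive (level-isLevel pos) | level-≤ pos
      ... | suc l | _ | l< = ≈-trans (⨀-one (Unique.upTo⁺ r) (∈.∈-upTo⁺ l<) other) (≈-reflexive (value (≡ᵇ-complete {l} refl)))
        where
        value : ∀ {b} → b ≡ true → when b (f (suc l)) ≡ f (suc l)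
        value refl = refl
        other : ∀ k → k ∈ upTo r → k ≢ l → when (l ≡ᵇ k) (f (suc k)) ≈ unit
        other k _ k≢ with l ≡ᵇ k in e
        ... | true  = contradiction (sym (≡ᵇ-sound e)) k≢
        ... | false = ≈-refl

      one-component : ∀ x → ⨀ (boxes r c) (λ b → ⨀ (upTo r) (λ i → when (isRep sameC b) (when (inC b i x) (f (suc i))))) ≈
                      when (isRep sameB x) (f (level x))
      one-component x with isRep sameB x in rep
      ... | false = ⨀-unit (boxes r c) (λ b _ → ⨀-unit (upTo r) (λ i _ → when-unit (isRep sameC b)))
        where
        when-unit : ∀ b → when b unit ≈ unit
        when-unit true  = ≈-refl
        when-unit false = ≈-refl
      ... | true with C.rep-exists (B.rep-positive {x} rep)
      ... | b₀ , rep₀ , path₀ = ≈-trans (⨀-one (boxes-unique r c) (positive-∈ (C.rep-positive {b₀} rep₀)) other)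
                (≈-trans (⨀-cong (upTo r) (λ i _ → here-value i)) (levels (B.rep-positive {x} rep)))
        where
        here-value : ∀ i → when (isRep sameC b₀) (when (sameC b₀ x ∧ (level x ≡ᵇ suc i)) (f (suc i))) ≈ when (level x ≡ᵇ suc i) (f (suc i))
        here-value i rewrite rep₀ | C.same⁺ (C.rep-positive {b₀} rep₀) (B.rep-positive {x} rep) path₀ = ≈-refl
        other : ∀ b → b ∈ boxes r c → b ≢ b₀ →
                ⨀ (upTo r) (λ i → when (isRep sameC b) (when (sameC b x ∧ (level x ≡ᵇ suc i)) (f (suc i)))) ≈ unit
        other b _ b≢ with isRep sameC b in repb | sameC b x in bx
        ... | false | _ = ⨀-unit (upTo r) (λ _ _ → ≈-refl)
        ... | true  | false = ⨀-unit (upTo r) (λ _ _ → ≈-refl)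
        ... | true  | true  = contradiction
          (C.rep-unique {b} {b₀} repb rep₀ (proj₂ (proj₂ (C.same⁻ {b} {x} bx)) ◅◅ C.reverse path₀)) b≢

    -- Each border component lies in one connected component and has one level, so the triple
    -- product collapses to one factor per border component. Then `root` trades its
    -- lexicographically least box for the start of its path, which can be recognised from two
    -- consecutive diagonals.
    border-product : ⨀ components (λ b → ⨀ (upTo r) (λ i → ⨀ (boxes r c) (λ x → when (inC b i x) (f (suc i))))) ≈
                     ⨀ (boxes r c) (λ x → when (isEnd x) (f (level x)))
    border-product = begin
      ⨀ components (λ b → ⨀ (upTo r) (λ i → ⨀ (boxes r c) (λ x → when (inC b i x) (f (suc i)))))
        ≈⟨ ⨀-filterᵇ (isRep sameC) (boxes r c) _ ⟩
      ⨀ (boxes r c) (λ b → when (isRep sameC b) (⨀ (upTo r) (λ i → ⨀ (boxes r c) (λ x → when (inC b i x) (f (suc i))))))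
        ≈⟨ ⨀-cong (boxes r c) (λ b _ → ≈-trans (⨀-when (isRep sameC b) (upTo r) _)
             (≈-trans (⨀-cong (upTo r) (λ i _ → ⨀-when (isRep sameC b) (boxes r c) _)) (⨀-swap (upTo r) (boxes r c) _))) ⟩
      ⨀ (boxes r c) (λ b → ⨀ (boxes r c) (λ x → ⨀ (upTo r) (λ i → when (isRep sameC b) (when (inC b i x) (f (suc i))))))
        ≈⟨ ⨀-swap (boxes r c) (boxes r c) _ ⟩
      ⨀ (boxes r c) (λ x → ⨀ (boxes r c) (λ b → ⨀ (upTo r) (λ i → when (isRep sameC b) (when (inC b i x) (f (suc i))))))
        ≈⟨ ⨀-cong (boxes r c) (λ x _ → one-component x) ⟩
      ⨀ (boxes r c) (λ x → when (isRep sameB x) (f (level x)))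
        ≈⟨ ⨀-bij (×-≡-dec ℕ._≟_ ℕ._≟_) (isRep sameB) isEnd root (boxes-unique r c) (boxes-unique r c) into onto injective ⟩
      ⨀ (boxes r c) (λ x → when (isEnd x) (f (level x))) ∎
      where
      end-positive : ∀ {x} → isEnd x ≡ true → Positive x
      end-positive {x} e = inSupp⁻ (proj₁ (∧-true {inSupp x} e))
      into : ∀ x → x ∈ boxes r c → isRep sameB x ≡ true → root x ∈ boxes r c × isEnd (root x) ≡ true × f (level x) ≈ f (level (root x))
      into x _ rep with root-spec (B.rep-positive {x} rep)
      ... | end , path = positive-∈ (end-positive {root x} end) , end , ≈-reflexive (cong f (sym (level-constant path)))
      onto : ∀ y → y ∈ boxes r c → isEnd y ≡ true → ∃ λ x → x ∈ boxes r c × isRep sameB x ≡ true × root x ≡ y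
      onto y _ end with B.rep-exists (end-positive {y} end)
      ... | x , rep , path = x , positive-∈ (B.rep-positive {x} rep) , rep , trans (root-constant path) (root-end {y} end)
      injective : ∀ x x′ → x ∈ boxes r c → x′ ∈ boxes r c → isRep sameB x ≡ true → isRep sameB x′ ≡ true → root x ≡ root x′ → x ≡ x′
      injective x x′ _ _ rep rep′ e with root-spec (B.rep-positive {x} rep) | root-spec (B.rep-positive {x′} rep′)
      ... | _ , path | _ , path′ = B.rep-unique {x} {x′} rep rep′
        (B.reverse path ◅◅ subst (λ y → Star B.Edge y x′) (sym e) path′)

-- Partitions as multiplicities and as column lengths

-- For a nonincreasing a that vanishes from L on and v > 0, leading L a v is the number of entries that are at least v.
leading : ℕ → (ℕ → ℕ) → ℕ → ℕ
leading zero a v = 0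
leading (suc L) a v = if v ≤ᵇ a 0 then suc (leading L (a ∘ suc) v) else 0

decreasing-≤ : ∀ {a : ℕ → ℕ} → (∀ q → a (suc q) ≤ a q) → ∀ {q q′} → q ≤ q′ → a q′ ≤ a q
decreasing-≤ dec {q} {zero} z≤n = ℕ.≤-refl
decreasing-≤ dec {q} {suc q′} q≤ with ℕ.m≤n⇒m<n∨m≡n q≤
... | inj₁ (s≤s q≤q′) = ℕ.≤-trans (dec q′) (decreasing-≤ dec q≤q′)
... | inj₂ refl = ℕ.≤-refl

leading⁻ : ∀ L {a v q} → q < leading L a v → v ≤ a q
leading⁻ (suc L) {a} {v} {q} q< with v ≤ᵇ a 0 in e
leading⁻ (suc L) {a} {v} {zero}  q< | true = ℕ.≤ᵇ⇒≤ v (a 0) (subst T (sym e) tt)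
leading⁻ (suc L) {a} {v} {suc q} (s≤s q<) | true = leading⁻ L q<

leading⁺ : ∀ L {a v q} → (∀ q → a (suc q) ≤ a q) → a L < v → v ≤ a q → q < leading L a v
leading⁺ zero {a} {v} {q} dec aL< v≤ = contradiction (ℕ.≤-trans v≤ (decreasing-≤ dec z≤n)) (ℕ.<⇒≱ aL<)
leading⁺ (suc L) {a} {v} {q} dec aL< v≤ with v ≤ᵇ a 0 in e
... | false = contradiction (T-true (ℕ.≤⇒≤ᵇ (ℕ.≤-trans v≤ (decreasing-≤ dec z≤n)))) (λ e′ → true≢false (trans (sym e′) e))
leading⁺ (suc L) {a} {v} {zero}  dec aL< v≤ | true = z<s
leading⁺ (suc L) {a} {v} {suc q} dec aL< v≤ | true = s≤s (leading⁺ L (λ q → dec (suc q)) aL< v≤)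

-- Counts are accessible only through the equivalence of q < `leading L a v` with v ≤ a q, so they
-- are compared as initial segments of ℕ.
≤-from-< : ∀ {a b} → (∀ q → q < a → q < b) → a ≤ b
≤-from-< {zero}  f = z≤n
≤-from-< {suc a} f = f a ℕ.≤-refl

≡-from-< : ∀ {a b} → (∀ q → q < a → q < b) → (∀ q → q < b → q < a) → a ≡ b
≡-from-< f g = ℕ.≤-antisym (≤-from-< f) (≤-from-< g)

-- With f v the number of parts that are at least v, the difference f v - f (v + 1) is the
-- multiplicity of v.
mult : ∀ n → (ℕ → ℕ) → State n
mult zero f = []
mult (suc n) f = (f (suc n) ∸ f (suc (suc n))) ∷ mult n f

-- Only differences of f matter, hence the free constant a. In `mult-conj` it is the multiplicity of
-- the largest part, which `conj` adds at every smaller value.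
mult-cong : ∀ n a {f g : ℕ → ℕ} → (∀ v → 0 < v → v ≤ suc n → f v ≡ a + g v) → mult n f ≡ mult n g
mult-cong zero a e = refl
mult-cong (suc n) a {f} {g} e = cong₂ _∷_
  (trans (cong₂ _∸_ (e (suc n) z<s (ℕ.n≤1+n _)) (e (suc (suc n)) z<s ℕ.≤-refl)) (ℕ.[m+n]∸[m+o]≡n∸o a _ _))
  (mult-cong n a (λ v 0< v≤ → e v 0< (ℕ.m≤n⇒m≤1+n v≤)))

mult-0 : ∀ n {f : ℕ → ℕ} → (∀ v → 0 < v → f v ≡ 0) → mult n f ≡ ∅
mult-0 zero e = refl
mult-0 (suc n) {f} e = cong₂ _∷_ (trans (cong (_∸ f (suc (suc n))) (e (suc n) z<s)) (ℕ.0∸n≡0 (f (suc (suc n))))) (mult-0 n e)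

conj : ∀ {n} → State n → ℕ → ℕ
conj [] v = 0
conj {suc n} (p ∷ ps) v = (if v ≤ᵇ suc n then p else 0) + conj ps v

if-≤ : ∀ {A : Set} {v n} {x y : A} → v ≤ n → (if v ≤ᵇ n then x else y) ≡ x
if-≤ v≤ rewrite T-true (ℕ.≤⇒≤ᵇ v≤) = refl

if-> : ∀ {A : Set} {v n} {x y : A} → n < v → (if v ≤ᵇ n then x else y) ≡ y
if-> {v = v} {n} n< with v ≤ᵇ n in e
... | true  = contradiction (ℕ.≤ᵇ⇒≤ v n (subst T (sym e) tt)) (ℕ.<⇒≱ n<)
... | false = refl

conj-> : ∀ {n} (μ : State n) {v} → n < v → conj μ v ≡ 0
conj-> [] n< = refl
conj-> {suc n} (p ∷ ps) n< = cong₂ _+_ (if-> n<) (conj-> ps (ℕ.<-trans (ℕ.n<1+n n) n<))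

conj-∅ : ∀ n v → conj (∅ {n}) v ≡ 0
conj-∅ zero v = refl
conj-∅ (suc n) v with v ≤ᵇ suc n
... | true  = conj-∅ n v
... | false = conj-∅ n v

conj-decreasing : ∀ {n} (μ : State n) v → conj μ (suc v) ≤ conj μ v
conj-decreasing [] v = z≤n
conj-decreasing {suc n} (p ∷ ps) v = ℕ.+-mono-≤ first (conj-decreasing ps v)
  where
  first : (if suc v ≤ᵇ suc n then p else 0) ≤ (if v ≤ᵇ suc n then p else 0)
  first with suc v ℕ.≤? suc n
  ... | yes v< = ℕ.≤-reflexive (trans (if-≤ v<) (sym (if-≤ (ℕ.<⇒≤ v<))))
  ... | no v≮  = ℕ.≤-trans (ℕ.≤-reflexive (if-> {v = suc v} (ℕ.≰⇒> v≮))) z≤n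

mult-conj : ∀ {n} (μ : State n) → mult n (conj μ) ≡ μ
mult-conj [] = refl
mult-conj {suc n} (p ∷ ps) = cong₂ _∷_
  (trans (cong₂ _∸_ (cong₂ _+_ (if-≤ (ℕ.≤-refl {suc n})) (conj-> ps ℕ.≤-refl))
                    (cong₂ _+_ (if-> {v = suc (suc n)} ℕ.≤-refl) (conj-> ps (ℕ.n≤1+n _)))) (ℕ.+-identityʳ p))
  (trans (mult-cong n p (λ v _ v≤ → cong (_+ conj ps v) (if-≤ v≤))) (mult-conj ps))

-- The differences telescope down from f (suc n), which vanishes.
conj-mult : ∀ n {f : ℕ → ℕ} {v} → (∀ v → f (suc v) ≤ f v) → f (suc n) ≡ 0 → 0 < v → v ≤ suc n → conj (mult n f) v ≡ f v
conj-mult n {f} dec f0 0<v v≤ = trans (sym (ℕ.+-identityʳ _)) (trans (cong (conj (mult n f) _ +_) (sym f0)) (go n 0<v v≤))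
  where
  go : ∀ n {v} → 0 < v → v ≤ suc n → conj (mult n f) v + f (suc n) ≡ f v
  go zero {suc zero} _ _ = refl
  go zero {suc (suc v)} _ (s≤s ())
  go (suc n) {v} 0<v v≤ with ℕ.m≤n⇒m<n∨m≡n v≤
  ... | inj₁ (s≤s v≤n) rewrite if-≤ {x = f (suc n) ∸ f (suc (suc n))} {y = 0} v≤n = trans
    (trans (cong (_+ f (suc (suc n))) (ℕ.+-comm (f (suc n) ∸ f (suc (suc n))) (conj (mult n f) v))) (trans (ℕ.+-assoc (conj (mult n f) v) _ _)
      (cong (conj (mult n f) v +_) (ℕ.m∸n+n≡m (dec (suc n)))))) (go n 0<v v≤n)
  ... | inj₂ refl = cong (_+ f (suc (suc n))) (conj-> (mult (suc n) f) ℕ.≤-refl)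

-- The conservation law of a site, free of subtraction: the multiplicity changes by outgoing minus
-- incoming charge.
branches-sound : ∀ {θ θ′ p q} → (θ′ , q) ∈ branches up θ p → carry θ 1 + q ≡ carry θ′ 1 + p
branches-sound {false} (here refl) = refl
branches-sound {false} (there (here refl)) = refl
branches-sound {true} {p = zero}  (here refl) = refl
branches-sound {true} {p = suc p} (here refl) = refl
branches-sound {true} {p = suc p} (there (here refl)) = refl

branches-complete : ∀ θ θ′ p q → carry θ 1 + q ≡ carry θ′ 1 + p → (θ′ , q) ∈ branches up θ p
branches-complete false false p q refl = here refl
branches-complete false true  p q refl = there (here refl)
branches-complete true  false (suc p) q refl = here refl
branches-complete true  true  zero q refl = here refl
branches-complete true  true  (suc p) q refl = there (here refl)

branches-swap : ∀ {θ θ′ p q} → (θ′ , q) ∈ branches dn θ p → (θ′ , p) ∈ branches up θ q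
branches-swap {false} {p = zero}  (here refl) = here refl
branches-swap {false} {p = suc p} (here refl) = here refl
branches-swap {false} {p = suc p} (there (here refl)) = there (here refl)
branches-swap {true} (here refl) = here refl
branches-swap {true} {q = zero} (there (here refl)) = here refl
branches-swap {true} {q = suc q}  (there (here refl)) = there (here refl)

branches-swap⁻ : ∀ {θ θ′ p q} → (θ′ , p) ∈ branches up θ q → (θ′ , q) ∈ branches dn θ p
branches-swap⁻ {false} {p = zero}  (here refl) = here refl
branches-swap⁻ {false} {p = suc p} (here refl) = here refl
branches-swap⁻ {false} (there (here refl)) = there (here refl)
branches-swap⁻ {true} {q = zero} (here refl) = there (here refl)
branches-swap⁻ {true} {q = suc q}  (here refl) = here refl
branches-swap⁻ {true} {q = suc q}  (there (here refl)) = there (here refl)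

∈-next⁺ : ∀ {d θ θ′ n p q} (μ : State n) {ν} → (θ′ , q) ∈ branches d θ p → ν ∈ next d θ′ μ → (q ∷ ν) ∈ next d θ (p ∷ μ)
∈-next⁺ μ = ∈-extend⁺ _∷_ Vec.∷-injective

-- Reversing a step exchanges `dn` and `up`, so interlacing is analysed for `up` alone.
next-swap : ∀ {θ n} (μ ν : State n) → ν ∈ next dn θ μ → μ ∈ next up θ ν
next-swap [] [] ν∈ = here refl
next-swap {θ} (p ∷ ps) _ ν∈ with ∈-extend⁻ _∷_ Vec.∷-injective (branches dn θ p) ν∈
... | _ , qs , b∈ , qs∈ , refl = ∈-next⁺ qs (branches-swap b∈) (next-swap ps qs qs∈)

next-swap⁻ : ∀ {θ n} (μ ν : State n) → ν ∈ next up θ μ → μ ∈ next dn θ ν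
next-swap⁻ [] [] ν∈ = here refl
next-swap⁻ {θ} (p ∷ ps) _ ν∈ with ∈-extend⁻ _∷_ Vec.∷-injective (branches up θ p) ν∈
... | _ , qs , b∈ , qs∈ , refl = ∈-next⁺ qs (branches-swap⁻ b∈) (next-swap⁻ ps qs qs∈)

-- Corresponding columns of two partitions differ by at most one box exactly when one is obtained from the other by
-- adding a horizontal strip.
Bump : ℕ → ℕ → Set
Bump x y = x ≤ y × y ≤ suc x

bump-carry : ∀ {x y} → Bump x y → ∃ λ θ → y ≡ carry θ 1 + x
bump-carry (x≤ , y≤) with ℕ.m≤n⇒m<n∨m≡n x≤
... | inj₁ x< = true , ℕ.≤-antisym y≤ x<
... | inj₂ refl = false , refl

carry-bump : ∀ {x y} θ → y ≡ carry θ 1 + x → Bump x y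
carry-bump false refl = ℕ.≤-refl , ℕ.n≤1+n _
carry-bump true  refl = ℕ.n≤1+n _ , ℕ.≤-refl

-- The charge at a part size is the difference of the two column lengths there; the last hypothesis
-- is this invariant at the incoming end, and `Bump` provides it for the next site.
mult-next : ∀ n θ {f g : ℕ → ℕ} → (∀ v → f (suc v) ≤ f v) → (∀ v → g (suc v) ≤ g v) → (∀ v → Bump (f (suc v)) (g (suc v))) →
            g (suc n) ≡ carry θ 1 + f (suc n) → mult n g ∈ next up θ (mult n f)
mult-next zero θ df dg b e = here refl
mult-next (suc n) θ {f} {g} df dg b e with bump-carry (b n)
... | θ′ , e′ = ∈-next⁺ (mult n f) (branches-complete θ θ′ _ _ sums) (mult-next n θ′ df dg b e′)
  where
  sums : carry θ 1 + (g (suc n) ∸ g (suc (suc n))) ≡ carry θ′ 1 + (f (suc n) ∸ f (suc (suc n)))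
  sums = ℕ.+-cancelʳ-≡ (f (suc (suc n))) _ _ (trans (ℕ.+-assoc (carry θ 1) _ _)
    (trans (ℕ+.x∙yz≈y∙xz (carry θ 1) (g (suc n) ∸ g (suc (suc n))) (f (suc (suc n)))) (trans (cong ((g (suc n) ∸ g (suc (suc n))) +_) (sym e))
    (trans (ℕ.m∸n+n≡m (dg (suc n))) (trans e′ (trans (cong (carry θ′ 1 +_) (sym (ℕ.m∸n+n≡m (df (suc n))))) (sym (ℕ.+-assoc (carry θ′ 1) _ _))))))))

conj-next : ∀ {n θ} (μ ν : State n) {v} → v ≤ n → ν ∈ next up θ μ → ∃ λ θ′ → carry θ 1 + conj ν v ≡ carry θ′ 1 + conj μ v
conj-next {θ = θ} [] [] {v} v≤ ν∈ = θ , refl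
conj-next {suc n} {θ} (p ∷ ps) _ {v} v≤ ν∈ with ∈-extend⁻ _∷_ Vec.∷-injective (branches up θ p) ν∈
... | (θ′ , q) , qs , b∈ , qs∈ , refl rewrite if-≤ {x = p} {y = 0} v≤ | if-≤ {x = q} {y = 0} v≤ with ℕ.m≤n⇒m<n∨m≡n v≤
... | inj₁ (s≤s v≤n) with conj-next ps qs v≤n qs∈
... | θ″ , e = θ″ , (begin
          carry θ 1 + (q + conj qs v) ≡⟨ ℕ.+-assoc (carry θ 1) q _ ⟨
          carry θ 1 + q + conj qs v ≡⟨ cong (_+ conj qs v) (trans (branches-sound b∈) (ℕ.+-comm (carry θ′ 1) p)) ⟩
          p + carry θ′ 1 + conj qs v ≡⟨ ℕ.+-assoc p _ _ ⟩
          p + (carry θ′ 1 + conj qs v) ≡⟨ cong (p +_) e ⟩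
          p + (carry θ″ 1 + conj ps v) ≡⟨ ℕ+.x∙yz≈y∙xz p (carry θ″ 1) _ ⟩
          carry θ″ 1 + (p + conj ps v) ∎)
  where open ≡-Reasoning
conj-next {suc n} {θ} (p ∷ ps) _ {v} v≤ ν∈ | (θ′ , q) , qs , b∈ , qs∈ , refl | inj₂ refl
  rewrite conj-> qs (ℕ.n<1+n n) | conj-> ps (ℕ.n<1+n n) | ℕ.+-identityʳ q | ℕ.+-identityʳ p = θ′ , branches-sound b∈

conj-bump : ∀ {n} (μ ν : State n) → ν ∈ next up false μ → ∀ v → Bump (conj μ v) (conj ν v)
conj-bump {n} μ ν ν∈ v with v ℕ.≤? n
... | yes v≤ = carry-bump (proj₁ (conj-next μ ν v≤ ν∈)) (proj₂ (conj-next μ ν v≤ ν∈))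
... | no v≰ rewrite conj-> μ (ℕ.≰⇒> v≰) | conj-> ν (ℕ.≰⇒> v≰) = z≤n , z≤n

module ℕΣ = BigOp ℕ.+-0-commutativeMonoid

-- Abel summation: the size counted by parts is the size counted by columns.
weight-mult : ∀ n {f : ℕ → ℕ} → (∀ v → f (suc v) ≤ f v) → f (suc n) ≡ 0 → weight (mult n f) ≡ ℕΣ.⨀ (upTo n) (f ∘ suc)
weight-mult n {f} dec f0 = trans (sym (ℕ.+-identityʳ _)) (trans (cong (weight (mult n f) +_) (sym (trans (cong (n *_) f0) (ℕ.*-zeroʳ n)))) (go n))
  where
  go : ∀ n → weight (mult n f) + n * f (suc n) ≡ ℕΣ.⨀ (upTo n) (f ∘ suc)
  go zero = refl
  go (suc n) = begin
    suc n * (x ∸ y) + weight (mult n f) + suc n * y ≡⟨ cong (_+ suc n * y) (ℕ.+-comm (suc n * (x ∸ y)) _) ⟩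
    weight (mult n f) + suc n * (x ∸ y) + suc n * y ≡⟨ ℕ.+-assoc (weight (mult n f)) _ _ ⟩
    weight (mult n f) + (suc n * (x ∸ y) + suc n * y) ≡⟨ cong (weight (mult n f) +_) (ℕ.*-distribˡ-+ (suc n) (x ∸ y) y) ⟨
    weight (mult n f) + suc n * (x ∸ y + y) ≡⟨ cong (λ k → weight (mult n f) + suc n * k) (ℕ.m∸n+n≡m (dec (suc n))) ⟩
    weight (mult n f) + (x + n * x) ≡⟨ cong (weight (mult n f) +_) (ℕ.+-comm x _) ⟩
    weight (mult n f) + (n * x + x) ≡⟨ ℕ.+-assoc (weight (mult n f)) _ _ ⟨
    weight (mult n f) + n * x + x ≡⟨ cong (_+ x) (go n) ⟩
    ℕΣ.⨀ (upTo n) (f ∘ suc) + x ≡⟨ ℕΣ.⨀-upTo-last (f ∘ suc) n ⟨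
    ℕΣ.⨀ (upTo (suc n)) (f ∘ suc) ∎
    where
    x y : ℕ
    x = f (suc n)
    y = f (suc (suc n))
    open ≡-Reasoning

-- Diagonals of a plane partition and the starts of border components

module Diagonals (r c : ℕ) (p : ℕ → ℕ → ℕ)
    (outside : ∀ i j → r ≤ i ⊎ c ≤ j → p i j ≡ 0)
    (column-≥ : ∀ i j → p (suc i) j ≤ p i j) (row-≥ : ∀ i j → p i (suc j) ≤ p i j)
    (N : ℕ) (bound : ∀ i j → p i j ≤ N) where
  open AOf r c p
  open PlanePartition r c p outside column-≥ row-≥

  -- One of the two truncated differences is always 0: diagonals with k ≤ r begin on the left edge
  -- of the rectangle, those with r ≤ k on its top edge.
  box : ℕ → ℕ → Box
  box k q = q + (r ∸ k) , q + (k ∸ r)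

  D : ℕ → ℕ → ℕ
  D k q = val (box k q)

  cnt : ℕ → ℕ → ℕ
  cnt k = leading r (D k)

  st : ℕ → State N
  st k = mult N (cnt k)

  D-decreasing : ∀ k q → D k (suc q) ≤ D k q
  D-decreasing k q = diagonal-≥ _ _

  <-cnt⁻ : ∀ {k q v} → q < cnt k v → v ≤ D k q
  <-cnt⁻ = leading⁻ r

  <-cnt⁺ : ∀ {k q v} → 0 < v → v ≤ D k q → q < cnt k v
  <-cnt⁺ {k} 0<v = leading⁺ r (D-decreasing k) (subst (_< _) (sym (outside _ _ (inj₁ (ℕ.m≤m+n r _)))) 0<v)

  cnt-decreasing : ∀ k v → cnt k (suc v) ≤ cnt k v
  cnt-decreasing k v = go r
    where
    go : ∀ L {a} → leading L a (suc v) ≤ leading L a v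
    go zero = z≤n
    go (suc L) {a} with suc v ≤ᵇ a 0 in e | v ≤ᵇ a 0 in e′
    ... | false | _ = z≤n
    ... | true  | true  = s≤s (go L)
    ... | true  | false = contradiction (trans (sym (T-true (ℕ.≤⇒≤ᵇ (ℕ.<⇒≤ (ℕ.≤ᵇ⇒≤ (suc v) (a 0) (subst T (sym e) tt)))))) e′) true≢false

  cnt-top : ∀ k → cnt k (suc N) ≡ 0
  cnt-top k = ℕ.n≤0⇒n≡0 (≤-from-< λ q q< → contradiction (<-cnt⁻ {k} q<) (ℕ.<⇒≱ (s≤s (bound _ _))))

  cnt-≤ : ∀ k v → cnt k (suc v) ≤ r
  cnt-≤ k v = ≤-from-< λ q q< → ℕ.≤-<-trans (ℕ.m≤m+n q _) (proj₁ (positive-inside (ℕ.≤-trans z<s (<-cnt⁻ {k} q<))))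

  box-up : ∀ {k} → k < r → ∀ q → box k q ≡ (suc (proj₁ (box (suc k) q)) , proj₂ (box (suc k) q))
  box-up {k} k<r q = cong₂ _,_ (trans (cong (q +_) (ℕ.+-∸-assoc 1 k<r)) (ℕ.+-suc q _))
    (cong (q +_) (trans (ℕ.m≤n⇒m∸n≡0 (ℕ.<⇒≤ k<r)) (sym (ℕ.m≤n⇒m∸n≡0 k<r))))

  box-dn : ∀ {k} → r ≤ k → ∀ q → box (suc k) q ≡ (proj₁ (box k q) , suc (proj₂ (box k q)))
  box-dn r≤k q = cong₂ _,_ (cong (q +_) (trans (ℕ.m≤n⇒m∸n≡0 (ℕ.m≤n⇒m≤1+n r≤k)) (sym (ℕ.m≤n⇒m∸n≡0 r≤k))))
    (trans (cong (q +_) (ℕ.+-∸-assoc 1 r≤k)) (ℕ.+-suc q _))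

  -- Neighbouring diagonals interlace: columns of the array give D k q ≤ D (k + 1) q, rows give D (k
  -- + 1) (q + 1) ≤ D k q. Conjugated, column lengths grow by 0 or 1.
  cnt-up : ∀ {k} → k < r → ∀ v → Bump (cnt k (suc v)) (cnt (suc k) (suc v))
  cnt-up {k} k<r v =
    ≤-from-< (λ q q< → <-cnt⁺ z<s (ℕ.≤-trans (<-cnt⁻ {k} q<) (weaker q))) ,
    ≤-from-< λ { zero _ → z<s ; (suc q) q< → s≤s (<-cnt⁺ {k} z<s (ℕ.≤-trans (<-cnt⁻ {suc k} q<) (stronger q))) }
    where
    weaker : ∀ q → D k q ≤ D (suc k) q
    weaker q = subst (λ b → val b ≤ D (suc k) q) (sym (box-up k<r q)) (column-≥ _ _)
    stronger : ∀ q → D (suc k) (suc q) ≤ D k q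
    stronger q = subst (λ b → D (suc k) (suc q) ≤ val b) (sym (box-up k<r q)) (row-≥ _ _)

  cnt-dn : ∀ {k} → r ≤ k → ∀ v → Bump (cnt (suc k) (suc v)) (cnt k (suc v))
  cnt-dn {k} r≤k v =
    ≤-from-< (λ q q< → <-cnt⁺ z<s (ℕ.≤-trans (<-cnt⁻ {suc k} q<) (weaker q))) ,
    ≤-from-< λ { zero _ → z<s ; (suc q) q< → s≤s (<-cnt⁺ {suc k} z<s (ℕ.≤-trans (<-cnt⁻ {k} q<) (stronger q))) }
    where
    weaker : ∀ q → D (suc k) q ≤ D k q
    weaker q = subst (λ b → val b ≤ D k q) (sym (box-dn r≤k q)) (row-≥ _ _)
    stronger : ∀ q → D k (suc q) ≤ D (suc k) q
    stronger q = subst (λ b → D k (suc q) ≤ val b) (sym (box-dn r≤k q)) (column-≥ _ _)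

  st-next : ∀ k → st (suc k) ∈ next (direction r k) false (st k)
  st-next k with k <ᵇ r in e
  ... | true  = mult-next N false (cnt-decreasing k) (cnt-decreasing (suc k)) (cnt-up (<ᵇ-sound e)) (trans (cnt-top (suc k)) (sym (cnt-top k)))
  ... | false = next-swap⁻ (st (suc k)) (st k) (mult-next N false (cnt-decreasing (suc k)) (cnt-decreasing k)
                  (cnt-dn (ℕ.≮⇒≥ λ k< → true≢false (trans (sym (<ᵇ-complete k<)) e))) (trans (cnt-top k) (sym (cnt-top (suc k)))))

  st-first : st 0 ≡ ∅
  st-first = mult-0 N λ v 0<v → ℕ.n≤0⇒n≡0 (≤-from-< λ q q< → contradiction
    (ℕ.≤-trans 0<v (ℕ.≤-trans (<-cnt⁻ {0} q<) (ℕ.≤-reflexive (outside _ _ (inj₁ (ℕ.m≤n+m r q)))))) ℕ.n≮0)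

  st-last : st (r + c) ≡ ∅
  st-last = mult-0 N λ v 0<v → ℕ.n≤0⇒n≡0 (≤-from-< λ q q< → contradiction
    (ℕ.≤-trans 0<v (ℕ.≤-trans (<-cnt⁻ {r + c} q<) (ℕ.≤-reflexive (outside _ _ (inj₂
      (ℕ.≤-trans (ℕ.≤-reflexive (sym (ℕ.m+n∸m≡n r c))) (ℕ.m≤n+m _ q))))))) ℕ.n≮0)

  chain-∈ : chain (r + c) st ∈ chains (direction r) (r + c) ∅
  chain-∈ = subst (λ μ → chain (r + c) st ∈ chains (direction r) (r + c) μ) st-first
    (∈-chains⁺ (direction r) (r + c) st (λ k _ → st-next k))

  -- Inside the rectangle this is the index of the previous diagonal; with `position` it inverts the
  -- coordinates of `box (suc κ) q`.
  prev : Box → ℕ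
  prev (i , j) = j + (r ∸ suc i)

  position : Box → ℕ
  position (i , j) = i ⊓ j

  suc-prev : ∀ {i j} → i < r → diagonal (i , j) ≡ suc (prev (i , j))
  suc-prev {i} {j} i<r = trans (cong (j +_) (ℕ.+-∸-assoc 1 i<r)) (ℕ.+-suc j _)

  prev-< : ∀ {i j} → i < r → j < c → prev (i , j) < r + c
  prev-< {i} {j} i<r j<c = ℕ.≤-trans (ℕ.+-mono-≤ j<c (ℕ.m∸n≤m r (suc i))) (ℕ.≤-reflexive (ℕ.+-comm c r))

  box-diagonal : ∀ {i j} → i < r → box (diagonal (i , j)) (position (i , j)) ≡ (i , j)
  box-diagonal {i} {j} i<r = go (ℕ.<⇒≤ i<r)
    where
    go : i ≤ r → box (diagonal (i , j)) (position (i , j)) ≡ (i , j)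
    go i≤r with ℕ.≤-total i j | ℕ.m+[n∸m]≡n i≤r
    ... | inj₁ i≤j | e = cong₂ _,_
      (trans (cong₂ _+_ (ℕ.m≤n⇒m⊓n≡m i≤j) (ℕ.m≤n⇒m∸n≡0 r≤)) (ℕ.+-identityʳ i))
      (trans (cong₂ _+_ (ℕ.m≤n⇒m⊓n≡m i≤j) shift) (ℕ.m+[n∸m]≡n i≤j))
      where
      r≤ : r ≤ j + (r ∸ i)
      r≤ = ℕ.≤-trans (ℕ.≤-reflexive (sym e)) (ℕ.+-monoˡ-≤ (r ∸ i) i≤j)
      shift : j + (r ∸ i) ∸ r ≡ j ∸ i
      shift = trans (cong (j + (r ∸ i) ∸_) (sym e))
        (trans (cong₂ _∸_ (ℕ.+-comm j (r ∸ i)) (ℕ.+-comm i (r ∸ i))) (ℕ.[m+n]∸[m+o]≡n∸o (r ∸ i) j i))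
    ... | inj₂ j≤i | e = cong₂ _,_
      (trans (cong₂ _+_ (ℕ.m≥n⇒m⊓n≡n j≤i) shift) (ℕ.m+[n∸m]≡n j≤i))
      (trans (cong₂ _+_ (ℕ.m≥n⇒m⊓n≡n j≤i) (ℕ.m≤n⇒m∸n≡0 ≤r)) (ℕ.+-identityʳ j))
      where
      ≤r : j + (r ∸ i) ≤ r
      ≤r = ℕ.≤-trans (ℕ.+-monoˡ-≤ (r ∸ i) j≤i) (ℕ.≤-reflexive e)
      shift : r ∸ (j + (r ∸ i)) ≡ i ∸ j
      shift = trans (cong (_∸ (j + (r ∸ i))) (sym e))
        (trans (cong₂ _∸_ (ℕ.+-comm i (r ∸ i)) (ℕ.+-comm j (r ∸ i))) (ℕ.[m+n]∸[m+o]≡n∸o (r ∸ i) i j))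

  diagonal-box : ∀ k q → q + (r ∸ k) < r → diagonal (box k q) ≡ k × position (box k q) ≡ q
  diagonal-box k q inside with ℕ.≤-total k r
  ... | inj₁ k≤r rewrite ℕ.m≤n⇒m∸n≡0 k≤r | ℕ.+-identityʳ q = diag , ℕ.m≥n⇒m⊓n≡n (ℕ.m≤m+n q _)
    where
    e : (r ∸ k) + k ≡ r
    e = ℕ.m∸n+n≡m k≤r
    q≤k : q ≤ k
    q≤k = ℕ.+-cancelˡ-≤ (r ∸ k) q k (ℕ.≤-trans (ℕ.≤-reflexive (ℕ.+-comm (r ∸ k) q)) (ℕ.≤-trans (ℕ.<⇒≤ inside) (ℕ.≤-reflexive (sym e))))
    diag : q + (r ∸ (q + (r ∸ k))) ≡ k
    diag = trans (cong (q +_) (trans (cong₂ _∸_ (sym e) (ℕ.+-comm q _)) (ℕ.[m+n]∸[m+o]≡n∸o (r ∸ k) k q))) (ℕ.m+[n∸m]≡n q≤k)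
  ... | inj₂ r≤k rewrite ℕ.m≤n⇒m∸n≡0 r≤k | ℕ.+-identityʳ q = diag , ℕ.m≤n⇒m⊓n≡m (ℕ.m≤m+n q _)
    where
    diag : q + (k ∸ r) + (r ∸ q) ≡ k
    diag = trans (cong (_+ (r ∸ q)) (ℕ.+-comm q _)) (trans (ℕ.+-assoc (k ∸ r) q _)
      (trans (cong ((k ∸ r) +_) (ℕ.m+[n∸m]≡n (ℕ.<⇒≤ inside))) (ℕ.m∸n+n≡m r≤k)))

  on-diagonal : ∀ {b} → Positive b → ∃ λ κ → ∃ λ q → b ≡ box (suc κ) q × prev b ≡ κ × position b ≡ q × κ < r + c
  on-diagonal {i , j} pos with positive-inside {i} {j} pos
  ... | i<r , j<c = prev (i , j) , position (i , j) ,
    trans (sym (box-diagonal i<r)) (cong (λ k → box k (i ⊓ j)) (suc-prev i<r)) , refl , refl , prev-< i<r j<c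

  prev-box : ∀ {κ q} → 0 < D (suc κ) q → prev (box (suc κ) q) ≡ κ × position (box (suc κ) q) ≡ q × κ < r + c
  prev-box {κ} {q} pos with positive-inside {proj₁ (box (suc κ) q)} pos
  ... | i<r , j<c with diagonal-box (suc κ) q i<r
  ... | d , e = e′ , e , subst (_< r + c) e′ (prev-< i<r j<c)
    where
    e′ : prev (box (suc κ) q) ≡ κ
    e′ = ℕ.suc-injective (trans (sym (suc-prev i<r)) d)

  private
    ≟-Box : DecidableEquality Box
    ≟-Box = ×-≡-dec ℕ._≟_ ℕ._≟_

    module S = BigOp ℕ.+-0-commutativeMonoid

    count-below : ∀ n m → n ≤ m → S.⨀ (upTo m) (λ v → S.when (v <ᵇ n) 1) ≡ n
    count-below zero m _ = S.⨀-unit (upTo m) (λ _ _ → refl)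
    count-below (suc n) (suc m) (s≤s n≤m) = cong suc (trans (S.⨀-applyUpTo _ suc m) (count-below n m n≤m))

  boxes-sum : ∀ {a b} (f : Box → ℕ) → S.⨀ (boxes a b) f ≡ S.⨀ (upTo a) (λ i → S.⨀ (upTo b) (λ j → f (i , j)))
  boxes-sum {a} {b} f = trans (S.⨀-concatMap (λ i → map (λ j → (i , j)) (upTo b)) (upTo a) f)
    (S.⨀-cong (upTo a) (λ i _ → S.⨀-map (λ j → (i , j)) (upTo b) f))

  -- Both sides count pairs of a box and a height below its value. For a fixed height the boxes that
  -- reach it fill an initial segment of each diagonal, whose length is a column length of the
  -- state. Diagonal 0 is empty, so the sum starts at 1.
  total-size : S.⨀ (boxes r c) val ≡ S.⨀ (upTo (r + c)) (λ κ → weight (st (suc κ)))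
  total-size = begin
    S.⨀ (boxes r c) val
      ≡⟨ S.⨀-cong (boxes r c) (λ b _ → sym (count-below (val b) N (bound _ _))) ⟩
    S.⨀ (boxes r c) (λ b → S.⨀ (upTo N) (λ v → S.when (v <ᵇ val b) 1))
      ≡⟨ S.⨀-swap (boxes r c) (upTo N) _ ⟩
    S.⨀ (upTo N) (λ v → S.⨀ (boxes r c) (λ b → S.when (v <ᵇ val b) 1))
      ≡⟨ S.⨀-cong (upTo N) (λ v _ → trans (reindex v) (boxes-sum {r + c} {r} (λ b → S.when (proj₂ b <ᵇ cnt (suc (proj₁ b)) (suc v)) 1))) ⟩
    S.⨀ (upTo N) (λ v → S.⨀ (upTo (r + c)) (λ κ → S.⨀ (upTo r) (λ q → S.when (q <ᵇ cnt (suc κ) (suc v)) 1)))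
      ≡⟨ S.⨀-cong (upTo N) (λ v _ → S.⨀-cong (upTo (r + c)) (λ κ _ → count-below _ r (cnt-≤ (suc κ) v))) ⟩
    S.⨀ (upTo N) (λ v → S.⨀ (upTo (r + c)) (λ κ → cnt (suc κ) (suc v)))
      ≡⟨ S.⨀-swap (upTo N) (upTo (r + c)) _ ⟩
    S.⨀ (upTo (r + c)) (λ κ → S.⨀ (upTo N) (λ v → cnt (suc κ) (suc v)))
      ≡⟨ S.⨀-cong (upTo (r + c)) (λ κ _ → weight-mult N (cnt-decreasing (suc κ)) (cnt-top (suc κ))) ⟨
    S.⨀ (upTo (r + c)) (λ κ → weight (st (suc κ))) ∎
    where
    open ≡-Reasoning
    reindex : ∀ v → S.⨀ (boxes r c) (λ b → S.when (v <ᵇ val b) 1) ≡ S.⨀ (boxes (r + c) r) (λ b → S.when (proj₂ b <ᵇ cnt (suc (proj₁ b)) (suc v)) 1)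
    reindex v = S.⨀-bij ≟-Box (λ b → v <ᵇ val b) (λ b → proj₂ b <ᵇ cnt (suc (proj₁ b)) (suc v)) (λ b → prev b , position b)
      (boxes-unique r c) (boxes-unique (r + c) r) into onto injective
      where
      into : ∀ b → b ∈ boxes r c → (v <ᵇ val b) ≡ true →
             (prev b , position b) ∈ boxes (r + c) r × (position b <ᵇ cnt (suc (prev b)) (suc v)) ≡ true × 1 ≡ 1
      into b _ v< with on-diagonal (ℕ.≤-<-trans z≤n (<ᵇ-sound {v} v<))
      ... | κ , q , refl , e , e′ , κ< rewrite e | e′ = ∈-boxes⁺ κ< (ℕ.<-≤-trans q< (cnt-≤ (suc κ) v)) , <ᵇ-complete q< , refl
        where
        q< : q < cnt (suc κ) (suc v)
        q< = <-cnt⁺ {suc κ} z<s (<ᵇ-sound {v} v<)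
      onto : ∀ y → y ∈ boxes (r + c) r → (proj₂ y <ᵇ cnt (suc (proj₁ y)) (suc v)) ≡ true →
             ∃ λ b → b ∈ boxes r c × (v <ᵇ val b) ≡ true × (prev b , position b) ≡ y
      onto (κ , q) _ q< with <-cnt⁻ {suc κ} (<ᵇ-sound {q} q<)
      ... | v< with prev-box {κ} {q} (ℕ.≤-<-trans z≤n v<)
      ... | e , e′ , _ = box (suc κ) q , positive-∈ (ℕ.≤-<-trans z≤n v<) , <ᵇ-complete v< , cong₂ _,_ e e′
      injective : ∀ b b′ → b ∈ boxes r c → b′ ∈ boxes r c → (v <ᵇ val b) ≡ true → (v <ᵇ val b′) ≡ true →
                  (prev b , position b) ≡ (prev b′ , position b′) → b ≡ b′
      injective b b′ _ _ v< v<′ eq with on-diagonal (ℕ.≤-<-trans z≤n (<ᵇ-sound {v} v<)) | on-diagonal (ℕ.≤-<-trans z≤n (<ᵇ-sound {v} v<′))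
      ... | κ , q , refl , e , e′ , _ | κ′ , q′ , refl , f , f′ , _ =
        cong₂ (λ k → box (suc k)) (trans (sym e) (trans (cong proj₁ eq) f)) (trans (sym e′) (trans (cong proj₂ eq) f′))

  -- On diagonal k the entries that are at least v fill the positions below `cnt k v`, so the run of
  -- the value v through position q ends there.
  level-box : ∀ k q → 0 < D k q → level (box k q) ≡ cnt k (D k q) ∸ q
  level-box k q pos = IsLevel-unique (level-isLevel pos) (record
    { positive  = ℕ.m<n⇒0<n∸m q<
    ; constant  = λ {h} h< → trans (shift h) (ℕ.≤-antisym
        (decreasing-≤ (D-decreasing k) (ℕ.m≤m+n q h))
        (<-cnt⁻ {k} (subst (q + h <_) (ℕ.m+[n∸m]≡n (ℕ.<⇒≤ q<)) (ℕ.+-monoʳ-< q h<))))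
    ; different = λ e → ℕ.<-irrefl refl (<-cnt⁺ {k} pos (ℕ.≤-reflexive (trans (sym e) (trans (shift _)
        (cong (D k) (ℕ.m+[n∸m]≡n (ℕ.<⇒≤ q<)))))))
    })
    where
    q< : q < cnt k (D k q)
    q< = <-cnt⁺ {k} pos ℕ.≤-refl
    shift : ∀ h → p (proj₁ (box k q) + h) (proj₂ (box k q) + h) ≡ D k (q + h)
    shift h = cong₂ p (ℕ+.xy∙z≈xz∙y q (r ∸ k) h) (ℕ+.xy∙z≈xz∙y q (k ∸ r) h)

  Stuck : Box → Set
  Stuck b = ∀ {x} → Before x b → bEdge x b ≡ true → ⊥

  isEnd⁻ : ∀ {b} → isEnd b ≡ true → Stuck b
  isEnd⁻ {i , j} end bef e with ∧-true {inSupp (i , j)} end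
  ... | _ , e₁ with ∧-true {not (bEdge (suc i , j) (i , j))} e₁
  isEnd⁻ {i , j} end below e | _ , e₁ | nb , nl = true≢false (trans (sym e) (not-true nb))
  isEnd⁻ {i , suc j} end left  e | _ , e₁ | nb , nl = true≢false (trans (sym e) (not-true nl))

  isEnd⁺ : ∀ {b} → Positive b → Stuck b → isEnd b ≡ true
  isEnd⁺ {i , j} pos stuck = ∧-intro (inSupp⁺ pos) (∧-intro (false-not (stuck below)) (noLeft j stuck))
    where
    false-not : ∀ {a} → (a ≡ true → ⊥) → not a ≡ true
    false-not {false} _ = refl
    false-not {true}  f = ⊥-elim (f refl)
    noLeft : ∀ j → Stuck (i , j) → not (hasLeft i j) ≡ true
    noLeft zero stuck = refl
    noLeft (suc j) stuck = false-not (stuck left)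

  module _ {κ : ℕ} where
    up-below : κ < r → ∀ q → Before (box κ q) (box (suc κ) q)
    up-below κ<r q = subst (λ b → Before b (box (suc κ) q)) (sym (box-up κ<r q)) below

    up-left : κ < r → ∀ q → Before (box κ q) (box (suc κ) (suc q))
    up-left κ<r q = subst (λ b → Before b (box (suc κ) (suc q))) (sym (box-up κ<r q)) left

    dn-left : r ≤ κ → ∀ q → Before (box κ q) (box (suc κ) q)
    dn-left r≤κ q = subst (Before (box κ q)) (sym (box-dn r≤κ q)) left

    dn-below : r ≤ κ → ∀ q → Before (box κ (suc q)) (box (suc κ) q)
    dn-below r≤κ q = subst (Before (box κ (suc q))) (sym (box-dn r≤κ q)) below

  module _ (κ u : ℕ) where
    private
      -- The value v occupies the positions from y up to x - 1 on diagonal κ, and from y′ up to x′ -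
      -- 1 on the next one.
      v x y x′ y′ : ℕ
      v = suc u
      x = cnt κ v
      y = cnt κ (suc v)
      x′ = cnt (suc κ) v
      y′ = cnt (suc κ) (suc v)

    -- Equal distance to the ends of the two runs means q₀ - q = x - x′, and `Bump` allows for this
    -- offset only the values of the two neighbours.
    adjacent : ∀ {q q₀} → q₀ + x′ ≡ q + x → Before (box κ q₀) (box (suc κ) q)
    adjacent {q} {q₀} e with κ ℕ.<? r
    ... | yes κ<r with bump-carry (cnt-up κ<r u)
    ... | false , e′ with ℕ.+-cancelʳ-≡ x q₀ q (trans (cong (q₀ +_) (sym e′)) e)
    ... | refl = up-below κ<r q
    adjacent {q} {q₀} e | yes κ<r | true , e′ with ℕ.+-cancelʳ-≡ x (suc q₀) q (trans (sym (ℕ.+-suc q₀ x)) (trans (cong (q₀ +_) (sym e′)) e))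
    ... | refl = up-left κ<r q₀
    adjacent {q} {q₀} e | no κ≮r with ℕ.≮⇒≥ κ≮r
    ... | r≤κ with bump-carry (cnt-dn r≤κ u)
    ... | false , e′ with ℕ.+-cancelʳ-≡ x′ q₀ q (trans e (cong (q +_) e′))
    ... | refl = dn-left r≤κ q
    adjacent {q} {q₀} e | no κ≮r | r≤κ | true , e′ with ℕ.+-cancelʳ-≡ x′ q₀ (suc q) (trans e (trans (cong (q +_) e′) (ℕ.+-suc q x′)))
    ... | refl = dn-below r≤κ q

    -- Rearranged, x′ - y′ ≤ (x - y) + 1: a step raises a multiplicity by at most one.
    strip : x′ + y ≤ suc (x + y′)
    strip with κ ℕ.<? r
    ... | yes κ<r = ℕ.+-mono-≤ (proj₂ (cnt-up κ<r u)) (proj₁ (cnt-up κ<r (suc u)))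
    ... | no κ≮r  = ℕ.≤-trans (ℕ.+-mono-≤ (proj₁ (cnt-dn (ℕ.≮⇒≥ κ≮r) u)) (proj₂ (cnt-dn (ℕ.≮⇒≥ κ≮r) (suc u)))) (ℕ.≤-reflexive (ℕ.+-suc x y′))

    y≤x : y ≤ x
    y≤x = cnt-decreasing κ v
    y′≤x′ : y′ ≤ x′
    y′≤x′ = cnt-decreasing (suc κ) v

    -- Same level means q₀ + x′ ≡ q + x, and this equation already forces adjacency.
    no-level-twin : ∀ {q} → D (suc κ) q ≡ v → Stuck (box (suc κ) q) → ∀ q₀ → q₀ + x′ ≡ q + x → D κ q₀ ≢ v
    no-level-twin {q} val≡ stuck q₀ e val₀ = stuck (adjacent e) (bEdge⁺ {box κ q₀} {box (suc κ) q}
      (cEdge⁺ pos₀ (trans val₀ (sym val≡)) (inj₁ (adjacent e)))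
      (trans (trans (level-box κ q₀ pos₀) (cong (λ w → cnt κ w ∸ q₀) val₀))
        (trans same (sym (trans (level-box (suc κ) q (subst (0 <_) (sym val≡) z<s)) (cong (λ w → cnt (suc κ) w ∸ q) val≡))))))
      where
      pos₀ : 0 < D κ q₀
      pos₀ = subst (0 <_) (sym val₀) z<s
      same : x ∸ q₀ ≡ x′ ∸ q
      same = trans (sym (ℕ.[m+n]∸[m+o]≡n∸o q x q₀)) (trans (cong₂ _∸_ (sym e) (ℕ.+-comm q q₀)) (ℕ.[m+n]∸[m+o]≡n∸o q₀ x′ q))

    -- The position q₀ = q + x - x′ would have the same level on the previous diagonal. It lies
    -- before x, so it can miss the run of v only by lying before y (or being negative), that is q +
    -- x < x′ + y. Together with y′ ≤ q and `strip` this squeezes q to y′ and the gain to exactly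
    -- one.
    stuck-gain : ∀ {q} → D (suc κ) q ≡ v → Stuck (box (suc κ) q) → x′ ∸ y′ ≡ suc (x ∸ y) × q ≡ y′
    stuck-gain {q} val≡ stuck = gain , ℕ.≤-antisym q≤y′ y′≤q
      where
      q<x′ : q < x′
      q<x′ = <-cnt⁺ {suc κ} z<s (ℕ.≤-reflexive (sym val≡))
      y′≤q : y′ ≤ q
      y′≤q = ℕ.≮⇒≥ λ q<y′ → ℕ.<-irrefl (sym val≡) (<-cnt⁻ {suc κ} q<y′)
      short : q + x < x′ + y
      short with x′ ℕ.≤? q + x
      ... | no x′≰  = ℕ.<-≤-trans (ℕ.≰⇒> x′≰) (ℕ.m≤m+n x′ y)
      ... | yes x′≤ = subst (_< x′ + y) eq (ℕ.+-monoʳ-< x′ q₀<y)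
        where
        q₀ : ℕ
        q₀ = q + x ∸ x′
        eq : x′ + q₀ ≡ q + x
        eq = ℕ.m+[n∸m]≡n x′≤
        q₀<x : q₀ < x
        q₀<x = ℕ.+-cancelˡ-< x′ q₀ x (subst (_< x′ + x) (sym eq) (ℕ.+-monoˡ-< x q<x′))
        q₀<y : q₀ < y
        q₀<y = ℕ.≰⇒> λ y≤q₀ → no-level-twin val≡ stuck q₀ (trans (ℕ.+-comm q₀ x′) eq)
          (ℕ.≤-antisym (ℕ.≤-pred (ℕ.≰⇒> λ v<D → ℕ.≤⇒≯ y≤q₀ (<-cnt⁺ {κ} z<s v<D))) (<-cnt⁻ {κ} q₀<x))
      tight : x′ + y ≡ suc (x + y′)
      tight = ℕ.≤-antisym strip (ℕ.≤-<-trans (ℕ.≤-trans (ℕ.+-monoʳ-≤ x y′≤q) (ℕ.≤-reflexive (ℕ.+-comm x q))) short)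
      q≤y′ : q ≤ y′
      q≤y′ = ℕ.+-cancelʳ-≤ x q y′ (ℕ.≤-pred (ℕ.≤-trans short (ℕ.≤-reflexive (trans tight (cong suc (ℕ.+-comm x y′))))))
      gain : x′ ∸ y′ ≡ suc (x ∸ y)
      gain = ℕ.+-cancelʳ-≡ (y′ + y) _ _ (begin
        x′ ∸ y′ + (y′ + y) ≡⟨ ℕ.+-assoc (x′ ∸ y′) y′ y ⟨
        x′ ∸ y′ + y′ + y ≡⟨ cong (_+ y) (ℕ.m∸n+n≡m y′≤x′) ⟩
        x′ + y ≡⟨ tight ⟩
        suc (x + y′) ≡⟨ cong (λ k → suc (k + y′)) (ℕ.m∸n+n≡m y≤x) ⟨
        suc (x ∸ y + y + y′) ≡⟨ cong suc (trans (ℕ.+-assoc (x ∸ y) y y′) (cong (x ∸ y +_) (ℕ.+-comm y y′))) ⟩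
        suc (x ∸ y) + (y′ + y) ∎)
        where open ≡-Reasoning

    -- A box of equal level on the previous diagonal would be at position y - 1, where the value
    -- exceeds v.
    gain-stuck : x′ ∸ y′ ≡ suc (x ∸ y) → D (suc κ) y′ ≡ v × Stuck (box (suc κ) y′)
    gain-stuck gain = val≡ , stuck
      where
      y′<x′ : y′ < x′
      y′<x′ = ℕ.m∸n≢0⇒n<m (λ e → ℕ.1+n≢0 (trans (sym gain) e))
      val≡ : D (suc κ) y′ ≡ v
      val≡ = ℕ.≤-antisym (ℕ.≤-pred (ℕ.≰⇒> λ v<D → ℕ.<-irrefl refl (<-cnt⁺ {suc κ} z<s v<D))) (<-cnt⁻ {suc κ} y′<x′)
      tight : x′ + y ≡ suc (x + y′)
      tight = begin
        x′ + y ≡⟨ cong (_+ y) (ℕ.m∸n+n≡m y′≤x′) ⟨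
        x′ ∸ y′ + y′ + y ≡⟨ cong (λ k → k + y′ + y) gain ⟩
        suc (x ∸ y + y′ + y) ≡⟨ cong suc (ℕ+.xy∙z≈xz∙y (x ∸ y) y′ y) ⟩
        suc (x ∸ y + y + y′) ≡⟨ cong (λ k → suc (k + y′)) (ℕ.m∸n+n≡m y≤x) ⟩
        suc (x + y′) ∎
        where open ≡-Reasoning
      stuck : Stuck (box (suc κ) y′)
      stuck {z} bef e with bEdge⁻ {z} {box (suc κ) y′} e
      ... | ce , le with cEdge⁻ {z} ce
      ... | (pos₀ , pos) , _ , vz = twin z-box
        where
        z-diagonal : diagonal z ≡ κ
        z-diagonal = ℕ.suc-injective (trans (sym (diagonal-before bef pos)) (proj₁ (diagonal-box (suc κ) y′ (proj₁ (positive-inside pos)))))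
        z-box : z ≡ box κ (position z)
        z-box = trans (sym (box-diagonal (proj₁ (positive-inside pos₀)))) (cong (λ k → box k (position z)) z-diagonal)
        twin : ∀ {q₀} → z ≡ box κ q₀ → ⊥
        twin {q₀} refl = ℕ.<-irrefl (sym (trans vz val≡)) (<-cnt⁻ {κ} q₀<y)
          where
          q₀≤x : q₀ ≤ x
          q₀≤x = ℕ.<⇒≤ (<-cnt⁺ {κ} z<s (ℕ.≤-reflexive (sym (trans vz val≡))))
          levels : x ∸ q₀ ≡ x′ ∸ y′
          levels = trans (sym (trans (level-box κ q₀ pos₀) (cong (λ w → cnt κ w ∸ q₀) (trans vz val≡))))
            (trans le (trans (level-box (suc κ) y′ pos) (cong (λ w → cnt (suc κ) w ∸ y′) val≡)))
          q₀<y : q₀ < y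
          q₀<y = ℕ.≤-reflexive (ℕ.+-cancelˡ-≡ (x ∸ q₀ + y′) (suc q₀) y (begin
            x ∸ q₀ + y′ + suc q₀ ≡⟨ ℕ.+-suc (x ∸ q₀ + y′) q₀ ⟩
            suc (x ∸ q₀ + y′ + q₀) ≡⟨ cong suc (trans (ℕ+.xy∙z≈xz∙y (x ∸ q₀) y′ q₀) (cong (_+ y′) (ℕ.m∸n+n≡m q₀≤x))) ⟩
            suc (x + y′) ≡⟨ tight ⟨
            x′ + y ≡⟨ cong (_+ y) (trans (cong (_+ y′) levels) (ℕ.m∸n+n≡m y′≤x′)) ⟨
            x ∸ q₀ + y′ + y ∎))
            where open ≡-Reasoning

  m : ℕ → ℕ → ℕ
  m k v = cnt k (suc v) ∸ cnt k (suc (suc v))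

  module EndProduct (M : CommutativeMonoid 0ℓ 0ℓ) (f : ℕ → CommutativeMonoid.Carrier M) where
    open CommutativeMonoid M using (_≈_) renaming (trans to ≈-trans; reflexive to ≈-reflexive)
    open BigOp M

    gained : Box → Bool
    gained (κ , u) = m (suc κ) u ≡ᵇ suc (m κ u)

    -- A start with value u + 1 is the first box of its run, so its level is the whole run length,
    -- the new multiplicity of u + 1. Starts thus correspond to the pairs of a step and a part size
    -- gained in it.
    end-product : ⨀ (boxes r c) (λ b → when (isEnd b) (f (level b))) ≈
                  ⨀ (upTo (r + c)) (λ κ → ⨀ (upTo N) (λ u → when (gained (κ , u)) (f (m (suc κ) u))))
    end-product = ≈-trans
      (⨀-bij (×-≡-dec ℕ._≟_ ℕ._≟_) isEnd gained (λ b → prev b , val b ∸ 1) (boxes-unique r c) (boxes-unique (r + c) N) into onto injective)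
      (≈-trans (⨀-concatMap (λ κ → map (κ ,_) (upTo N)) (upTo (r + c)) _) (⨀-cong (upTo (r + c)) (λ κ _ → ⨀-map (κ ,_) (upTo N) _)))
      where
      end-positive : ∀ {b} → isEnd b ≡ true → Positive b
      end-positive {b} e = inSupp⁻ (proj₁ (∧-true {inSupp b} e))
      describe : ∀ {b} → isEnd b ≡ true → ∃ λ κ → ∃ λ u → b ≡ box (suc κ) (cnt (suc κ) (suc (suc u))) × prev b ≡ κ × val b ≡ suc u ×
                 κ < r + c × m (suc κ) u ≡ suc (m κ u) × level b ≡ m (suc κ) u
      describe {b} end with on-diagonal (end-positive {b} end)
      ... | κ , q , refl , e , _ , κ< with D (suc κ) q in val≡ | end-positive {b} end
      ... | suc u | pos with stuck-gain κ u val≡ (isEnd⁻ {box (suc κ) q} end)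
      ... | gain , refl = κ , u , refl , e , refl , κ< , gain ,
                trans (level-box (suc κ) q (subst (0 <_) (sym val≡) z<s)) (cong (λ w → cnt (suc κ) w ∸ q) val≡)
      into : ∀ b → b ∈ boxes r c → isEnd b ≡ true →
             (prev b , val b ∸ 1) ∈ boxes (r + c) N × gained (prev b , val b ∸ 1) ≡ true × f (level b) ≈ f (m (suc (prev b)) (val b ∸ 1))
      into b _ end with describe {b} end
      ... | κ , u , _ , e , val≡ , κ< , gain , lev rewrite e | val≡ =
        ∈-boxes⁺ κ< (subst (_≤ N) val≡ (bound _ _)) , ≡ᵇ-complete gain , ≈-reflexive (cong f lev)
      onto : ∀ z → z ∈ boxes (r + c) N → gained z ≡ true → ∃ λ b → b ∈ boxes r c × isEnd b ≡ true × (prev b , val b ∸ 1) ≡ z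
      onto (κ , u) _ g with gain-stuck κ u (≡ᵇ-sound g)
      ... | val≡ , stuck = box (suc κ) (cnt (suc κ) (suc (suc u))) , positive-∈ pos , isEnd⁺ {box (suc κ) (cnt (suc κ) (suc (suc u)))} pos stuck ,
        cong₂ _,_ (proj₁ (prev-box pos)) (cong (_∸ 1) val≡)
        where
        pos : 0 < D (suc κ) (cnt (suc κ) (suc (suc u)))
        pos = subst (0 <_) (sym val≡) z<s
      injective : ∀ b b′ → b ∈ boxes r c → b′ ∈ boxes r c → isEnd b ≡ true → isEnd b′ ≡ true →
                  (prev b , val b ∸ 1) ≡ (prev b′ , val b′ ∸ 1) → b ≡ b′
      injective b b′ _ _ end end′ eq with describe {b} end | describe {b′} end′
      ... | κ , u , eb , e , val≡ , _ | κ′ , u′ , eb′ , e′ , val≡′ , _ = trans eb (trans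
        (cong₂ (λ κ u → box (suc κ) (cnt (suc κ) (suc (suc u)))) (trans (sym e) (trans (cong proj₁ eq) e′))
          (trans (sym (cong (_∸ 1) val≡)) (trans (cong proj₂ eq) (cong (_∸ 1) val≡′)))) (sym eb′))


-- Arrays of numbers and their correspondence with chains

leading-≤ : ∀ L {a v} → leading L a v ≤ L
leading-≤ zero = z≤n
leading-≤ (suc L) {a} {v} with v ≤ᵇ a 0
... | true  = s≤s (leading-≤ L)
... | false = z≤n

vector : ∀ {A : Set} n → (ℕ → A) → Vec A n
vector zero f = []
vector (suc n) f = f 0 ∷ vector n (f ∘ suc)

nthOr0-vector : ∀ n f {i} → i < n → nthOr0 (toList (vector n f)) i ≡ f i
nthOr0-vector (suc n) f {zero}  _ = refl
nthOr0-vector (suc n) f {suc i} (s≤s i<) = nthOr0-vector n (f ∘ suc) i<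

nthRow-vector : ∀ {c} n (f : ℕ → Vec ℕ c) {i} → i < n → nthRow (toList (vector n f)) i ≡ toList (f i)
nthRow-vector (suc n) f {zero}  _ = refl
nthRow-vector (suc n) f {suc i} (s≤s i<) = nthRow-vector n (f ∘ suc) i<

nthOr0-outside : ∀ {n} (xs : Vec ℕ n) {i} → n ≤ i → nthOr0 (toList xs) i ≡ 0
nthOr0-outside [] _ = refl
nthOr0-outside (x ∷ xs) (s≤s n≤) = nthOr0-outside xs n≤

nthRow-cases : ∀ {c r} (M : Vec (Vec ℕ c) r) i →
               (nthRow (toList M) i ≡ []) ⊎ (∃ λ (xs : Vec ℕ c) → nthRow (toList M) i ≡ toList xs × i < r)
nthRow-cases [] i = inj₁ refl
nthRow-cases (xs ∷ M) zero = inj₂ (xs , refl , z<s)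
nthRow-cases (xs ∷ M) (suc i) with nthRow-cases M i
... | inj₁ e = inj₁ e
... | inj₂ (ys , e , i<) = inj₂ (ys , e , s≤s i<)

entry-outside : ∀ {r c} (M : Vec (Vec ℕ c) r) i j → r ≤ i ⊎ c ≤ j → entry M i j ≡ 0
entry-outside M i j out with nthRow-cases M i
... | inj₁ e = cong (λ xs → nthOr0 xs j) e
... | inj₂ (xs , e , i<) with out
... | inj₁ r≤ = contradiction i< (ℕ.≤⇒≯ r≤)
... | inj₂ c≤ = trans (cong (λ xs → nthOr0 xs j) e) (nthOr0-outside xs c≤)

matrix : ∀ r c → (ℕ → ℕ → ℕ) → Vec (Vec ℕ c) r
matrix r c f = vector r (λ i → vector c (f i))

entry-matrix : ∀ {r c} f {i j} → i < r → j < c → entry (matrix r c f) i j ≡ f i j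
entry-matrix {r} {c} f {i} {j} i< j< = trans (cong (λ xs → nthOr0 xs j) (nthRow-vector r (λ i → vector c (f i)) i<)) (nthOr0-vector c (f i) j<)

nthOr0-injective : ∀ {n} (xs ys : Vec ℕ n) → (∀ j → j < n → nthOr0 (toList xs) j ≡ nthOr0 (toList ys) j) → xs ≡ ys
nthOr0-injective [] [] e = refl
nthOr0-injective (x ∷ xs) (y ∷ ys) e = cong₂ _∷_ (e 0 z<s) (nthOr0-injective xs ys (λ j j< → e (suc j) (s≤s j<)))

entry-injective : ∀ {r c} (M M′ : Vec (Vec ℕ c) r) → (∀ i j → i < r → j < c → entry M i j ≡ entry M′ i j) → M ≡ M′
entry-injective [] [] e = refl
entry-injective (xs ∷ M) (ys ∷ M′) e = cong₂ _∷_ (nthOr0-injective xs ys (λ j → e 0 j z<s))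
  (entry-injective M M′ (λ i j i< → e (suc i) j (s≤s i<)))

∈-allVecs⁺ : ∀ {A : Set} n {xs : List A} (f : ℕ → A) → (∀ i → i < n → f i ∈ xs) → vector n f ∈ allVecs n xs
∈-allVecs⁺ zero f e = here refl
∈-allVecs⁺ (suc n) f e = ∈-extend⁺ _∷_ Vec.∷-injective {key = id} (e 0 z<s) (∈-allVecs⁺ n (f ∘ suc) (λ i i< → e (suc i) (s≤s i<)))

allVecs-unique : ∀ {A : Set} n {xs : List A} → Unique xs → Unique (allVecs n xs)
allVecs-unique zero u = [] ∷ []
allVecs-unique (suc n) {xs} u = extend-unique _∷_ Vec.∷-injective xs (subst Unique (sym (List.map-id xs)) u) (λ _ → allVecs-unique n u)

arrays : ℕ → ∀ r c → List (Vec (Vec ℕ c) r)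
arrays N r c = allVecs r (allVecs c (upTo (suc N)))

arrays-unique : ∀ N r c → Unique (arrays N r c)
arrays-unique N r c = allVecs-unique r (allVecs-unique c (Unique.upTo⁺ (suc N)))

∈-arrays⁺ : ∀ {N r c} f → (∀ i j → f i j ≤ N) → matrix r c f ∈ arrays N r c
∈-arrays⁺ {r = r} {c} f b = ∈-allVecs⁺ r _ (λ i _ → ∈-allVecs⁺ c (f i) (λ j _ → ∈.∈-upTo⁺ (s≤s (b i j))))

∈-arrays⁻ : ∀ {N} r {c} {M : Vec (Vec ℕ c) r} → M ∈ arrays N r c → ∀ i j → entry M i j ≤ N
∈-arrays⁻ zero {M = []} _ i j = z≤n
∈-arrays⁻ {N} (suc r) {c} M∈ i j with ∈-extend⁻ _∷_ Vec.∷-injective {key = id} (allVecs c (upTo (suc N))) M∈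
∈-arrays⁻ {N} (suc r) {c} M∈ zero j | xs , _ , xs∈ , _ , refl = row c xs∈ j
  where
  row : ∀ c {xs} → xs ∈ allVecs c (upTo (suc N)) → ∀ j → nthOr0 (toList xs) j ≤ N
  row zero {[]} _ j = z≤n
  row (suc c) xs∈ j with ∈-extend⁻ _∷_ Vec.∷-injective {key = id} (upTo (suc N)) xs∈
  row (suc c) xs∈ zero | _ , _ , x∈ , _ , refl = ℕ.≤-pred (∈.∈-upTo⁻ x∈)
  row (suc c) xs∈ (suc j) | _ , _ , _ , xs∈′ , refl = row c xs∈′ j
∈-arrays⁻ {N} (suc r) {c} M∈ (suc i) j | _ , _ , _ , M∈′ , refl = ∈-arrays⁻ r M∈′ i j

all⁺ : ∀ {A : Set} (p : A → Bool) xs → (∀ x → x ∈ xs → p x ≡ true) → all p xs ≡ true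
all⁺ p [] e = refl
all⁺ p (x ∷ xs) e = ∧-intro (e x (here refl)) (all⁺ p xs (λ y y∈ → e y (there y∈)))

all⁻ : ∀ {A : Set} (p : A → Bool) {xs x} → all p xs ≡ true → x ∈ xs → p x ≡ true
all⁻ p {y ∷ xs} e (here refl) = proj₁ (∧-true {p y} e)
all⁻ p {y ∷ xs} e (there x∈)  = all⁻ p (proj₂ (∧-true {p y} e)) x∈

module _ {r c : ℕ} (M : Vec (Vec ℕ c) r) where
  isPlanePartition⁺ : (∀ i j → entry M (suc i) j ≤ entry M i j) → (∀ i j → entry M i (suc j) ≤ entry M i j) → isPlanePartition M ≡ true
  isPlanePartition⁺ col row = all⁺ _ (boxes r c) λ { (i , j) _ → ∧-intro (<ᵇ-complete (s≤s (col i j))) (<ᵇ-complete (s≤s (row i j))) }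

  isPlanePartition⁻ : isPlanePartition M ≡ true → (∀ i j → entry M (suc i) j ≤ entry M i j) × (∀ i j → entry M i (suc j) ≤ entry M i j)
  isPlanePartition⁻ e = (λ i j → proj₁ (both i j)) , (λ i j → proj₂ (both i j))
    where
    both : ∀ i j → entry M (suc i) j ≤ entry M i j × entry M i (suc j) ≤ entry M i j
    both i j with i ℕ.<? r | j ℕ.<? c
    ... | yes i< | yes j< with ∧-true {entry M (suc i) j <ᵇ suc (entry M i j)} (all⁻ _ e (∈-boxes⁺ i< j<))
    ... | col , row = ℕ.≤-pred (<ᵇ-sound col) , ℕ.≤-pred (<ᵇ-sound row)
    both i j | no i≮ | _ =
      ℕ.≤-trans (ℕ.≤-reflexive (entry-outside M (suc i) j (inj₁ (ℕ.m≤n⇒m≤1+n (ℕ.≮⇒≥ i≮))))) z≤n ,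
      ℕ.≤-trans (ℕ.≤-reflexive (entry-outside M i (suc j) (inj₁ (ℕ.≮⇒≥ i≮)))) z≤n
    both i j | _ | no j≮ =
      ℕ.≤-trans (ℕ.≤-reflexive (entry-outside M (suc i) j (inj₂ (ℕ.≮⇒≥ j≮)))) z≤n ,
      ℕ.≤-trans (ℕ.≤-reflexive (entry-outside M i (suc j) (inj₂ (ℕ.m≤n⇒m≤1+n (ℕ.≮⇒≥ j≮))))) z≤n

empty-conj : ∀ {n} (μ : State n) → empty? μ ≡ true → ∀ v → conj μ v ≡ 0
empty-conj [] e v = refl
empty-conj {suc n} (zero ∷ ps) e v with v ≤ᵇ suc n
... | true  = empty-conj ps e v
... | false = empty-conj ps e v

-- The inverse of reading the diagonals: each diagonal is conjugated back.
module ArrayOfChain (r c N : ℕ) (st : ℕ → State N) (first : st 0 ≡ ∅)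
                    (steps : ∀ k → k < r + c → st (suc k) ∈ next (direction r k) false (st k))
                    (last : empty? (st (r + c)) ≡ true) where
  C : ℕ → ℕ → ℕ
  C k = conj (st k)

  C-up : ∀ {k} → k < r + c → k < r → ∀ v → Bump (C k v) (C (suc k) v)
  C-up {k} k< k<r with k <ᵇ r | <ᵇ-complete k<r | steps k k<
  ... | true | _ | step = conj-bump (st k) (st (suc k)) step

  C-dn : ∀ {k} → k < r + c → r ≤ k → ∀ v → Bump (C (suc k) v) (C k v)
  C-dn {k} k< r≤k with k <ᵇ r in e | steps k k<
  ... | true  | _ = contradiction (<ᵇ-sound e) (ℕ.≤⇒≯ r≤k)
  ... | false | step = conj-bump (st (suc k)) (st k) (next-swap (st k) (st (suc k)) step)

  -- From the empty first diagonal on, a column gains at most one box per `up` step and none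
  -- afterwards. This keeps the rebuilt diagonal within the r rows of the rectangle.
  C-rows : ∀ k v → k ≤ r + c → C k v ≤ k × C k v ≤ r
  C-rows zero v _ rewrite first | conj-∅ N v = z≤n , z≤n
  C-rows (suc k) v k< with C-rows k v (ℕ.<⇒≤ k<) | k ℕ.<? r
  ... | ≤k , _  | yes k<r = ℕ.≤-trans (proj₂ (C-up k< k<r v)) (s≤s ≤k) , ℕ.≤-trans (ℕ.≤-trans (proj₂ (C-up k< k<r v)) (s≤s ≤k)) k<r
  ... | ≤k , ≤r | no k≮r  = ℕ.≤-trans (proj₁ (C-dn k< (ℕ.≮⇒≥ k≮r) v)) (ℕ.m≤n⇒m≤1+n ≤k) , ℕ.≤-trans (proj₁ (C-dn k< (ℕ.≮⇒≥ k≮r) v)) ≤r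

  -- The counterpart for the c columns, by induction from the far end, where `last` makes the
  -- diagonal empty; d is the number of steps still to come.
  C-columns : ∀ d k v → k + d ≡ r + c → C k v + (k ∸ r) ≤ c
  C-columns zero k v e rewrite trans (sym (ℕ.+-identityʳ k)) e | ℕ.m+n∸m≡n r c | empty-conj (st (r + c)) last v = ℕ.≤-refl
  C-columns (suc d) k v e with C-columns d (suc k) v (trans (sym (ℕ.+-suc k d)) e) | k ℕ.<? r
  ... | ih | yes k<r rewrite ℕ.m≤n⇒m∸n≡0 k<r | ℕ.m≤n⇒m∸n≡0 (ℕ.<⇒≤ k<r) =
    ℕ.≤-trans (ℕ.+-monoˡ-≤ 0 (proj₁ (C-up (subst (k <_) e (ℕ.m<m+n k z<s)) k<r v))) ih
  ... | ih | no k≮r rewrite ℕ.+-∸-assoc 1 (ℕ.≮⇒≥ k≮r) =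
    ℕ.≤-trans (ℕ.+-monoˡ-≤ (k ∸ r) (proj₂ (C-dn (subst (k <_) e (ℕ.m<m+n k z<s)) (ℕ.≮⇒≥ k≮r) v)))
      (ℕ.≤-trans (ℕ.≤-reflexive (sym (ℕ.+-suc (C (suc k) v) (k ∸ r)))) ih)

  diag : ℕ → ℕ → ℕ
  diag i j = j + (r ∸ i)

  diag-< : ∀ {i j} → j < c → diag i j < r + c
  diag-< {i} {j} j<c = ℕ.≤-trans (ℕ.+-mono-≤ j<c (ℕ.m∸n≤m r i)) (ℕ.≤-reflexive (ℕ.+-comm c r))

  value : ℕ → ℕ → ℕ
  value i j = leading N (λ v → C (diag i j) (suc v)) (suc (i ⊓ j))

  M : Vec (Vec ℕ c) r
  M = matrix r c value

  e : ℕ → ℕ → ℕ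
  e = entry M

  inside : ∀ {i j u} → u < e i j → i < r × j < c
  inside {i} {j} u< with i ℕ.<? r | j ℕ.<? c
  ... | yes i< | yes j< = i< , j<
  ... | no i≮  | _ = contradiction (subst (_ <_) (entry-outside M i j (inj₁ (ℕ.≮⇒≥ i≮))) u<) ℕ.n≮0
  ... | _ | no j≮  = contradiction (subst (_ <_) (entry-outside M i j (inj₂ (ℕ.≮⇒≥ j≮))) u<) ℕ.n≮0

  <-e⁻ : ∀ {i j u} → u < e i j → i ⊓ j < C (diag i j) (suc u)
  <-e⁻ {i} {j} u< with inside {i} {j} u<
  ... | i< , j< = leading⁻ N (subst (_ <_) (entry-matrix value i< j<) u<)

  <-e⁺ : ∀ {i j u} → i < r → j < c → i ⊓ j < C (diag i j) (suc u) → u < e i j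
  <-e⁺ {i} {j} i< j< q< = subst (_ <_) (sym (entry-matrix value i< j<)) (leading⁺ N (λ v → conj-decreasing (st (diag i j)) (suc v))
    (ℕ.≤-trans (ℕ.≤-reflexive (cong suc (conj-> (st (diag i j)) ℕ.≤-refl))) z<s) q<)

  e-bound : ∀ i j → e i j ≤ N
  e-bound i j = ≤-from-< λ u u< → ℕ.<-≤-trans u< (≤N u<)
    where
    ≤N : ∀ {u} → u < e i j → e i j ≤ N
    ≤N u< with inside {i} {j} u<
    ... | i< , j< = ℕ.≤-trans (ℕ.≤-reflexive (entry-matrix value i< j<)) (leading-≤ N)

  diag-suc : ∀ {i j} → i < r → diag i j ≡ suc (diag (suc i) j)
  diag-suc {i} {j} i<r = trans (cong (j +_) (ℕ.+-∸-assoc 1 i<r)) (ℕ.+-suc j _)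

  e-column : ∀ i j → e (suc i) j ≤ e i j
  e-column i j = ≤-from-< λ u u< → go u (inside {suc i} {j} u<) (<-e⁻ {suc i} {j} u<)
    where
    go : ∀ u → suc i < r × j < c → suc i ⊓ j < C (diag (suc i) j) (suc u) → u < e i j
    go u (i< , j<) q< = <-e⁺ (ℕ.<⇒≤ i<) j< (subst (λ k → i ⊓ j < C k (suc u)) (sym (diag-suc (ℕ.<⇒≤ i<))) step)
      where
      step : i ⊓ j < C (suc (diag (suc i) j)) (suc u)
      step with diag (suc i) j ℕ.<? r
      ... | yes κ<r = ℕ.<-≤-trans (ℕ.≤-<-trans (ℕ.⊓-monoˡ-≤ j (ℕ.n≤1+n i)) q<) (proj₁ (C-up (diag-< {suc i} j<) κ<r (suc u)))
      -- A `dn` step loses up to one box of the column, but here suc i ≤ j, so the position drops by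
      -- one as well.
      ... | no κ≮r = ℕ.≤-<-trans (ℕ.m⊓n≤m i j) (ℕ.≤-pred (ℕ.≤-trans (subst (_< C (diag (suc i) j) (suc u)) (ℕ.m≤n⇒m⊓n≡m i<j) q<)
              (proj₂ (C-dn (diag-< {suc i} j<) (ℕ.≮⇒≥ κ≮r) (suc u)))))
        where
        i<j : suc i ≤ j
        i<j = ℕ.+-cancelʳ-≤ (r ∸ suc i) (suc i) j (ℕ.≤-trans (ℕ.≤-reflexive (ℕ.m+[n∸m]≡n (ℕ.<⇒≤ i<))) (ℕ.≮⇒≥ κ≮r))

  e-row : ∀ i j → e i (suc j) ≤ e i j
  e-row i j = ≤-from-< λ u u< → go u (inside {i} {suc j} u<) (<-e⁻ {i} {suc j} u<)
    where
    go : ∀ u → i < r × suc j < c → i ⊓ suc j < C (suc (diag i j)) (suc u) → u < e i j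
    go u (i< , j<) q< = <-e⁺ i< (ℕ.<⇒≤ j<) step
      where
      step : i ⊓ j < C (diag i j) (suc u)
      step with diag i j ℕ.<? r
      ... | no κ≮r = ℕ.<-≤-trans (ℕ.≤-<-trans (ℕ.⊓-monoʳ-≤ i (ℕ.n≤1+n j)) q<) (proj₁ (C-dn (diag-< {i} (ℕ.<⇒≤ j<)) (ℕ.≮⇒≥ κ≮r) (suc u)))
      ... | yes κ<r = ℕ.≤-<-trans (ℕ.m⊓n≤n i j) (ℕ.≤-pred (ℕ.≤-trans (subst (_< C (suc (diag i j)) (suc u)) (ℕ.m≥n⇒m⊓n≡n j<i) q<)
              (proj₂ (C-up (diag-< {i} (ℕ.<⇒≤ j<)) κ<r (suc u)))))
        where
        j<i : suc j ≤ i
        j<i = ℕ.+-cancelʳ-≤ (r ∸ i) (suc j) i (ℕ.≤-trans κ<r (ℕ.≤-reflexive (sym (ℕ.m+[n∸m]≡n (ℕ.<⇒≤ i<)))))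

  private
    module Dg = Diagonals r c e (entry-outside M) e-column e-row N e-bound

  cnt-C : ∀ k u → k ≤ r + c → Dg.cnt k (suc u) ≡ C k (suc u)
  cnt-C k u k≤ = ≡-from-< forth back
    where
    forth : ∀ q → q < Dg.cnt k (suc u) → q < C k (suc u)
    forth q q< with Dg.<-cnt⁻ {k} q<
    ... | u< with Dg.diagonal-box k q (proj₁ (inside u<)) | <-e⁻ {q + (r ∸ k)} u<
    ... | d , pos | q<′ = subst₂ (λ a b → a < C b (suc u)) pos d q<′
    back : ∀ q → q < C k (suc u) → q < Dg.cnt k (suc u)
    back q q< = Dg.<-cnt⁺ {k} z<s (<-e⁺ row< col< (subst₂ (λ a b → a < C b (suc u)) (sym pos) (sym d) q<))
      where
      row< : q + (r ∸ k) < r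
      row< with ℕ.≤-total k r
      ... | inj₁ k≤r = ℕ.<-≤-trans (ℕ.+-monoˡ-< (r ∸ k) (ℕ.<-≤-trans q< (proj₁ (C-rows k (suc u) k≤)))) (ℕ.≤-reflexive (ℕ.m+[n∸m]≡n k≤r))
      ... | inj₂ r≤k rewrite ℕ.m≤n⇒m∸n≡0 r≤k | ℕ.+-identityʳ q = ℕ.<-≤-trans q< (proj₂ (C-rows k (suc u) k≤))
      col< : q + (k ∸ r) < c
      col< = ℕ.<-≤-trans (ℕ.+-monoˡ-< (k ∸ r) q<) (C-columns (r + c ∸ k) k (suc u) (ℕ.m+[n∸m]≡n k≤))
      d = proj₁ (Dg.diagonal-box k q row<)
      pos = proj₂ (Dg.diagonal-box k q row<)

  st-recovered : ∀ k → k ≤ r + c → Dg.st k ≡ st k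
  st-recovered k k≤ = trans (mult-cong N 0 (λ { (suc u) _ _ → cnt-C k u k≤ })) (mult-conj (st k))

-- `Diagonals.st` freed of the proofs it is parametrised by, so that the chain is a function of the
-- array alone, as a bijection requires.
stateOf : ∀ N {r c} → Vec (Vec ℕ c) r → ℕ → State N
stateOf N {r} M k = mult N (leading r (λ q → entry M (q + (r ∸ k)) (q + (k ∸ r))))

chainOf : ∀ N {r c} → Vec (Vec ℕ c) r → List (State N)
chainOf N {r} {c} M = chain (r + c) (stateOf N M)

module ArrayChain (N r c : ℕ) where
  private
    module Dg {M : Vec (Vec ℕ c) r} (M∈ : M ∈ arrays N r c) (pp : isPlanePartition M ≡ true) =
      Diagonals r c (entry M) (entry-outside M) (proj₁ (isPlanePartition⁻ M pp)) (proj₂ (isPlanePartition⁻ M pp)) N (∈-arrays⁻ r M∈)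

  chainOf-∈ : ∀ M → M ∈ arrays N r c → isPlanePartition M ≡ true →
              chainOf N M ∈ chains (direction r) (r + c) ∅ × returns ∅ (chainOf N M) ≡ true
  chainOf-∈ M M∈ pp = Dg.chain-∈ M∈ pp , trans (cong (λ μ → returns μ (chainOf N M)) (sym (Dg.st-first M∈ pp)))
    (trans (returns-chain (r + c) (stateOf N M)) (trans (cong empty? (Dg.st-last M∈ pp)) (empty-∅ N)))
    where
    empty-∅ : ∀ n → empty? (∅ {n}) ≡ true
    empty-∅ zero = refl
    empty-∅ (suc n) = empty-∅ n

  chainOf-onto : ∀ ch → ch ∈ chains (direction r) (r + c) (∅ {N}) → returns ∅ ch ≡ true →
                 ∃ λ M → M ∈ arrays N r c × isPlanePartition M ≡ true × chainOf N M ≡ ch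
  chainOf-onto ch ch∈ ret with ∈-chains⁻ (direction r) (r + c) ∅ ch∈
  ... | st , first , refl , steps = A.M , ∈-arrays , isPlanePartition⁺ A.M A.e-column A.e-row , chain-cong (r + c) (λ k k< → A.st-recovered (suc k) k<)
    where
    module A = ArrayOfChain r c N st first steps (trans (sym (returns-chain (r + c) st)) (trans (cong (λ μ → returns μ (chain (r + c) st)) first) ret))
    ∈-arrays : A.M ∈ arrays N r c
    ∈-arrays = ∈-arrays⁺ A.value (λ i j → leading-≤ N)

  chainOf-injective : ∀ M M′ → M ∈ arrays N r c → M′ ∈ arrays N r c → isPlanePartition M ≡ true → isPlanePartition M′ ≡ true →
                      chainOf N M ≡ chainOf N M′ → M ≡ M′
  chainOf-injective M M′ M∈ M′∈ pp pp′ eq = entry-injective M M′ λ i j i< j< →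
    ≡-from-< (λ u → half M M′ M∈ M′∈ pp pp′ eq i< j<) (λ u → half M′ M M′∈ M∈ pp′ pp (sym eq) i< j<)
    where
    half : ∀ M M′ → M ∈ arrays N r c → M′ ∈ arrays N r c → isPlanePartition M ≡ true → isPlanePartition M′ ≡ true →
           chainOf N M ≡ chainOf N M′ → ∀ {i j u} → i < r → j < c → u < entry M i j → u < entry M′ i j
    half M M′ M∈ M′∈ pp pp′ eq {i} {j} {u} i< j< u< = subst (λ b → u < entry M′ (proj₁ b) (proj₂ b)) at
      (Dg.<-cnt⁻ M′∈ pp′ {suc κ} (subst (i ⊓ j <_) counts (Dg.<-cnt⁺ M∈ pp {suc κ} z<s (subst (λ b → u < entry M (proj₁ b) (proj₂ b)) (sym at) u<))))
      where
      κ : ℕ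
      κ = j + (r ∸ suc i)
      at : Dg.box M∈ pp (suc κ) (i ⊓ j) ≡ (i , j)
      at = trans (cong (λ k → Dg.box M∈ pp k (i ⊓ j)) (sym (Dg.suc-prev M∈ pp i<))) (Dg.box-diagonal M∈ pp i<)
      u≤N : suc u ≤ suc N
      u≤N = ℕ.m≤n⇒m≤1+n (ℕ.≤-trans u< (∈-arrays⁻ r M∈ i j))
      counts : Dg.cnt M∈ pp (suc κ) (suc u) ≡ Dg.cnt M′∈ pp′ (suc κ) (suc u)
      counts = trans (sym (conj-mult N (Dg.cnt-decreasing M∈ pp (suc κ)) (Dg.cnt-top M∈ pp (suc κ)) z<s u≤N))
        (trans (cong (λ μ → conj μ (suc u)) (chain-injective (r + c) {st = stateOf N M} {stateOf N M′} eq κ (Dg.prev-< M∈ pp i< j<)))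
          (conj-mult N (Dg.cnt-decreasing M′∈ pp′ (suc κ)) (Dg.cnt-top M′∈ pp′ (suc κ)) z<s u≤N))

-- Rings of formal power series

-- Formal power series, identified when their coefficients agree in the degrees satisfying P.
module Series (R : CommutativeRing 0ℓ 0ℓ) (P : ℕ → Set) (P-down : ∀ {m n} → m ≤ n → P n → P m) where
  open RingNotation R hiding (_^_)

  S : Set
  S = ℕ → Carrier

  sum : ℕ → S → Carrier
  sum zero f = f 0
  sum (suc n) f = sum n f ⊕ f (suc n)

  conv : S → S → S
  conv f g n = sum n (λ a → f a ⊛ g (n ∸ a))

  constant : Carrier → S
  constant a zero = a
  constant a (suc n) = 0#

  indeterminate : S
  indeterminate zero = 0#
  indeterminate (suc n) = constant 1# n

  sum-cong : ∀ n {f g : S} → (∀ a → a ≤ n → f a ≈ g a) → sum n f ≈ sum n g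
  sum-cong zero e = e 0 z≤n
  sum-cong (suc n) e = +-cong (sum-cong n (λ a a≤ → e a (ℕ.m≤n⇒m≤1+n a≤))) (e (suc n) ℕ.≤-refl)

  sum-+ : ∀ n (f g : S) → sum n (λ a → f a ⊕ g a) ≈ sum n f ⊕ sum n g
  sum-+ zero f g = ≈-refl
  sum-+ (suc n) f g = ≈-trans (+-congʳ (sum-+ n f g)) (interchange _ _ _ _)

  sum-* : ∀ n b (f : S) → sum n (λ a → b ⊛ f a) ≈ b ⊛ sum n f
  sum-* zero b f = ≈-refl
  sum-* (suc n) b f = ≈-trans (+-congʳ (sum-* n b f)) (≈-sym (distribˡ _ _ _))

  sum-first : ∀ n (f : S) → sum (suc n) f ≈ f 0 ⊕ sum n (f ∘ suc)
  sum-first zero f = ≈-refl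
  sum-first (suc n) f = ≈-trans (+-congʳ (sum-first n f)) (+-assoc _ _ _)

  conv-cong : ∀ n {f f′ g g′ : S} → (∀ a → a ≤ n → f a ≈ f′ a) → (∀ a → a ≤ n → g a ≈ g′ a) → conv f g n ≈ conv f′ g′ n
  conv-cong n ef eg = sum-cong n (λ a a≤ → *-cong (ef a a≤) (eg (n ∸ a) (ℕ.m∸n≤m n a)))

  conv-suc : ∀ f g n → conv f g (suc n) ≈ f 0 ⊛ g (suc n) ⊕ conv (f ∘ suc) g n
  conv-suc f g n = sum-first n _

  conv-last : ∀ f g n → conv f g (suc n) ≈ conv f (g ∘ suc) n ⊕ f (suc n) ⊛ g 0
  conv-last f g n = +-cong
    (sum-cong n (λ a a≤ → *-congˡ (≈-reflexive (cong g (ℕ.+-∸-assoc 1 a≤)))))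
    (*-congˡ (≈-reflexive (cong g (ℕ.n∸n≡0 n))))

  -- Induction works because `conv-suc` peels off the first term and `conv-last` the last one, and
  -- these correspond when the factors are exchanged.
  conv-comm : ∀ n f g → conv f g n ≈ conv g f n
  conv-comm zero f g = *-comm _ _
  conv-comm (suc n) f g = begin
    conv f g (suc n) ≈⟨ conv-suc f g n ⟩
    f 0 ⊛ g (suc n) ⊕ conv (f ∘ suc) g n ≈⟨ +-cong (*-comm _ _) (conv-comm n (f ∘ suc) g) ⟩
    g (suc n) ⊛ f 0 ⊕ conv g (f ∘ suc) n ≈⟨ +-comm _ _ ⟩
    conv g (f ∘ suc) n ⊕ g (suc n) ⊛ f 0 ≈⟨ conv-last g f n ⟨
    conv g f (suc n) ∎

  conv-+ : ∀ n f g h → conv (λ a → f a ⊕ g a) h n ≈ conv f h n ⊕ conv g h n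
  conv-+ n f g h = ≈-trans (sum-cong n (λ a _ → distribʳ _ _ _)) (sum-+ n _ _)

  conv-* : ∀ n b f g → conv (λ a → b ⊛ f a) g n ≈ b ⊛ conv f g n
  conv-* n b f g = ≈-trans (sum-cong n (λ a _ → *-assoc _ _ _)) (sum-* n b _)

  conv-assoc : ∀ n f g h → conv (conv f g) h n ≈ conv f (conv g h) n
  conv-assoc zero f g h = *-assoc _ _ _
  conv-assoc (suc n) f g h = begin
    conv (conv f g) h (suc n)
      ≈⟨ conv-suc (conv f g) h n ⟩
    (f 0 ⊛ g 0) ⊛ h (suc n) ⊕ conv (conv f g ∘ suc) h n
      ≈⟨ +-cong (*-assoc _ _ _) (conv-cong n {g = h} (λ a _ → conv-suc f g a) (λ _ _ → ≈-refl)) ⟩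
    f 0 ⊛ (g 0 ⊛ h (suc n)) ⊕ conv (λ a → f 0 ⊛ g (suc a) ⊕ conv (f ∘ suc) g a) h n
      ≈⟨ +-congˡ (≈-trans (conv-+ n _ _ h) (+-cong (conv-* n (f 0) (g ∘ suc) h) (conv-assoc n (f ∘ suc) g h))) ⟩
    f 0 ⊛ (g 0 ⊛ h (suc n)) ⊕ (f 0 ⊛ conv (g ∘ suc) h n ⊕ conv (f ∘ suc) (conv g h) n)
      ≈⟨ +-assoc _ _ _ ⟨
    f 0 ⊛ (g 0 ⊛ h (suc n)) ⊕ f 0 ⊛ conv (g ∘ suc) h n ⊕ conv (f ∘ suc) (conv g h) n
      ≈⟨ +-congʳ (≈-trans (≈-sym (distribˡ _ _ _)) (*-congˡ (≈-sym (conv-suc g h n)))) ⟩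
    f 0 ⊛ conv g h (suc n) ⊕ conv (f ∘ suc) (conv g h) n
      ≈⟨ conv-suc f (conv g h) n ⟨
    conv f (conv g h) (suc n) ∎

  conv-constant : ∀ b f n → conv (constant b) f n ≈ b ⊛ f n
  conv-constant b f zero = ≈-refl
  conv-constant b f (suc n) = ≈-trans (conv-suc (constant b) f n) (≈-trans (+-congˡ (conv-0 n)) (+-identityʳ _))
    where
    conv-0 : ∀ n → conv (λ _ → 0#) f n ≈ 0#
    conv-0 zero = zeroˡ _
    conv-0 (suc n) = ≈-trans (conv-suc _ f n) (≈-trans (+-cong (zeroˡ _) (conv-0 n)) (+-identityˡ 0#))

  conv-1 : ∀ f n → conv (constant 1#) f n ≈ f n
  conv-1 f n = ≈-trans (conv-constant 1# f n) (*-identityˡ _)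

  conv-indeterminate : ∀ f n → conv indeterminate f (suc n) ≈ f n
  conv-indeterminate f n = ≈-trans (conv-suc indeterminate f n)
    (≈-trans (+-cong (zeroˡ _) (conv-1 f n)) (+-identityˡ _))

  seriesRing : CommutativeRing 0ℓ 0ℓ
  seriesRing = record
    { Carrier = S
    ; _≈_ = λ f g → ∀ n → P n → f n ≈ g n
    ; _+_ = λ f g n → f n ⊕ g n
    ; _*_ = conv
    ; -_  = λ f n → ⊖ f n
    ; 0#  = λ _ → 0#
    ; 1#  = constant 1#
    ; isCommutativeRing = record
      { isRing = record
        { +-isAbelianGroup = record
          { isGroup = record
            { isMonoid = record
              { isSemigroup = record
                { isMagma = record
                  { isEquivalence = record
                    { refl  = λ _ _ → ≈-refl
                    ; sym = λ e n Pn → ≈-sym (e n Pn)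
                    ; trans = λ e e′ n Pn → ≈-trans (e n Pn) (e′ n Pn)
                    }
                  ; ∙-cong = λ e e′ n Pn → +-cong (e n Pn) (e′ n Pn)
                  }
                ; assoc = λ _ _ _ _ _ → +-assoc _ _ _
                }
              ; identity = (λ _ _ _ → +-identityˡ _) , (λ _ _ _ → +-identityʳ _)
              }
            ; inverse = (λ _ _ _ → -‿inverseˡ _) , (λ _ _ _ → -‿inverseʳ _)
            ; ⁻¹-cong = λ e n Pn → -‿cong (e n Pn)
            }
          ; comm = λ _ _ _ _ → +-comm _ _
          }
        ; *-cong = λ e e′ n Pn → conv-cong n (λ a a≤ → e a (P-down a≤ Pn)) (λ a a≤ → e′ a (P-down a≤ Pn))
        ; *-assoc = λ f g h n _ → conv-assoc n f g h
        ; *-identity = (λ f n _ → conv-1 f n) , (λ f n _ → ≈-trans (conv-comm n f (constant 1#)) (conv-1 f n))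
        ; distrib = (λ f g h n _ → ≈-trans (conv-comm n f _) (≈-trans (conv-+ n g h f) (+-cong (conv-comm n g f) (conv-comm n h f))))
                  , (λ f g h n _ → conv-+ n g h f)
        }
      ; *-comm = λ f g n _ → conv-comm n f g
      }
    }

  open RingNotation seriesRing using (_^_)

  private
    pick : Bool → Carrier
    pick b = if b then 1# else 0#

  power-coefficient : ∀ m n → (indeterminate ^ m) n ≈ pick (n ≡ᵇ m)
  power-coefficient zero zero = ≈-refl
  power-coefficient zero (suc n) = ≈-refl
  power-coefficient (suc m) zero = zeroˡ _
  power-coefficient (suc m) (suc n) = ≈-trans (conv-indeterminate (indeterminate ^ m) n) (power-coefficient m n)

  conv-power-≥ : ∀ m f n → conv (indeterminate ^ m) f (m + n) ≈ f n
  conv-power-≥ zero f n = conv-1 f n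
  conv-power-≥ (suc m) f n = ≈-trans (conv-assoc (suc (m + n)) indeterminate (indeterminate ^ m) f)
    (≈-trans (conv-indeterminate (conv (indeterminate ^ m) f) (m + n)) (conv-power-≥ m f n))

  conv-power-< : ∀ m f n → n < m → conv (indeterminate ^ m) f n ≈ 0#
  conv-power-< (suc m) f zero _ = ≈-trans (conv-assoc 0 indeterminate (indeterminate ^ m) f) (zeroˡ _)
  conv-power-< (suc m) f (suc n) (s≤s n<) = ≈-trans (conv-assoc (suc n) indeterminate (indeterminate ^ m) f)
    (≈-trans (conv-indeterminate (conv (indeterminate ^ m) f) n) (conv-power-< m f n n<))

polRing : CommutativeRing 0ℓ 0ℓ
polRing = Series.seriesRing ℤ.+-*-commutativeRing (λ _ → ⊤) (λ _ _ → tt)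

-- The truncation sits in the equality: series are compared up to degree n only, so s^(n+1) equals 0
-- while the elements are still those of `PS`.
psRing : ℕ → CommutativeRing 0ℓ 0ℓ
psRing n = Series.seriesRing polRing (_≤ n) ℕ.≤-trans

module ℤ[t] = Series ℤ.+-*-commutativeRing (λ _ → ⊤) (λ _ _ → tt)
module Pol = CommutativeRing polRing
module PolΠ = BigOp Pol.*-commutativeMonoid

sumTo-sum : ∀ n f → sumTo n f ≡ ℤ[t].sum n f
sumTo-sum zero f = refl
sumTo-sum (suc n) f = cong (ℤ._+ f (suc n)) (sumTo-sum n f)

onePol-1 : onePol Pol.≈ Pol.1#
onePol-1 zero _ = refl
onePol-1 (suc k) _ = refl

prodPol-⨀ : ∀ {A : Set} (F : A → Pol) xs → prodPol (map F xs) Pol.≈ PolΠ.⨀ xs F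
prodPol-⨀ F [] = onePol-1
prodPol-⨀ F (x ∷ xs) = Pol.trans (λ k _ → sumTo-sum k _) (Pol.*-congˡ {F x} (prodPol-⨀ F xs))

powPol-count : ∀ {A : Set} u (q : A → Bool) xs → powPol u (length (filterᵇ q xs)) Pol.≈ PolΠ.⨀ xs (λ x → PolΠ.when (q x) u)
powPol-count u q [] = onePol-1
powPol-count u q (x ∷ xs) with q x
... | true  = Pol.trans (λ k _ → sumTo-sum k _) (Pol.*-congˡ {u} (powPol-count u q xs))
... | false = Pol.trans (powPol-count u q xs) (Pol.sym (Pol.*-identityˡ _))

-- The generating function as an operator product

module ArrayWeight (n r c : ℕ) (M : Vec (Vec ℕ c) r) (M∈ : M ∈ arrays n r c) (pp : isPlanePartition M ≡ true) where
  private
    col = proj₁ (isPlanePartition⁻ M pp)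
    row = proj₂ (isPlanePartition⁻ M pp)
    bound = ∈-arrays⁻ r M∈
  open AOf r c (entry M)
  open PlanePartition r c (entry M) (entry-outside M) col row
  open Diagonals r c (entry M) (entry-outside M) col row n bound public
  open BorderProduct Pol.*-commutativeMonoid oneMinusTPow
  open EndProduct Pol.*-commutativeMonoid oneMinusTPow

  A-product : Aπ M Pol.≈ PolΠ.⨀ (upTo (r + c)) (λ κ → PolΠ.⨀ (upTo n) (λ u → PolΠ.when (gained (κ , u)) (oneMinusTPow (m (suc κ) u))))
  A-product = Pol.trans (prodPol-⨀ P components) (Pol.trans (PolΠ.⨀-cong components (λ b _ → P-product b))
    (Pol.trans border-product end-product))
    where
    inB : Box → ℕ → Box → Bool
    inB b i x = isRep sameB x ∧ sameC b x ∧ (level x ≡ᵇ suc i)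
    factor : Box → ℕ → Pol
    factor b i = powPol (oneMinusTPow (suc i)) (nLev b (suc i))
    P-product : ∀ b → P b Pol.≈ PolΠ.⨀ (upTo r) (λ i → PolΠ.⨀ (boxes r c) (λ x → PolΠ.when (inB b i x) (oneMinusTPow (suc i))))
    P-product b = Pol.trans
      (Pol.reflexive (cong prodPol (sym (List.map-upTo (factor b) r))))
      (Pol.trans (prodPol-⨀ (factor b) (upTo r))
        (PolΠ.⨀-cong (upTo r) {factor b} {λ i → PolΠ.⨀ (boxes r c) (λ x → PolΠ.when (inB b i x) (oneMinusTPow (suc i)))}
          (λ i _ → powPol-count (oneMinusTPow (suc i)) (inB b i) (boxes r c))))

  size-total : size M ≡ BigOp.⨀ ℕ.+-0-commutativeMonoid (upTo (r + c)) (λ κ → weight (stateOf n M (suc κ)))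
  size-total = trans (List.foldr-cong (λ { (i , j) s → refl }) refl (boxes r c)) total-size

module GeneratingFunction (n : ℕ) (K : CommutativeRing 0ℓ 0ℓ) (t s : CommutativeRing.Carrier K) where
  open RingNotation K
  open Transfer K t
  open TransferProduct K t s
  open ChainSum K t s
  private
    module Sum = BigOp (CommutativeRing.+-commutativeMonoid K)
    module Prod = BigOp (CommutativeRing.*-commutativeMonoid K)

  gains-mult : ∀ N f g → gains (mult N f) (mult N g) ≈
               Prod.⨀ (upTo N) (λ u → gain (f (suc u) ∸ f (suc (suc u))) (g (suc u) ∸ g (suc (suc u))))
  gains-mult zero f g = ≈-refl
  gains-mult (suc N) f g = ≈-trans (*-comm _ _) (≈-trans (*-congʳ (gains-mult N f g)) (≈-sym (Prod.⨀-upTo-last _ N)))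

  ⨀-power : ∀ {A : Set} (xs : List A) (h : A → ℕ) → Prod.⨀ xs (λ x → s ^ h x) ≈ s ^ ℕΣ.⨀ xs h
  ⨀-power [] h = ≈-refl
  ⨀-power (x ∷ xs) h = ≈-trans (*-congˡ (⨀-power xs h)) (≈-sym (^-homo-* s (h x) _))

  -- Polynomials enter K as products of factors 1 - t^m, on which multiplicativity and `const-w`
  -- determine `const`.
  module _ (nilpotent : s ^ suc n ≈ 0#)
           (ι : ℕ → Carrier) (ι-inverse : ∀ m → ι (suc m) ⊛ (1# ⊖ s ^ suc m) ≈ 1#)
           (const : Pol → Carrier) (const-cong : ∀ {p q} → p Pol.≈ q → const p ≈ const q) (const-1 : const Pol.1# ≈ 1#)
           (const-* : ∀ p q → const (p Pol.* q) ≈ const p ⊛ const q)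
           (const-w : ∀ m → const (oneMinusTPow (suc m)) ≈ w (suc m)) where

    const-⨀ : ∀ {A : Set} (xs : List A) (f : A → Pol) → const (PolΠ.⨀ xs f) ≈ Prod.⨀ xs (const ∘ f)
    const-⨀ [] f = const-1
    const-⨀ (x ∷ xs) f = ≈-trans (const-* (f x) _) (*-congˡ (const-⨀ xs f))

    module _ (r c : ℕ) where
      array-weight : ∀ M → M ∈ arrays n r c → isPlanePartition M ≡ true → const (Aπ M) ⊛ s ^ size M ≈ chain-weight ∅ (chainOf n M)
      array-weight M M∈ pp = begin
        const (Aπ M) ⊛ s ^ size M
          ≈⟨ *-cong products (≈-trans (≈-reflexive (cong (s ^_) W.size-total)) (≈-sym (⨀-power (upTo (r + c)) (λ κ → weight (W.st (suc κ)))))) ⟩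
        Prod.⨀ (upTo (r + c)) (λ κ → gains (W.st κ) (W.st (suc κ))) ⊛ Prod.⨀ (upTo (r + c)) (λ κ → s ^ weight (W.st (suc κ)))
          ≈⟨ Prod.⨀-∙ (upTo (r + c)) _ _ ⟨
        Prod.⨀ (upTo (r + c)) (λ κ → gains (W.st κ) (W.st (suc κ)) ⊛ s ^ weight (W.st (suc κ)))
          ≈⟨ chain-weight-product (r + c) W.st ⟨
        chain-weight (W.st 0) (chain (r + c) W.st)
          ≈⟨ ≈-reflexive (cong (λ μ → chain-weight μ (chain (r + c) W.st)) W.st-first) ⟩
        chain-weight ∅ (chainOf n M) ∎
        where
        module W = ArrayWeight n r c M M∈ pp
        one-gain : ∀ p q → const (PolΠ.when (q ≡ᵇ suc p) (oneMinusTPow q)) ≈ gain p q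
        one-gain p zero = const-1
        one-gain p (suc q) with q ≡ᵇ p
        ... | true  = const-w q
        ... | false = const-1
        products : const (Aπ M) ≈ Prod.⨀ (upTo (r + c)) (λ κ → gains (W.st κ) (W.st (suc κ)))
        products = ≈-trans (const-cong W.A-product) (≈-trans (const-⨀ (upTo (r + c)) _) (Prod.⨀-cong (upTo (r + c)) (λ κ _ →
          ≈-trans (const-⨀ (upTo n) _) (≈-trans (Prod.⨀-cong (upTo n) (λ u _ → one-gain (W.m κ u) (W.m (suc κ) u)))
            (≈-sym (gains-mult n (W.cnt κ) (W.cnt (suc κ))))))))

      generating-function : Sum.⨀ (arrays n r c) (λ M → Sum.when (isPlanePartition M) (const (Aπ M) ⊛ s ^ size M)) ≈
                            Prod.⨀ (upTo r) (λ i → Prod.⨀ (upTo c) (λ j → (1# ⊖ t ⊛ s ^ (i + suc j)) ⊛ ι (i + suc j)))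
      generating-function = begin
        Sum.⨀ (arrays n r c) (λ M → Sum.when (isPlanePartition M) (const (Aπ M) ⊛ s ^ size M))
          ≈⟨ Sum.⨀-bij (List.≡-dec (Vec.≡-dec ℕ._≟_)) isPlanePartition (returns ∅) (chainOf n)
               (arrays-unique n r c) (chains-unique (direction r) (r + c) ∅)
               (λ M M∈ pp → proj₁ (AC.chainOf-∈ M M∈ pp) , proj₂ (AC.chainOf-∈ M M∈ pp) , array-weight M M∈ pp)
               AC.chainOf-onto AC.chainOf-injective ⟩
        Sum.⨀ (chains (direction r) (r + c) ∅) (λ ch → Sum.when (returns ∅ ch) (chain-weight ∅ ch))
          ≈⟨ chain-sum (direction r) (r + c) ∅ ⟨
        total (direction r) (r + c) ∅
          ≈⟨ total-direction r c ∅ ⟩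
        ascend r (descend c) ∅
          ≈⟨ partition-function n nilpotent ι ι-inverse r c ⟩
        Prod.⨀ (upTo r) (λ i → Prod.⨀ (upTo c) (λ j → (1# ⊖ t ⊛ s ^ (i + suc j)) ⊛ ι (i + suc j))) ∎
        where module AC = ArrayChain n r c

-- Comparison of coefficients with the two product formulas

bool-ext : ∀ {a b} → (a ≡ true → b ≡ true) → (b ≡ true → a ≡ true) → a ≡ b
bool-ext {true}  {b} f g = sym (f refl)
bool-ext {false} {true}  f g = g refl
bool-ext {false} {false} f g = refl

≡ᵇ-sym : ∀ m n → (m ≡ᵇ n) ≡ (n ≡ᵇ m)
≡ᵇ-sym m n = bool-ext (λ e → ≡ᵇ-complete (sym (≡ᵇ-sound {m} e))) (λ e → ≡ᵇ-complete (sym (≡ᵇ-sound {n} e)))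

≡ᵇ-false : ∀ {m n} → m ≢ n → (m ≡ᵇ n) ≡ false
≡ᵇ-false {m} {n} m≢n with m ≡ᵇ n in e
... | true  = contradiction (≡ᵇ-sound e) m≢n
... | false = refl

isMultiple : ℕ → ℕ → Bool
isMultiple m n = any (λ j → (j * m) ≡ᵇ n) (upTo (suc n))

-- Periodicity of the coefficients of 1/(1 - s^(m+1)).
isMultiple-+ : ∀ m n → isMultiple (suc m) (suc m + n) ≡ isMultiple (suc m) n
isMultiple-+ m n = bool-ext to from
  where
  to : isMultiple (suc m) (suc m + n) ≡ true → isMultiple (suc m) n ≡ true
  to e with any⁻ (λ j → (j * suc m) ≡ᵇ (suc m + n)) (upTo (suc (suc m + n))) e
  ... | zero  , _ , ()
  ... | suc j , _ , eq = any⁺ (λ j → (j * suc m) ≡ᵇ n)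
    (∈.∈-upTo⁺ (s≤s (ℕ.≤-trans (ℕ.m≤m*n j (suc m)) (ℕ.≤-reflexive jm≡n)))) (≡ᵇ-complete jm≡n)
    where
    jm≡n : j * suc m ≡ n
    jm≡n = ℕ.+-cancelˡ-≡ (suc m) (j * suc m) n (≡ᵇ-sound {suc j * suc m} {suc m + n} eq)
  from : isMultiple (suc m) n ≡ true → isMultiple (suc m) (suc m + n) ≡ true
  from e with any⁻ (λ j → (j * suc m) ≡ᵇ n) (upTo (suc n)) e
  ... | j , j∈ , eq = any⁺ (λ j → (j * suc m) ≡ᵇ (suc m + n))
    (∈.∈-upTo⁺ (s≤s (s≤s (ℕ.≤-trans (ℕ.≤-pred (∈.∈-upTo⁻ j∈)) (ℕ.m≤n+m n m)))))
    (≡ᵇ-complete (cong (suc m +_) (≡ᵇ-sound {j * suc m} {n} eq)))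

isMultiple-< : ∀ {m n} → suc n < m → isMultiple m (suc n) ≡ false
isMultiple-< {m} {n} n< with isMultiple m (suc n) in e
... | false = refl
... | true with any⁻ (λ j → (j * m) ≡ᵇ suc n) (upTo (suc (suc n))) e
... | zero  , _ , ()
... | suc j , _ , eq = contradiction n< (ℕ.≤⇒≯ (ℕ.≤-trans (ℕ.m≤m+n m (j * m)) (ℕ.≤-reflexive (≡ᵇ-sound {suc j * m} eq))))

module RingLemmas (K : CommutativeRing 0ℓ 0ℓ) where
  open RingNotation K
  open DifferenceSolver K using (solve; _:=_; _:*_; _:-_; one)

  expand-complement : ∀ a x → a ⊛ (1# ⊖ x) ≈ a ⊖ x ⊛ a
  expand-complement = solve 2 (λ a x → a :* (one :- x) := a :- x :* a) (CommutativeRing.refl K)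

module Coefficients (n : ℕ) where
  module PS = Series polRing (_≤ n) ℕ.≤-trans
  module K = CommutativeRing (psRing n)
  module KΠ = BigOp K.*-commutativeMonoid
  module KΣ = BigOp K.+-commutativeMonoid
  open Relation.Binary.Reasoning.Setoid K.setoid
  open Algebra.Properties.CommutativeSemiring.Exp K.commutativeSemiring using (_^_)
  open Algebra.Properties.CommutativeSemiring.Exp Pol.commutativeSemiring using () renaming (_^_ to _^P_)

  τ : Pol
  τ = ℤ[t].indeterminate

  s t : PS
  s = PS.indeterminate
  t = PS.constant τ

  const-cong : ∀ {p q} → p Pol.≈ q → PS.constant p K.≈ PS.constant q
  const-cong e zero _ = e
  const-cong e (suc k) _ = λ _ _ → refl

  const-* : ∀ p q → PS.constant (p Pol.* q) K.≈ PS.constant p K.* PS.constant q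
  const-* p q zero _ = λ _ _ → refl
  const-* p q (suc k) _ = Pol.sym (Pol.trans (PS.conv-constant p (PS.constant q) (suc k)) (Pol.zeroʳ p))

  const-^ : ∀ m → t ^ m K.≈ PS.constant (τ ^P m)
  const-^ zero = K.refl {K.1#}
  const-^ (suc m) = begin
    t K.* t ^ m ≈⟨ K.*-congˡ {t} (const-^ m) ⟩
    t K.* PS.constant (τ ^P m) ≈⟨ const-* τ (τ ^P m) ⟨
    PS.constant (τ ^P suc m) ∎

  minus-pick : ∀ b → (if b then -1ℤ else 0ℤ) ≡ 0ℤ ℤ.+ ℤ.- (if b then 1ℤ else 0ℤ)
  minus-pick true  = refl
  minus-pick false = refl

  const-w : ∀ m → PS.constant (oneMinusTPow (suc m)) K.≈ K.1# K.- t ^ suc m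
  const-w m k k≤ i _ = trans (pointwise k i) (cong (λ z → K.1# k i ℤ.+ ℤ.- z) (sym (const-^ (suc m) k k≤ i tt)))
    where
    pointwise : ∀ k i → PS.constant (oneMinusTPow (suc m)) k i ≡ K.1# k i ℤ.+ ℤ.- PS.constant (τ ^P suc m) k i
    pointwise zero zero = cong (λ z → 1ℤ ℤ.+ ℤ.- z) (sym (ℤ[t].power-coefficient (suc m) zero))
    pointwise zero (suc i) = trans (minus-pick (i ≡ᵇ m)) (cong (λ z → 0ℤ ℤ.+ ℤ.- z) (sym (ℤ[t].power-coefficient (suc m) (suc i))))
    pointwise (suc k) i = refl

  pickP : Bool → Pol
  pickP b = if b then Pol.1# else Pol.0#

  nilpotent : s ^ suc n K.≈ K.0#
  nilpotent k k≤ = Pol.trans (PS.power-coefficient (suc n) k) (Pol.reflexive (cong pickP (≡ᵇ-false (ℕ.<⇒≢ (s≤s k≤)))))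

  -- The product is ι minus its shift by m + 1. From degree m + 1 on the two cancel by periodicity;
  -- below, the shift vanishes and ι contributes just its constant term 1.
  ι-inverse : ∀ m → invOneMinusSPow (suc m) K.* (K.1# K.- s ^ suc m) K.≈ K.1#
  ι-inverse m = K.trans {ι K.* (K.1# K.- x)} {ι K.- x K.* ι} {K.1#} (RingLemmas.expand-complement (psRing n) ι x) pointwise
    where
    ι x : PS
    ι = invOneMinusSPow (suc m)
    x = s ^ suc m
    above : ∀ k → Pol._≈_ (ι (suc m + k) Pol.- PS.conv x ι (suc m + k)) Pol.0#
    above k = Pol.trans (Pol.+-congˡ {ι (suc m + k)} (Pol.-‿cong (PS.conv-power-≥ (suc m) ι k)))
      (Pol.trans (Pol.reflexive (cong (λ b → (if b then onePol else zeroPol) Pol.- ι k) (isMultiple-+ m k))) (Pol.-‿inverseʳ (ι k)))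
    below-m : ∀ k → k < suc m → (ι k Pol.- PS.conv x ι k) Pol.≈ K.1# k
    below-m zero k< = Pol.trans (Pol.+-cong {ι zero} onePol-1 (Pol.-‿cong (PS.conv-power-< (suc m) ι zero k<)))
      (λ i _ → ℤ.+-identityʳ (Pol.1# i))
    below-m (suc k) k< = Pol.trans (Pol.+-cong {ι (suc k)} (Pol.reflexive (cong (λ b → if b then onePol else zeroPol) (isMultiple-< k<)))
      (Pol.-‿cong (PS.conv-power-< (suc m) ι (suc k) k<))) (λ i _ → refl)
    pointwise : (ι K.- x K.* ι) K.≈ K.1#
    pointwise k _ with k ℕ.<? suc m
    ... | yes k< = below-m k k<
    ... | no k≮ = subst (λ k → (ι k Pol.- PS.conv x ι k) Pol.≈ K.1# k) (ℕ.m+[n∸m]≡n (ℕ.≮⇒≥ k≮)) (above (k ∸ suc m))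

  *S-conv : ∀ f g m i → (f *S g) m i ≡ PS.conv f g m i
  *S-conv f g m i = go m
    where
    go : ∀ l → sumTo l (λ a → (f a *P g (m ∸ a)) i) ≡ PS.sum l (λ a → f a Pol.* g (m ∸ a)) i
    go zero = sumTo-sum i _
    go (suc l) = cong₂ ℤ._+_ (go l) (sumTo-sum i _)

  *S-* : ∀ f g → (f *S g) K.≈ (f K.* g)
  *S-* f g m _ i _ = *S-conv f g m i

  onePS-1 : onePS K.≈ K.1#
  onePS-1 zero _ = onePol-1
  onePS-1 (suc k) _ = λ _ _ → refl

  prodPS-⨀ : ∀ {A : Set} (F : A → PS) xs → prodPS (map F xs) K.≈ KΠ.⨀ xs F
  prodPS-⨀ F [] = onePS-1
  prodPS-⨀ F (x ∷ xs) = begin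
    F x *S prodPS (map F xs) ≈⟨ *S-* (F x) (prodPS (map F xs)) ⟩
    F x K.* prodPS (map F xs) ≈⟨ K.*-congˡ {F x} (prodPS-⨀ F xs) ⟩
    F x K.* KΠ.⨀ xs F ∎

  powPS-⨀ : ∀ (f : PS) m → powPS f m K.≈ KΠ.⨀ (upTo m) (λ _ → f)
  powPS-⨀ f zero = onePS-1
  powPS-⨀ f (suc m) = begin
    f *S powPS f m ≈⟨ *S-* f (powPS f m) ⟩
    f K.* powPS f m ≈⟨ K.*-congˡ {f} (powPS-⨀ f m) ⟩
    f K.* KΠ.⨀ (upTo m) (λ _ → f) ≈⟨ K.*-congˡ {f} (KΠ.⨀-applyUpTo (λ _ → f) suc m) ⟨
    KΠ.⨀ (upTo (suc m)) (λ _ → f) ∎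

  factor : ℕ → PS
  factor m = oneMinusTSPow m *S invOneMinusSPow m

  oneMinusTSPow-K : ∀ m → oneMinusTSPow (suc m) K.≈ (K.1# K.- t K.* s ^ suc m)
  oneMinusTSPow-K m k _ i _ = trans (pointwise k i) (cong (λ z → K.1# k i ℤ.+ ℤ.- z)
      (sym (trans (PS.conv-constant τ (s ^ suc m) k i tt) (trans (Pol.*-congˡ {τ} (PS.power-coefficient (suc m) k) i tt) (scaled (k ≡ᵇ suc m) i)))))
    where
    scaled : ∀ b i → (τ Pol.* pickP b) i ≡ (if b then τ else Pol.0#) i
    scaled true  i = Pol.*-identityʳ τ i tt
    scaled false i = Pol.zeroʳ τ i tt
    pointwise : ∀ k i → oneMinusTSPow (suc m) k i ≡ K.1# k i ℤ.+ ℤ.- (if k ≡ᵇ suc m then τ else Pol.0#) i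
    pointwise zero zero = refl
    pointwise zero (suc i) = refl
    pointwise (suc k) i with k ≡ᵇ m
    pointwise (suc k) i | false = refl
    pointwise (suc k) zero | true  = refl
    pointwise (suc k) (suc zero) | true  = refl
    pointwise (suc k) (suc (suc i)) | true  = refl

  factor-K : ∀ m → factor (suc m) K.≈ ((K.1# K.- t K.* s ^ suc m) K.* invOneMinusSPow (suc m))
  factor-K m = begin
    factor (suc m) ≈⟨ *S-* (oneMinusTSPow (suc m)) (invOneMinusSPow (suc m)) ⟩
    oneMinusTSPow (suc m) K.* invOneMinusSPow (suc m) ≈⟨ K.*-congʳ {invOneMinusSPow (suc m)} (oneMinusTSPow-K m) ⟩
    (K.1# K.- t K.* s ^ suc m) K.* invOneMinusSPow (suc m) ∎

  -- Beyond its constant term the factor starts in degree m + 1 > n. This is what allows the n × n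
  -- square to be cut off along its main antidiagonal.
  factor-trivial : ∀ m → n ≤ m → factor (suc m) K.≈ K.1#
  factor-trivial m n≤m = begin
    factor (suc m) ≈⟨ *S-* (oneMinusTSPow (suc m)) (invOneMinusSPow (suc m)) ⟩
    oneMinusTSPow (suc m) K.* invOneMinusSPow (suc m) ≈⟨ K.*-cong {oneMinusTSPow (suc m)} {K.1#} {invOneMinusSPow (suc m)} numerator denominator ⟩
    K.1# K.* K.1# ≈⟨ K.*-identityˡ K.1# ⟩
    K.1# ∎
    where
    numerator : oneMinusTSPow (suc m) K.≈ K.1#
    numerator zero _ = onePol-1
    numerator (suc k) k≤ i _ rewrite ≡ᵇ-false {k} {m} (λ { refl → ℕ.<-irrefl refl (ℕ.≤-trans k≤ n≤m) }) = refl
    denominator : invOneMinusSPow (suc m) K.≈ K.1#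
    denominator zero _ = onePol-1
    denominator (suc k) k≤ = Pol.reflexive (cong (λ b → if b then onePol else zeroPol) (isMultiple-< (s≤s (ℕ.≤-trans k≤ n≤m))))

  rhsBox-⨀ : ∀ r c → rhsBox r c K.≈ KΠ.⨀ (upTo r) (λ i → KΠ.⨀ (upTo c) (λ j → factor (suc (i + j))))
  rhsBox-⨀ r c = begin
    rhsBox r c ≡⟨ cong prodPS (List.map-id factors) ⟨
    prodPS (map id factors) ≈⟨ prodPS-⨀ id factors ⟩
    KΠ.⨀ factors id ≈⟨ KΠ.⨀-concatMap row (upTo r) id ⟩
    KΠ.⨀ (upTo r) (λ i → KΠ.⨀ (row i) id)
      ≈⟨ KΠ.⨀-cong (upTo r) (λ i _ → KΠ.⨀-map (λ j → factor (suc (i + j))) (upTo c) id) ⟩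
    KΠ.⨀ (upTo r) (λ i → KΠ.⨀ (upTo c) (λ j → factor (suc (i + j)))) ∎
    where
    row : ℕ → List PS
    row i = map (λ j → factor (suc (i + j))) (upTo c)
    factors : List PS
    factors = concatMap row (upTo r)

  rhsAll-⨀ : prodPS (applyUpTo (λ m → powPS (factor (suc m)) (suc m)) n) K.≈ KΠ.⨀ (upTo n) (λ m → KΠ.⨀ (upTo (suc m)) (λ _ → factor (suc m)))
  rhsAll-⨀ = begin
    prodPS (applyUpTo power n) ≡⟨ cong prodPS (List.map-upTo power n) ⟨
    prodPS (map power (upTo n)) ≈⟨ prodPS-⨀ power (upTo n) ⟩
    KΠ.⨀ (upTo n) power ≈⟨ KΠ.⨀-cong (upTo n) (λ m _ → powPS-⨀ (factor (suc m)) (suc m)) ⟩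
    KΠ.⨀ (upTo n) (λ m → KΠ.⨀ (upTo (suc m)) (λ _ → factor (suc m))) ∎
    where
    power : ℕ → PS
    power m = powPS (factor (suc m)) (suc m)

  -- The antidiagonal i + j = m has m + 1 boxes, which yields the exponent m + 1 of the factor
  -- belonging to s^(m+1).
  rhsBox-rhsAll : rhsBox n n n Pol.≈ rhsAll n
  rhsBox-rhsAll = Pol.trans (rhsBox-⨀ n n n ℕ.≤-refl)
    (Pol.trans (KΠ.⨀-antidiagonals n (λ m → factor (suc m)) factor-trivial n ℕ.≤-refl) (Pol.sym (rhsAll-⨀ n ℕ.≤-refl)))

  monomial : ∀ {r c} → Vec (Vec ℕ c) r → PS
  monomial M = KΣ.when (isPlanePartition M) (PS.constant (Aπ M) K.* s ^ size M)

  -- The right side runs over plane partitions of every size with entries up to n; taking the n-th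
  -- coefficient of A_π s^|π| does the work of the test on the size.
  genBox-⨀ : ∀ r c → genBox r c n Pol.≈ KΣ.⨀ (arrays n r c) monomial n
  genBox-⨀ r c = go (arrays n r c)
    where
    term : ∀ M → (if isPlanePartition M ∧ (size M ≡ᵇ n) then Aπ M else zeroPol) Pol.≈
                 monomial M n
    term M with isPlanePartition M
    ... | false = λ _ _ → refl
    ... | true  = Pol.sym (Pol.trans (PS.conv-constant (Aπ M) (s ^ size M) n)
        (Pol.trans (Pol.*-congˡ {Aπ M} (Pol.trans (PS.power-coefficient (size M) n) (Pol.reflexive (cong pickP (≡ᵇ-sym n (size M))))))
          (scaled (size M ≡ᵇ n))))
      where
      scaled : ∀ b → (Aπ M Pol.* pickP b) Pol.≈ (if b then Aπ M else zeroPol)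
      scaled true  = Pol.*-identityʳ (Aπ M)
      scaled false = Pol.zeroʳ (Aπ M)
    go : ∀ Ms → sumPol (map (λ M → if isPlanePartition M ∧ (size M ≡ᵇ n) then Aπ M else zeroPol) Ms) Pol.≈
                KΣ.⨀ Ms monomial n
    go [] = λ _ _ → refl
    go (M ∷ Ms) = λ i _ → cong₂ ℤ._+_ (term M i tt) (go Ms i tt)

  genBox-rhsBox : ∀ r c → genBox r c n Pol.≈ rhsBox r c n
  genBox-rhsBox r c = Pol.trans (genBox-⨀ r c) (equal n ℕ.≤-refl)
    where
    ratio : ℕ → ℕ → PS
    ratio i j = (K.1# K.- t K.* s ^ (i + suc j)) K.* invOneMinusSPow (i + suc j)
    equal : KΣ.⨀ (arrays n r c) monomial K.≈ rhsBox r c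
    ratio-factor : ∀ i j → ratio i j K.≈ factor (suc (i + j))
    ratio-factor i j = subst (λ m → ((K.1# K.- t K.* s ^ m) K.* invOneMinusSPow m) K.≈ factor (suc (i + j))) (sym (ℕ.+-suc i j))
      (K.sym {factor (suc (i + j))} {(K.1# K.- t K.* s ^ suc (i + j)) K.* invOneMinusSPow (suc (i + j))} (factor-K (i + j)))
    equal = begin
      KΣ.⨀ (arrays n r c) monomial
        ≈⟨ GeneratingFunction.generating-function n (psRing n) t s nilpotent invOneMinusSPow ι-inverse
             PS.constant const-cong (K.refl {K.1#}) const-* const-w r c ⟩
      KΠ.⨀ (upTo r) (λ i → KΠ.⨀ (upTo c) (ratio i))
        ≈⟨ KΠ.⨀-cong (upTo r) (λ i _ → KΠ.⨀-cong (upTo c) (λ j _ → ratio-factor i j)) ⟩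
      KΠ.⨀ (upTo r) (λ i → KΠ.⨀ (upTo c) (λ j → factor (suc (i + j))))
        ≈⟨ rhsBox-⨀ r c ⟨
      rhsBox r c ∎

theoremB : ((r c : ℕ) → 1 ≤ r → 1 ≤ c → genBox r c ≋ rhsBox r c) × (genAll ≋ rhsAll)
theoremB =
  -- The truncation degree is the degree n of the coefficient under comparison.
  (λ r c _ _ n k → Coefficients.genBox-rhsBox n r c k tt) ,
  (λ n k → trans (Coefficients.genBox-rhsBox n n n k tt) (Coefficients.rhsBox-rhsAll n k tt))
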